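{- Let $r,k$ be non-negative integers and $x$ an indeterminate. The bilinear product on the $\mathbb{C}(x)$-vector space $\mathrm{MP}_{r,k}(x)$ with basis $\{X_\pi : \pi\in\Pi_{r,k}\}$ determined by $$X_\pi\cdot X_\gamma=\sum_{\nu} a_\nu\, b_\nu(x)\, X_{\nu|_{[k]\cup[\bar{\bar k}]}}\qquad(\pi,\gamma\in\Pi_{r,k}),$$ where the sum is over all multiset partitions $\nu\in\Gamma_{r,k}$ such that $\nu|_{[k]\cup[\bar k]}=\pi$ and $\nu|_{[\bar k]\cup[\bar{\bar k}]}=\bar\gamma$, is associative.
   Context: Let $[k]=\{1,\dots,k\}$, $[\bar k]=\{\bar1,\dots,\bar k\}$, $[\bar{\bar k}]=\{\bar{\bar1},\dots,\bar{\bar k}\}$ be three disjoint alphabets. A multiset partition of a multiset $S$ is a multiset of non-empty multisets (its blocks) whose multiset union is $S$. Its length $\ell(\pi)$ is the number of blocks counted with multiplicity; $m(\pi)!$ is the product, over the distinct blocks $T$ of $\pi$, of $m_T(\pi)!$, where $m_T(\pi)$ is the multiplicity of $T$ in $\pi$. $\Pi_{r,k}$ is the set of all multiset partitions of multisets consisting of $r$ elements from $[k]$ and $r$ elements from $[\bar k]$ (counted with multiplicity). $\Gamma_{r,k}$ is the set of all multiset partitions of multisets consisting of $r$ elements from each of $[k]$, $[\bar k]$, $[\bar{\bar k}]$. For a set $A$, $\nu|_A$ is the (possibly empty) multiset partition obtained by restricting each block of $\nu$ to its elements in $A$ and discarding the empty results. For $\gamma\in\Pi_{r,k}$, $\bar\gamma$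 is obtained by adding one bar to every entry, so $\bar\gamma$ has entries in $[\bar k]\cup[\bar{\bar k}]$. For $\nu\in\Gamma_{r,k}$, the multiset partition $\nu|_{[k]\cup[\bar{\bar k}]}$ is regarded as an element of $\Pi_{r,k}$ by removing one bar from each doubly barred entry. For $\nu\in\Gamma_{r,k}$ and each distinct block $S$ of $\nu|_{[k]\cup[\bar{\bar k}]}$, let $\nu_S$ be the multiset of blocks $T$ of $\nu$ (with multiplicity) with $T|_{[k]\cup[\bar{\bar k}]}=S$. Let $\beta$ be the (possibly empty) multiset of the blocks of $\nu$ all of whose elements lie in $[\bar k]$. Define $$a_\nu=\prod_S\frac{\ell(\nu_S)!}{m(\nu_S)!},\qquad b_\nu(x)=\frac{(x-\ell(\nu|_{[k]\cup[\bar{\bar k}]}))_{\ell(\beta)}}{m(\beta)!},$$ where the product is over the distinct blocks $S$ of $\nu|_{[k]\cup[\bar{\bar k}]}$ and $(a)_s=a(a-1)\cdots(a-s+1)$. An empty sum is $0$. -}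

module Defs where

open import Algebra.Bundles
  using (CommutativeRing; CommutativeSemigroup; CommutativeMonoid)
import Algebra.Properties.CommutativeSemigroup as CSProps
import Algebra.Properties.Ring as RingProperties
import Algebra.Solver.Ring.NaturalCoefficients.Default as SemiringSolver
open import Algebra.Structures using (IsCommutativeRing; IsCommutativeSemigroup)
open import Data.Bool.Base using (true; false)
open import Data.Empty using (⊥-elim)
open import Data.Fin.Base using (Fin; zero; suc)
open import Data.Fin.Patterns using (0F; 1F; 2F)
import Data.Fin.Properties as Finₚ
open import Data.Integer.Base using (+_)
open import Data.List.Base as List
  using (List; []; _∷_; [_]; _++_; map; filter; length; concatMap; upTo; deduplicate;
         cartesianProductWith; foldr)
import Data.List.Properties as Listₚ
import Data.List.Membership.DecPropositional as DecMembership
open import Data.List.Membership.Propositional using (_∈_; lose)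
open import Data.List.Membership.Propositional.Properties
  using (∈-∃++; ∈-++⁺ˡ; ∈-++⁺ʳ; ∈-++⁻; ∈-map⁺; ∈-map⁻; ∈-filter⁺; ∈-upTo⁺;
         ∈-cartesianProductWith⁺; ∈-concatMap⁺)
open import Data.List.Relation.Binary.Permutation.Propositional
  using (_↭_; ↭-refl; ↭-sym; ↭-trans; prep)
import Data.List.Relation.Binary.Permutation.Propositional.Properties as ↭ₚ
open ↭ₚ using (shift; drop-∷; ∈-resp-↭; ↭-length; All-resp-↭)
open import Data.List.Relation.Unary.All as All using (All; []; _∷_)
import Data.List.Relation.Unary.All.Properties as Allₚ
open import Data.List.Relation.Unary.AllPairs as AllPairs using (AllPairs; []; _∷_)
import Data.List.Relation.Unary.AllPairs.Properties as AllPairsₚ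
open import Data.List.Relation.Unary.Any using (Any; here; there)
import Data.List.Relation.Unary.Enumerates.Setoid as SetoidEnumerates
open import Data.List.Relation.Unary.Unique.Propositional using (Unique)
import Data.List.Relation.Unary.Unique.Propositional.Properties as Uniqueₚ
import Data.List.Relation.Unary.Unique.Setoid as SetoidUnique
open import Data.Nat.Base as ℕ using (ℕ; zero; suc; _!; z≤n; s≤s)
open import Data.Nat.ListAction using (sum; product)
import Data.Nat.ListAction.Properties as ListActionₚ
import Data.Nat.Properties as ℕ
open import Data.Product using (∃; _×_; _,_; proj₁; proj₂; map₁)
open import Data.Rational.Base as ℚ using (ℚ; 0ℚ; 1ℚ)
import Data.Rational.Properties as ℚₚ
open import Data.Rational.Solver using (module +-*-Solver)
open import Data.Sum.Base using (inj₁; inj₂)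
open import Data.Vec.Base as Vec using (Vec; []; _∷_)
import Data.Vec.Properties as Vecₚ
open import Function.Base using (_∘_)
open import Level using (Level; 0ℓ; _⊔_)
open import Relation.Binary.Bundles using (Setoid)
open import Relation.Binary.Definitions using (DecidableEquality)
open import Relation.Binary.PropositionalEquality as ≡ using (_≡_; _≢_)
import Relation.Binary.Reasoning.Setoid as SetoidReasoning
open import Relation.Nullary using (¬_; Dec; yes; no; ¬?; does)
open import Relation.Nullary.Decidable using (map′; _×-dec_)
open import Relation.Unary using (Decidable)

-- Cauchy sequences of rationals modulo null sequences.
module Reals where
  open import Data.Rational.Base using (_+_; _*_; -_; _-_; _<_; ½; ∣_∣)
  open +-*-Solver using (solve; _:=_; _:+_; _:*_; :-_)

  Cauchy : (ℕ → ℚ) → Set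
  Cauchy a = ∀ ε → 0ℚ < ε → ∃ λ N → ∀ m n → N ℕ.≤ m → N ℕ.≤ n → ∣ a m - a n ∣ < ε

  record ℝ : Set where
    no-eta-equality
    field
      seq    : ℕ → ℚ
      cauchy : Cauchy seq
  open ℝ public

  infix 4 _≈ʳ_
  record _≈ʳ_ (x y : ℝ) : Set where
    constructor null
    field
      vanishes : ∀ ε → 0ℚ < ε → ∃ λ N → ∀ n → N ℕ.≤ n → ∣ seq x n - seq y n ∣ < ε
  open _≈ʳ_

  private
    -- Families of rationals tending to 0 along i : I; `Late N i` says that i is
    -- beyond N.  Used for I = ℕ and for pairs of naturals.
    module Small {I : Set} (Late : ℕ → I → Set)
                 (late-≤ : ∀ {M N i} → M ℕ.≤ N → Late N i → Late M i) where

      Vanishing : (I → ℚ) → Set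
      Vanishing f = ∀ ε → 0ℚ < ε → ∃ λ N → ∀ i → Late N i → ∣ f i ∣ < ε

      Bounded : (I → ℚ) → Set
      Bounded f = ∃ λ B → 0ℚ < B × ∃ λ N → ∀ i → Late N i → ∣ f i ∣ < B

      resp : ∀ {f g} → (∀ i → f i ≡ g i) → Vanishing f → Vanishing g
      resp e v ε ε>0 with v ε ε>0
      ... | N , h = N , λ i l → ≡.subst (λ t → ∣ t ∣ < ε) (e i) (h i l)

      zeroV : Vanishing (λ _ → 0ℚ)
      zeroV ε ε>0 = 0 , λ _ _ → ε>0

      half+half : ∀ ε → ½ * ε + ½ * ε ≡ ε
      half+half ε = ≡.trans (≡.sym (ℚₚ.*-distribʳ-+ ε ½ ½)) (ℚₚ.*-identityˡ ε)

      0<half : ∀ {ε} → 0ℚ < ε → 0ℚ < ½ * ε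
      0<half {ε} ε>0 = ≡.subst (λ t → t < ½ * ε) (ℚₚ.*-zeroʳ ½) (ℚₚ.*-monoʳ-<-pos ½ ε>0)

      plus : ∀ {f g} → Vanishing f → Vanishing g → Vanishing (λ i → f i + g i)
      plus {f} {g} u v ε ε>0 with u (½ * ε) (0<half ε>0) | v (½ * ε) (0<half ε>0)
      ... | M , h | N , k = M ℕ.⊔ N , λ i l →
        ℚₚ.≤-<-trans (ℚₚ.∣p+q∣≤∣p∣+∣q∣ (f i) (g i))
          (≡.subst (∣ f i ∣ + ∣ g i ∣ <_) (half+half ε)
            (ℚₚ.+-mono-< (h i (late-≤ (ℕ.m≤m⊔n M N) l)) (k i (late-≤ (ℕ.m≤n⊔m M N) l))))

      neg : ∀ {f} → Vanishing f → Vanishing (λ i → - f i)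
      neg {f} v ε ε>0 with v ε ε>0
      ... | N , h = N , λ i l → ≡.subst (_< ε) (≡.sym (ℚₚ.∣-p∣≡∣p∣ (f i))) (h i l)

      times : ∀ {f g} → Bounded f → Vanishing g → Vanishing (λ i → f i * g i)
      times {f} {g} (B , B>0 , M , h) v ε ε>0 = M ℕ.⊔ N , λ i l →
        ≡.subst (_< ε) (≡.sym (ℚₚ.∣p*q∣≡∣p∣*∣q∣ (f i) (g i)))
          (ℚₚ.≤-<-trans
            (ℚₚ.*-monoʳ-≤-nonNeg ∣ g i ∣ {{ℚₚ.∣-∣-nonNeg (g i)}}
              (ℚₚ.<⇒≤ (h i (late-≤ (ℕ.m≤m⊔n M N) l))))
            (≡.subst (B * ∣ g i ∣ <_) B*δ≡ε
              (ℚₚ.*-monoʳ-<-pos B (proj₂ small i (late-≤ (ℕ.m≤n⊔m M N) l)))))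
        where
        instance
          B-pos : ℚ.Positive B
          B-pos = ℚ.positive B>0
          B-nonZero : ℚ.NonZero B
          B-nonZero = ℚₚ.pos⇒nonZero B
          1/B-pos : ℚ.Positive (ℚ.1/ B)
          1/B-pos = ℚₚ.1/pos⇒pos B
        δ = ℚ.1/ B * ε
        δ>0 : 0ℚ < δ
        δ>0 = ≡.subst (_< δ) (ℚₚ.*-zeroʳ (ℚ.1/ B)) (ℚₚ.*-monoʳ-<-pos (ℚ.1/ B) ε>0)
        small = v δ δ>0
        N = proj₁ small
        B*δ≡ε : B * δ ≡ ε
        B*δ≡ε = ≡.trans (≡.sym (ℚₚ.*-assoc B (ℚ.1/ B) ε))
          (≡.trans (≡.cong (_* ε) (ℚₚ.*-inverseʳ B)) (ℚₚ.*-identityˡ ε))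

    module Seq  = Small (ℕ._≤_) ℕ.≤-trans
    module Pair = Small {ℕ × ℕ} (λ N (m , n) → N ℕ.≤ m × N ℕ.≤ n)
                        (λ M≤N (p , q) → ℕ.≤-trans M≤N p , ℕ.≤-trans M≤N q)

    differences : (ℕ → ℚ) → ℕ × ℕ → ℚ
    differences a (m , n) = a m - a n

    pairwise : ∀ x → Pair.Vanishing (differences (seq x))
    pairwise x ε ε>0 with cauchy x ε ε>0
    ... | N , h = N , λ (m , n) (p , q) → h m n p q

    fromPairwise : ∀ a → Pair.Vanishing (differences a) → Cauchy a
    fromPairwise a v ε ε>0 =
      proj₁ (v ε ε>0) , λ m n p q → proj₂ (v ε ε>0) (m , n) (p , q)

    bounded : ∀ x → Seq.Bounded (seq x)
    bounded x with cauchy x 1ℚ (ℚₚ.positive⁻¹ 1ℚ)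
    ... | N , h = B , ℚₚ.≤-<-trans (ℚₚ.0≤∣p∣ (a N)) below , N , λ n l →
      ≡.subst (λ t → ∣ t ∣ < B) (x-y+y (a n) (a N))
        (ℚₚ.≤-<-trans (ℚₚ.∣p+q∣≤∣p∣+∣q∣ (a n - a N) (a N))
          (ℚₚ.+-monoˡ-< ∣ a N ∣ (h n N l ℕ.≤-refl)))
      where
      a = seq x
      B = 1ℚ + ∣ a N ∣
      below : ∣ a N ∣ < B
      below = ≡.subst (_< B) (ℚₚ.+-identityˡ ∣ a N ∣)
        (ℚₚ.+-monoˡ-< ∣ a N ∣ (ℚₚ.positive⁻¹ 1ℚ))
      x-y+y : ∀ p q → p - q + q ≡ p
      x-y+y p q = ≡.trans (ℚₚ.+-assoc p (- q) q)
        (≡.trans (≡.cong (λ t → p + t) (ℚₚ.+-inverseˡ q)) (ℚₚ.+-identityʳ p))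

    boundedˡ : ∀ x → Pair.Bounded (λ (m , n) → seq x m)
    boundedˡ x = let B , B>0 , N , h = bounded x in
      B , B>0 , N , λ (m , n) (p , q) → h m p

    boundedʳ : ∀ x → Pair.Bounded (λ (m , n) → seq x n)
    boundedʳ x = let B , B>0 , N , h = bounded x in
      B , B>0 , N , λ (m , n) (p , q) → h n q

    +-minus : ∀ p q r s → (p - q) + (r - s) ≡ (p + r) - (q + s)
    +-minus = solve 4 (λ p q r s →
      (p :+ (:- q)) :+ (r :+ (:- s)) := (p :+ r) :+ (:- (q :+ s))) ≡.refl

    *-minus : ∀ p q r s → p * (r - s) + s * (p - q) ≡ p * r - q * s
    *-minus = solve 4 (λ p q r s →
      p :* (r :+ (:- s)) :+ s :* (p :+ (:- q)) := p :* r :+ (:- (q :* s))) ≡.refl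

    neg-minus : ∀ p q → - (p - q) ≡ - p - - q
    neg-minus = solve 2 (λ p q → :- (p :+ (:- q)) := (:- p) :+ (:- (:- q))) ≡.refl

    swap-minus : ∀ p q → - (p - q) ≡ q - p
    swap-minus = solve 2 (λ p q → :- (p :+ (:- q)) := q :+ (:- p)) ≡.refl

    chain-minus : ∀ p q r → (p - q) + (q - r) ≡ p - r
    chain-minus = solve 3 (λ p q r →
      (p :+ (:- q)) :+ (q :+ (:- r)) := p :+ (:- r)) ≡.refl

  infixl 6 _+ʳ_
  infixl 7 _*ʳ_
  _+ʳ_ _*ʳ_ : ℝ → ℝ → ℝ
  (x +ʳ y) .seq n  = seq x n + seq y n
  (x +ʳ y) .cauchy = fromPairwise (λ n → seq x n + seq y n) (Pair.resp
    (λ (m , n) → +-minus (seq x m) (seq x n) (seq y m) (seq y n))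
    (Pair.plus (pairwise x) (pairwise y)))
  (x *ʳ y) .seq n  = seq x n * seq y n
  (x *ʳ y) .cauchy = fromPairwise (λ n → seq x n * seq y n) (Pair.resp
    (λ (m , n) → *-minus (seq x m) (seq x n) (seq y m) (seq y n))
    (Pair.plus (Pair.times (boundedˡ x) (pairwise y))
               (Pair.times (boundedʳ y) (pairwise x))))

  -ʳ_ : ℝ → ℝ
  (-ʳ x) .seq n  = - seq x n
  (-ʳ x) .cauchy = fromPairwise (λ n → - seq x n)
    (Pair.resp (λ (m , n) → neg-minus (seq x m) (seq x n)) (Pair.neg (pairwise x)))

  fromℚ : ℚ → ℝ
  fromℚ q .seq _  = q
  fromℚ q .cauchy = fromPairwise (λ _ → q) (Pair.resp (λ _ → ≡.sym (ℚₚ.+-inverseʳ q)) Pair.zeroV)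

  private
    pointwise : ∀ {x y} → (∀ n → seq x n ≡ seq y n) → x ≈ʳ y
    pointwise {x} {y} e = null (Seq.resp
      (λ n → ≡.trans (≡.sym (ℚₚ.+-inverseʳ (seq y n))) (≡.cong (_- seq y n) (≡.sym (e n))))
      Seq.zeroV)

    +ʳ-cong : ∀ {x x′ y y′} → x ≈ʳ x′ → y ≈ʳ y′ → x +ʳ y ≈ʳ x′ +ʳ y′
    +ʳ-cong {x} {x′} {y} {y′} (null u) (null v) = null (Seq.resp
      (λ n → +-minus (seq x n) (seq x′ n) (seq y n) (seq y′ n)) (Seq.plus u v))

    *ʳ-cong : ∀ {x x′ y y′} → x ≈ʳ x′ → y ≈ʳ y′ → x *ʳ y ≈ʳ x′ *ʳ y′
    *ʳ-cong {x} {x′} {y} {y′} (null u) (null v) = null (Seq.resp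
      (λ n → *-minus (seq x n) (seq x′ n) (seq y n) (seq y′ n))
      (Seq.plus (Seq.times (bounded x) v) (Seq.times (bounded y′) u)))

    -ʳ-cong : ∀ {x y} → x ≈ʳ y → (-ʳ x) ≈ʳ (-ʳ y)
    -ʳ-cong {x} {y} (null u) =
      null (Seq.resp (λ n → neg-minus (seq x n) (seq y n)) (Seq.neg u))

    symʳ : ∀ {x y} → x ≈ʳ y → y ≈ʳ x
    symʳ {x} {y} (null u) =
      null (Seq.resp (λ n → swap-minus (seq x n) (seq y n)) (Seq.neg u))

    transʳ : ∀ {x y z} → x ≈ʳ y → y ≈ʳ z → x ≈ʳ z
    transʳ {x} {y} {z} (null u) (null v) = null (Seq.resp
      (λ n → chain-minus (seq x n) (seq y n) (seq z n)) (Seq.plus u v))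

    +ʳ-assoc : ∀ x y z → (x +ʳ y) +ʳ z ≈ʳ x +ʳ (y +ʳ z)
    +ʳ-assoc x y z = pointwise λ n → ℚₚ.+-assoc (seq x n) (seq y n) (seq z n)

    +ʳ-comm : ∀ x y → x +ʳ y ≈ʳ y +ʳ x
    +ʳ-comm x y = pointwise λ n → ℚₚ.+-comm (seq x n) (seq y n)

    +ʳ-identityˡ : ∀ x → fromℚ 0ℚ +ʳ x ≈ʳ x
    +ʳ-identityˡ x = pointwise λ n → ℚₚ.+-identityˡ (seq x n)

    -ʳ-inverseˡ : ∀ x → (-ʳ x) +ʳ x ≈ʳ fromℚ 0ℚ
    -ʳ-inverseˡ x = pointwise λ n → ℚₚ.+-inverseˡ (seq x n)

    *ʳ-assoc : ∀ x y z → (x *ʳ y) *ʳ z ≈ʳ x *ʳ (y *ʳ z)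
    *ʳ-assoc x y z = pointwise λ n → ℚₚ.*-assoc (seq x n) (seq y n) (seq z n)

    *ʳ-comm : ∀ x y → x *ʳ y ≈ʳ y *ʳ x
    *ʳ-comm x y = pointwise λ n → ℚₚ.*-comm (seq x n) (seq y n)

    *ʳ-identityˡ : ∀ x → fromℚ 1ℚ *ʳ x ≈ʳ x
    *ʳ-identityˡ x = pointwise λ n → ℚₚ.*-identityˡ (seq x n)

    *ʳ-distribˡ : ∀ x y z → x *ʳ (y +ʳ z) ≈ʳ x *ʳ y +ʳ x *ʳ z
    *ʳ-distribˡ x y z = pointwise λ n → ℚₚ.*-distribˡ-+ (seq x n) (seq y n) (seq z n)

  isRealRing : IsCommutativeRing _≈ʳ_ _+ʳ_ _*ʳ_ -ʳ_ (fromℚ 0ℚ) (fromℚ 1ℚ)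
  isRealRing = record
    { isRing = record
      { +-isAbelianGroup = record
        { isGroup = record
          { isMonoid = record
            { isSemigroup = record
              { isMagma = record
                { isEquivalence = record
                  { refl = pointwise λ _ → ≡.refl ; sym = symʳ ; trans = transʳ }
                ; ∙-cong = +ʳ-cong
                }
              ; assoc = +ʳ-assoc
              }
            ; identity = +ʳ-identityˡ
                       , λ x → transʳ (+ʳ-comm x (fromℚ 0ℚ)) (+ʳ-identityˡ x)
            }
          ; inverse = -ʳ-inverseˡ
                    , λ x → transʳ (+ʳ-comm x (-ʳ x)) (-ʳ-inverseˡ x)
          ; ⁻¹-cong = -ʳ-cong
          }
        ; comm = +ʳ-comm
        }
      ; *-cong = *ʳ-cong
      ; *-assoc = *ʳ-assoc
      ; *-identity = *ʳ-identityˡ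
                   , λ x → transʳ (*ʳ-comm x (fromℚ 1ℚ)) (*ʳ-identityˡ x)
      ; distrib = *ʳ-distribˡ , λ x y z →
          transʳ (*ʳ-comm (y +ʳ z) x)
            (transʳ (*ʳ-distribˡ x y z) (+ʳ-cong (*ʳ-comm x y) (*ʳ-comm x z)))
      }
    ; *-comm = *ʳ-comm
    }

  realRing : CommutativeRing 0ℓ 0ℓ
  realRing = record { isCommutativeRing = isRealRing }

module Complexification {c ℓ : Level} (R : CommutativeRing c ℓ) where
  open CommutativeRing R
  open RingProperties ring
  open SetoidReasoning setoid
  open SemiringSolver commutativeSemiring using (solve; _:=_; _:+_; _:*_)
  private module +S = CSProps +-commutativeSemigroup

  record Complex : Set c where
    constructor _+i_
    field re im : Carrier
  open Complex public

  infix 4 _≈ᶜ_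
  record _≈ᶜ_ (z w : Complex) : Set ℓ where
    constructor _,_
    field
      re≈ : re z ≈ re w
      im≈ : im z ≈ im w

  infixl 6 _+ᶜ_
  infixl 7 _*ᶜ_
  _+ᶜ_ _*ᶜ_ : Complex → Complex → Complex
  (a +i b) +ᶜ (a′ +i b′) = (a + a′) +i (b + b′)
  (a +i b) *ᶜ (a′ +i b′) = (a * a′ - b * b′) +i (a * b′ + b * a′)

  -ᶜ_ : Complex → Complex
  -ᶜ (a +i b) = (- a) +i (- b)

  0ᶜ 1ᶜ : Complex
  0ᶜ = 0# +i 0#
  1ᶜ = 1# +i 0#

  private
    -≈ : ∀ y → - y ≈ - 1# * y
    -≈ y = sym (-1*x≈-x y)

    assocRe : ∀ a b a′ b′ a″ b″ →
      (a * a′ - b * b′) * a″ - (a * b′ + b * a′) * b″ ≈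
      a * (a′ * a″ - b′ * b″) - b * (a′ * b″ + b′ * a″)
    assocRe a b a′ b′ a″ b″ = begin
      (a * a′ - b * b′) * a″ - (a * b′ + b * a′) * b″
        ≈⟨ +-cong (*-congʳ (+-congˡ (-≈ _))) (-≈ _) ⟩
      (a * a′ + m * (b * b′)) * a″ + m * ((a * b′ + b * a′) * b″)
        ≈⟨ solve 7 (λ m a b a′ b′ a″ b″ →
             (a :* a′ :+ m :* (b :* b′)) :* a″ :+ m :* ((a :* b′ :+ b :* a′) :* b″) :=
             a :* (a′ :* a″ :+ m :* (b′ :* b″)) :+ m :* (b :* (a′ :* b″ :+ b′ :* a″)))
             refl m a b a′ b′ a″ b″ ⟩
      a * (a′ * a″ + m * (b′ * b″)) + m * (b * (a′ * b″ + b′ * a″))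
        ≈⟨ +-cong (*-congˡ (+-congˡ (-≈ _))) (-≈ _) ⟨
      a * (a′ * a″ - b′ * b″) - b * (a′ * b″ + b′ * a″) ∎
      where m = - 1#

    assocIm : ∀ a b a′ b′ a″ b″ →
      (a * a′ - b * b′) * b″ + (a * b′ + b * a′) * a″ ≈
      a * (a′ * b″ + b′ * a″) + b * (a′ * a″ - b′ * b″)
    assocIm a b a′ b′ a″ b″ = begin
      (a * a′ - b * b′) * b″ + (a * b′ + b * a′) * a″
        ≈⟨ +-congʳ (*-congʳ (+-congˡ (-≈ _))) ⟩
      (a * a′ + m * (b * b′)) * b″ + (a * b′ + b * a′) * a″
        ≈⟨ solve 7 (λ m a b a′ b′ a″ b″ →
             (a :* a′ :+ m :* (b :* b′)) :* b″ :+ (a :* b′ :+ b :* a′) :* a″ :=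
             a :* (a′ :* b″ :+ b′ :* a″) :+ b :* (a′ :* a″ :+ m :* (b′ :* b″)))
             refl m a b a′ b′ a″ b″ ⟩
      a * (a′ * b″ + b′ * a″) + b * (a′ * a″ + m * (b′ * b″))
        ≈⟨ +-congˡ (*-congˡ (+-congˡ (-≈ _))) ⟨
      a * (a′ * b″ + b′ * a″) + b * (a′ * a″ - b′ * b″) ∎
      where m = - 1#

    distribRe : ∀ a b a′ b′ a″ b″ →
      a * (a′ + a″) - b * (b′ + b″) ≈ (a * a′ - b * b′) + (a * a″ - b * b″)
    distribRe a b a′ b′ a″ b″ = begin
      a * (a′ + a″) - b * (b′ + b″) ≈⟨ +-congˡ (-≈ _) ⟩
      a * (a′ + a″) + m * (b * (b′ + b″))
        ≈⟨ solve 7 (λ m a b a′ b′ a″ b″ →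
             a :* (a′ :+ a″) :+ m :* (b :* (b′ :+ b″)) :=
             (a :* a′ :+ m :* (b :* b′)) :+ (a :* a″ :+ m :* (b :* b″)))
             refl m a b a′ b′ a″ b″ ⟩
      (a * a′ + m * (b * b′)) + (a * a″ + m * (b * b″))
        ≈⟨ +-cong (+-congˡ (-≈ _)) (+-congˡ (-≈ _)) ⟨
      (a * a′ - b * b′) + (a * a″ - b * b″) ∎
      where m = - 1#

    distribIm : ∀ a b a′ b′ a″ b″ →
      a * (b′ + b″) + b * (a′ + a″) ≈ (a * b′ + b * a′) + (a * b″ + b * a″)
    distribIm a b a′ b′ a″ b″ =
      trans (+-cong (distribˡ a b′ b″) (distribˡ b a′ a″)) (+S.interchange _ _ _ _)

    commutative : ∀ z w → z *ᶜ w ≈ᶜ w *ᶜ z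
    commutative z w =
      +-cong (*-comm _ _) (-‿cong (*-comm _ _)) ,
      trans (+-cong (*-comm _ _) (*-comm _ _)) (+-comm _ _)

    identityˡ : ∀ z → 1ᶜ *ᶜ z ≈ᶜ z
    identityˡ (a +i b) =
      trans (+-cong (*-identityˡ a) (trans (-‿cong (zeroˡ b)) -0#≈0#)) (+-identityʳ a) ,
      trans (+-cong (*-identityˡ b) (zeroˡ a)) (+-identityʳ b)

    symᶜ : ∀ {z w} → z ≈ᶜ w → w ≈ᶜ z
    symᶜ (p , q) = sym p , sym q

    transᶜ : ∀ {z w v} → z ≈ᶜ w → w ≈ᶜ v → z ≈ᶜ v
    transᶜ (p , q) (p′ , q′) = trans p p′ , trans q q′

    +ᶜ-cong : ∀ {z z′ w w′} → z ≈ᶜ z′ → w ≈ᶜ w′ → z +ᶜ w ≈ᶜ z′ +ᶜ w′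
    +ᶜ-cong (p , q) (p′ , q′) = +-cong p p′ , +-cong q q′

    distribˡᶜ : ∀ z w v → z *ᶜ (w +ᶜ v) ≈ᶜ z *ᶜ w +ᶜ z *ᶜ v
    distribˡᶜ (a +i b) (a′ +i b′) (a″ +i b″) =
      distribRe a b a′ b′ a″ b″ , distribIm a b a′ b′ a″ b″

  isComplexRing : IsCommutativeRing _≈ᶜ_ _+ᶜ_ _*ᶜ_ -ᶜ_ 0ᶜ 1ᶜ
  isComplexRing = record
    { isRing = record
      { +-isAbelianGroup = record
        { isGroup = record
          { isMonoid = record
            { isSemigroup = record
              { isMagma = record
                { isEquivalence = record
                  { refl = refl , refl ; sym = symᶜ ; trans = transᶜ }
                ; ∙-cong = +ᶜ-cong
                }
              ; assoc = λ _ _ _ → +-assoc _ _ _ , +-assoc _ _ _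
              }
            ; identity = (λ _ → +-identityˡ _ , +-identityˡ _)
                       , (λ _ → +-identityʳ _ , +-identityʳ _)
            }
          ; inverse = (λ _ → -‿inverseˡ _ , -‿inverseˡ _)
                    , (λ _ → -‿inverseʳ _ , -‿inverseʳ _)
          ; ⁻¹-cong = λ where (p , q) → -‿cong p , -‿cong q
          }
        ; comm = λ _ _ → +-comm _ _ , +-comm _ _
        }
      ; *-cong = λ where
          (p , q) (p′ , q′) → +-cong (*-cong p p′) (-‿cong (*-cong q q′))
                            , +-cong (*-cong p q′) (*-cong q p′)
      ; *-assoc = λ where
          (a +i b) (a′ +i b′) (a″ +i b″) →
            assocRe a b a′ b′ a″ b″ , assocIm a b a′ b′ a″ b″
      ; *-identity = identityˡ , λ z → transᶜ (commutative z 1ᶜ) (identityˡ z)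
      ; distrib = distribˡᶜ , λ z w v →
          transᶜ (commutative (w +ᶜ v) z)
            (transᶜ (distribˡᶜ z w v) (+ᶜ-cong (commutative z w) (commutative z v)))
      }
    ; *-comm = commutative
    }

  complexRing : CommutativeRing c ℓ
  complexRing = record { isCommutativeRing = isComplexRing }

module Polynomials {c ℓ : Level} (R : CommutativeRing c ℓ) where
  open CommutativeRing R
  open RingProperties ring
  private module +S = CSProps +-commutativeSemigroup

  -- Coefficient lists, constant term first; trailing zeros are allowed.
  Poly : Set c
  Poly = List Carrier

  coeff : Poly → ℕ → Carrier
  coeff []      _       = 0#
  coeff (a ∷ _) zero    = a
  coeff (_ ∷ p) (suc n) = coeff p n

  infix 4 _≈ᵖ_
  record _≈ᵖ_ (p q : Poly) : Set ℓ where
    constructor coeffwise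
    field coeff-≈ : ∀ n → coeff p n ≈ coeff q n
  open _≈ᵖ_

  infixl 6 _+ᵖ_
  infixl 7 _*ᵖ_ _·_
  _+ᵖ_ : Poly → Poly → Poly
  []      +ᵖ q       = q
  (a ∷ p) +ᵖ []      = a ∷ p
  (a ∷ p) +ᵖ (b ∷ q) = (a + b) ∷ (p +ᵖ q)

  -ᵖ_ : Poly → Poly
  -ᵖ_ = map (-_)

  _·_ : Carrier → Poly → Poly
  a · q = map (a *_) q

  _*ᵖ_ : Poly → Poly → Poly
  []      *ᵖ q = []
  (a ∷ p) *ᵖ q = a · q +ᵖ (0# ∷ p *ᵖ q)

  constant : Carrier → Poly
  constant a = a ∷ []

  X : Poly
  X = 0# ∷ 1# ∷ []

  private
    coeff-+ : ∀ p q n → coeff (p +ᵖ q) n ≈ coeff p n + coeff q n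
    coeff-+ []      q       n       = sym (+-identityˡ _)
    coeff-+ (a ∷ p) []      n       = sym (+-identityʳ _)
    coeff-+ (a ∷ p) (b ∷ q) zero    = refl
    coeff-+ (a ∷ p) (b ∷ q) (suc n) = coeff-+ p q n

    coeff-neg : ∀ p n → coeff (-ᵖ p) n ≈ - coeff p n
    coeff-neg []      n       = sym -0#≈0#
    coeff-neg (a ∷ p) zero    = refl
    coeff-neg (a ∷ p) (suc n) = coeff-neg p n

    coeff-· : ∀ a p n → coeff (a · p) n ≈ a * coeff p n
    coeff-· a []      n       = sym (zeroʳ a)
    coeff-· a (b ∷ p) zero    = refl
    coeff-· a (b ∷ p) (suc n) = coeff-· a p n

    reflᵖ : ∀ {p} → p ≈ᵖ p
    reflᵖ = coeffwise λ _ → refl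

    symᵖ : ∀ {p q} → p ≈ᵖ q → q ≈ᵖ p
    symᵖ e = coeffwise λ n → sym (coeff-≈ e n)

    transᵖ : ∀ {p q r} → p ≈ᵖ q → q ≈ᵖ r → p ≈ᵖ r
    transᵖ e f = coeffwise λ n → trans (coeff-≈ e n) (coeff-≈ f n)

    setoidᵖ : Setoid c ℓ
    setoidᵖ = record
      { Carrier = Poly
      ; _≈_ = _≈ᵖ_
      ; isEquivalence = record { refl = reflᵖ ; sym = symᵖ ; trans = transᵖ } }

    open SetoidReasoning setoidᵖ

    infixr 5 _∷≈_
    _∷≈_ : ∀ {a b p q} → a ≈ b → p ≈ᵖ q → a ∷ p ≈ᵖ b ∷ q
    e ∷≈ f = coeffwise λ where
      zero    → e
      (suc n) → coeff-≈ f n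

    +ᵖ-cong : ∀ {p p′ q q′} → p ≈ᵖ p′ → q ≈ᵖ q′ → p +ᵖ q ≈ᵖ p′ +ᵖ q′
    +ᵖ-cong {p} {p′} {q} {q′} e f = coeffwise λ n →
      trans (coeff-+ p q n)
        (trans (+-cong (coeff-≈ e n) (coeff-≈ f n)) (sym (coeff-+ p′ q′ n)))

    +ᵖ-comm : ∀ p q → p +ᵖ q ≈ᵖ q +ᵖ p
    +ᵖ-comm p q = coeffwise λ n →
      trans (coeff-+ p q n) (trans (+-comm _ _) (sym (coeff-+ q p n)))

    +ᵖ-assoc : ∀ p q r → (p +ᵖ q) +ᵖ r ≈ᵖ p +ᵖ (q +ᵖ r)
    +ᵖ-assoc p q r = coeffwise λ n →
      trans (coeff-+ (p +ᵖ q) r n)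
        (trans (+-congʳ (coeff-+ p q n))
          (trans (+-assoc _ _ _)
            (sym (trans (coeff-+ p (q +ᵖ r) n) (+-congˡ (coeff-+ q r n))))))

    +ᵖ-isCommutativeSemigroup : IsCommutativeSemigroup _≈ᵖ_ _+ᵖ_
    +ᵖ-isCommutativeSemigroup = record
      { isSemigroup = record
        { isMagma = record
          { isEquivalence = Setoid.isEquivalence setoidᵖ
          ; ∙-cong = +ᵖ-cong
          }
        ; assoc = +ᵖ-assoc
        }
      ; comm = +ᵖ-comm
      }

    +ᵖ-commutativeSemigroup : CommutativeSemigroup c ℓ
    +ᵖ-commutativeSemigroup = record { isCommutativeSemigroup = +ᵖ-isCommutativeSemigroup }

    open CSProps +ᵖ-commutativeSemigroup
      using (interchange; x∙yz≈y∙xz)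

    -ᵖ-inverseˡ : ∀ p → (-ᵖ p) +ᵖ p ≈ᵖ []
    -ᵖ-inverseˡ p = coeffwise λ n →
      trans (coeff-+ (-ᵖ p) p n) (trans (+-congʳ (coeff-neg p n)) (-‿inverseˡ _))

    ·-congˡ : ∀ {a p q} → p ≈ᵖ q → a · p ≈ᵖ a · q
    ·-congˡ {a} {p} {q} e = coeffwise λ n →
      trans (coeff-· a p n) (trans (*-congˡ (coeff-≈ e n)) (sym (coeff-· a q n)))

    ·-distribˡ : ∀ a p q → a · (p +ᵖ q) ≈ᵖ a · p +ᵖ a · q
    ·-distribˡ a []      q       = reflᵖ
    ·-distribˡ a (b ∷ p) []      = reflᵖ
    ·-distribˡ a (b ∷ p) (c ∷ q) = distribˡ a b c ∷≈ ·-distribˡ a p q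

    ·-assoc : ∀ a b p → (a * b) · p ≈ᵖ a · (b · p)
    ·-assoc a b []      = reflᵖ
    ·-assoc a b (c ∷ p) = *-assoc a b c ∷≈ ·-assoc a b p

    0·≈[] : ∀ p → 0# · p ≈ᵖ []
    0·≈[] p = coeffwise λ n → trans (coeff-· 0# p n) (zeroˡ _)

    1·≈ : ∀ p → 1# · p ≈ᵖ p
    1·≈ p = coeffwise λ n → trans (coeff-· 1# p n) (*-identityˡ _)

    0∷[]≈[] : 0# ∷ [] ≈ᵖ []
    0∷[]≈[] = coeffwise λ where
      zero    → refl
      (suc n) → refl

    *ᵖ-zeroʳ : ∀ p → p *ᵖ [] ≈ᵖ []
    *ᵖ-zeroʳ []      = reflᵖ
    *ᵖ-zeroʳ (a ∷ p) = transᵖ (refl ∷≈ *ᵖ-zeroʳ p) 0∷[]≈[]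

    *ᵖ-congˡ : ∀ p {q q′} → q ≈ᵖ q′ → p *ᵖ q ≈ᵖ p *ᵖ q′
    *ᵖ-congˡ []      e = reflᵖ
    *ᵖ-congˡ (a ∷ p) e = +ᵖ-cong (·-congˡ e) (refl ∷≈ *ᵖ-congˡ p e)

    *ᵖ-∷ʳ : ∀ p b q → p *ᵖ (b ∷ q) ≈ᵖ b · p +ᵖ (0# ∷ p *ᵖ q)
    *ᵖ-∷ʳ []      b q = symᵖ 0∷[]≈[]
    *ᵖ-∷ʳ (a ∷ p) b q = +-congʳ (*-comm a b) ∷≈ (begin
      a · q +ᵖ p *ᵖ (b ∷ q)             ≈⟨ +ᵖ-cong reflᵖ (*ᵖ-∷ʳ p b q) ⟩
      a · q +ᵖ (b · p +ᵖ (0# ∷ p *ᵖ q)) ≈⟨ x∙yz≈y∙xz (a · q) (b · p) _ ⟩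
      b · p +ᵖ (a · q +ᵖ (0# ∷ p *ᵖ q)) ∎)

    *ᵖ-comm : ∀ p q → p *ᵖ q ≈ᵖ q *ᵖ p
    *ᵖ-comm []      q = symᵖ (*ᵖ-zeroʳ q)
    *ᵖ-comm (a ∷ p) q = begin
      a · q +ᵖ (0# ∷ p *ᵖ q) ≈⟨ +ᵖ-cong reflᵖ (refl ∷≈ *ᵖ-comm p q) ⟩
      a · q +ᵖ (0# ∷ q *ᵖ p) ≈⟨ *ᵖ-∷ʳ q a p ⟨
      q *ᵖ (a ∷ p)           ∎

    *ᵖ-cong : ∀ {p p′ q q′} → p ≈ᵖ p′ → q ≈ᵖ q′ → p *ᵖ q ≈ᵖ p′ *ᵖ q′
    *ᵖ-cong {p} {p′} {q} {q′} e f = begin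
      p *ᵖ q   ≈⟨ *ᵖ-congˡ p f ⟩
      p *ᵖ q′  ≈⟨ *ᵖ-comm p q′ ⟩
      q′ *ᵖ p  ≈⟨ *ᵖ-congˡ q′ e ⟩
      q′ *ᵖ p′ ≈⟨ *ᵖ-comm q′ p′ ⟩
      p′ *ᵖ q′ ∎

    *ᵖ-distribˡ : ∀ p q r → p *ᵖ (q +ᵖ r) ≈ᵖ p *ᵖ q +ᵖ p *ᵖ r
    *ᵖ-distribˡ []      q r = reflᵖ
    *ᵖ-distribˡ (a ∷ p) q r = begin
      a · (q +ᵖ r) +ᵖ (0# ∷ p *ᵖ (q +ᵖ r))
        ≈⟨ +ᵖ-cong (·-distribˡ a q r) (sym (+-identityˡ 0#) ∷≈ *ᵖ-distribˡ p q r) ⟩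
      (a · q +ᵖ a · r) +ᵖ ((0# ∷ p *ᵖ q) +ᵖ (0# ∷ p *ᵖ r))
        ≈⟨ interchange (a · q) (a · r) _ _ ⟩
      (a · q +ᵖ (0# ∷ p *ᵖ q)) +ᵖ (a · r +ᵖ (0# ∷ p *ᵖ r)) ∎

    *ᵖ-distribʳ : ∀ p q r → (q +ᵖ r) *ᵖ p ≈ᵖ q *ᵖ p +ᵖ r *ᵖ p
    *ᵖ-distribʳ p q r = begin
      (q +ᵖ r) *ᵖ p    ≈⟨ *ᵖ-comm (q +ᵖ r) p ⟩
      p *ᵖ (q +ᵖ r)    ≈⟨ *ᵖ-distribˡ p q r ⟩
      p *ᵖ q +ᵖ p *ᵖ r ≈⟨ +ᵖ-cong (*ᵖ-comm p q) (*ᵖ-comm p r) ⟩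
      q *ᵖ p +ᵖ r *ᵖ p ∎

    ·-*ᵖ : ∀ a p q → (a · p) *ᵖ q ≈ᵖ a · (p *ᵖ q)
    ·-*ᵖ a []      q = reflᵖ
    ·-*ᵖ a (b ∷ p) q = begin
      (a * b) · q +ᵖ (0# ∷ (a · p) *ᵖ q)
        ≈⟨ +ᵖ-cong (·-assoc a b q) (sym (zeroʳ a) ∷≈ ·-*ᵖ a p q) ⟩
      a · (b · q) +ᵖ a · (0# ∷ p *ᵖ q)
        ≈⟨ ·-distribˡ a (b · q) (0# ∷ p *ᵖ q) ⟨
      a · (b · q +ᵖ (0# ∷ p *ᵖ q)) ∎

    *ᵖ-assoc : ∀ p q r → (p *ᵖ q) *ᵖ r ≈ᵖ p *ᵖ (q *ᵖ r)
    *ᵖ-assoc []      q r = reflᵖ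
    *ᵖ-assoc (a ∷ p) q r = begin
      (a · q +ᵖ (0# ∷ p *ᵖ q)) *ᵖ r
        ≈⟨ *ᵖ-distribʳ r (a · q) (0# ∷ p *ᵖ q) ⟩
      (a · q) *ᵖ r +ᵖ (0# · r +ᵖ (0# ∷ (p *ᵖ q) *ᵖ r))
        ≈⟨ +ᵖ-cong (·-*ᵖ a q r) (+ᵖ-cong (0·≈[] r) (refl ∷≈ *ᵖ-assoc p q r)) ⟩
      a · (q *ᵖ r) +ᵖ (0# ∷ p *ᵖ (q *ᵖ r)) ∎

    *ᵖ-identityˡ : ∀ p → constant 1# *ᵖ p ≈ᵖ p
    *ᵖ-identityˡ p = begin
      1# · p +ᵖ (0# ∷ []) ≈⟨ +ᵖ-cong (1·≈ p) 0∷[]≈[] ⟩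
      p +ᵖ []             ≈⟨ +ᵖ-comm p [] ⟩
      p                   ∎

  isPolynomialRing : IsCommutativeRing _≈ᵖ_ _+ᵖ_ _*ᵖ_ -ᵖ_ [] (constant 1#)
  isPolynomialRing = record
    { isRing = record
      { +-isAbelianGroup = record
        { isGroup = record
          { isMonoid = record
            { isSemigroup =
                IsCommutativeSemigroup.isSemigroup +ᵖ-isCommutativeSemigroup
            ; identity = (λ _ → reflᵖ) , (λ p → +ᵖ-comm p [])
            }
          ; inverse = -ᵖ-inverseˡ
                    , λ p → transᵖ (+ᵖ-comm p (-ᵖ p)) (-ᵖ-inverseˡ p)
          ; ⁻¹-cong = λ {p} {q} e → coeffwise λ n →
              trans (coeff-neg p n) (trans (-‿cong (coeff-≈ e n)) (sym (coeff-neg q n)))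
          }
        ; comm = +ᵖ-comm
        }
      ; *-cong = *ᵖ-cong
      ; *-assoc = *ᵖ-assoc
      ; *-identity = *ᵖ-identityˡ
                   , λ p → transᵖ (*ᵖ-comm p (constant 1#)) (*ᵖ-identityˡ p)
      ; distrib = *ᵖ-distribˡ , *ᵖ-distribʳ
      }
    ; *-comm = *ᵖ-comm
    }

  polynomialRing : CommutativeRing c ℓ
  polynomialRing = record { isCommutativeRing = isPolynomialRing }

module Fractions {c ℓ : Level} (R : CommutativeRing c ℓ) where
  open CommutativeRing R
  open RingProperties ring
  open SetoidReasoning setoid
  open SemiringSolver commutativeSemiring using (solve; _:=_; _:+_; _:*_)

  -- In a domain the regular elements are exactly the nonzero ones, so that this
  -- total ring of fractions is then the field of fractions.
  Regular : Carrier → Set (c ⊔ ℓ)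
  Regular d = ∀ a → d * a ≈ 0# → a ≈ 0#

  record Fraction : Set (c ⊔ ℓ) where
    constructor frac
    field
      num     : Carrier
      den     : Carrier
      regular : Regular den
  open Fraction public

  infix 4 _≈ᶠ_
  record _≈ᶠ_ (f g : Fraction) : Set ℓ where
    constructor cross
    field crossed : num f * den g ≈ num g * den f
  open _≈ᶠ_

  1-regular : Regular 1#
  1-regular a e = trans (sym (*-identityˡ a)) e

  *-regular : ∀ {d e} → Regular d → Regular e → Regular (d * e)
  *-regular {d} {e} rd re a eq = re a (rd (e * a) (trans (sym (*-assoc d e a)) eq))

  infixl 6 _+ᶠ_
  infixl 7 _*ᶠ_
  _+ᶠ_ _*ᶠ_ : Fraction → Fraction → Fraction
  frac a d p +ᶠ frac b e q = frac (a * e + b * d) (d * e) (*-regular p q)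
  frac a d p *ᶠ frac b e q = frac (a * b) (d * e) (*-regular p q)

  -ᶠ_ : Fraction → Fraction
  -ᶠ frac a d p = frac (- a) d p

  embed : Carrier → Fraction
  embed a = frac a 1# 1-regular

  private
    cancel : ∀ {d} → Regular d → ∀ {a b} → d * a ≈ d * b → a ≈ b
    cancel {d} reg {a} {b} e = x-y≈0⇒x≈y (reg (a - b) (begin
      d * (a - b)        ≈⟨ distribˡ d a (- b) ⟩
      d * a + d * (- b)  ≈⟨ +-cong e (sym (-‿distribʳ-* d b)) ⟩
      d * b + - (d * b)  ≈⟨ -‿inverseʳ (d * b) ⟩
      0#                 ∎))
      where
      x-y≈0⇒x≈y : ∀ {x y} → x - y ≈ 0# → x ≈ y
      x-y≈0⇒x≈y {x} {y} = x∙y⁻¹≈ε⇒x≈y x y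

    transᶠ : ∀ {f g h} → f ≈ᶠ g → g ≈ᶠ h → f ≈ᶠ h
    transᶠ {frac a d p} {frac a′ d′ p′} {frac a″ d″ p″} (cross e) (cross e′) =
      cross (cancel p′ (begin
        d′ * (a * d″)  ≈⟨ solve 3 (λ x y z → x :* (y :* z) := (y :* x) :* z) refl d′ a d″ ⟩
        (a * d′) * d″  ≈⟨ *-congʳ e ⟩
        (a′ * d) * d″  ≈⟨ solve 3 (λ x y z → (x :* y) :* z := (x :* z) :* y) refl a′ d d″ ⟩
        (a′ * d″) * d  ≈⟨ *-congʳ e′ ⟩
        (a″ * d′) * d  ≈⟨ solve 3 (λ x y z → (x :* y) :* z := y :* (x :* z)) refl a″ d′ d ⟩
        d′ * (a″ * d)  ∎))

    reflᶠ : ∀ {f} → f ≈ᶠ f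
    reflᶠ = cross refl

    symᶠ : ∀ {f g} → f ≈ᶠ g → g ≈ᶠ f
    symᶠ (cross e) = cross (sym e)

    +ᶠ-cong : ∀ {f f′ g g′} → f ≈ᶠ f′ → g ≈ᶠ g′ → f +ᶠ g ≈ᶠ f′ +ᶠ g′
    +ᶠ-cong {frac a d _} {frac a′ d′ _} {frac b e _} {frac b′ e′ _} (cross p) (cross q) =
      cross (begin
        (a * e + b * d) * (d′ * e′)
          ≈⟨ solve 6 (λ a b d e d′ e′ → (a :* e :+ b :* d) :* (d′ :* e′) :=
               (a :* d′) :* (e :* e′) :+ (b :* e′) :* (d :* d′)) refl a b d e d′ e′ ⟩
        (a * d′) * (e * e′) + (b * e′) * (d * d′)
          ≈⟨ +-cong (*-congʳ p) (*-congʳ q) ⟩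
        (a′ * d) * (e * e′) + (b′ * e) * (d * d′)
          ≈⟨ solve 6 (λ a′ b′ d e d′ e′ → (a′ :* d) :* (e :* e′) :+ (b′ :* e) :* (d :* d′) :=
               (a′ :* e′ :+ b′ :* d′) :* (d :* e)) refl a′ b′ d e d′ e′ ⟩
        (a′ * e′ + b′ * d′) * (d * e) ∎)

    *ᶠ-cong : ∀ {f f′ g g′} → f ≈ᶠ f′ → g ≈ᶠ g′ → f *ᶠ g ≈ᶠ f′ *ᶠ g′
    *ᶠ-cong {frac a d _} {frac a′ d′ _} {frac b e _} {frac b′ e′ _} (cross p) (cross q) =
      cross (begin
        (a * b) * (d′ * e′)
          ≈⟨ solve 4 (λ a b d′ e′ → (a :* b) :* (d′ :* e′) := (a :* d′) :* (b :* e′))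
               refl a b d′ e′ ⟩
        (a * d′) * (b * e′)
          ≈⟨ *-cong p q ⟩
        (a′ * d) * (b′ * e)
          ≈⟨ solve 4 (λ a b d e → (a :* d) :* (b :* e) := (a :* b) :* (d :* e))
               refl a′ b′ d e ⟩
        (a′ * b′) * (d * e) ∎)

    +ᶠ-assoc : ∀ f g h → (f +ᶠ g) +ᶠ h ≈ᶠ f +ᶠ (g +ᶠ h)
    +ᶠ-assoc (frac a d _) (frac a′ d′ _) (frac a″ d″ _) = cross
      (solve 6 (λ a d a′ d′ a″ d″ →
        ((a :* d′ :+ a′ :* d) :* d″ :+ a″ :* (d :* d′)) :* (d :* (d′ :* d″)) :=
        (a :* (d′ :* d″) :+ (a′ :* d″ :+ a″ :* d′) :* d) :* ((d :* d′) :* d″))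
        refl a d a′ d′ a″ d″)

    +ᶠ-comm : ∀ f g → f +ᶠ g ≈ᶠ g +ᶠ f
    +ᶠ-comm (frac a d _) (frac a′ d′ _) =
      cross (*-cong (+-comm _ _) (*-comm _ _))

    +ᶠ-identityˡ : ∀ f → embed 0# +ᶠ f ≈ᶠ f
    +ᶠ-identityˡ (frac a d _) = cross (begin
      (0# * d + a * 1#) * d ≈⟨ *-congʳ (trans (+-cong (zeroˡ d) (*-identityʳ a)) (+-identityˡ a)) ⟩
      a * d                 ≈⟨ *-congˡ (*-identityˡ d) ⟨
      a * (1# * d)          ∎)

    -ᶠ-inverseˡ : ∀ f → (-ᶠ f) +ᶠ f ≈ᶠ embed 0#
    -ᶠ-inverseˡ (frac a d _) = cross (begin
      ((- a) * d + a * d) * 1# ≈⟨ *-identityʳ _ ⟩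
      (- a) * d + a * d        ≈⟨ distribʳ d (- a) a ⟨
      (- a + a) * d            ≈⟨ *-congʳ (-‿inverseˡ a) ⟩
      0# * d                   ≈⟨ zeroˡ d ⟩
      0#                       ≈⟨ zeroˡ (d * d) ⟨
      0# * (d * d)             ∎)

    -ᶠ-cong : ∀ {f g} → f ≈ᶠ g → (-ᶠ f) ≈ᶠ (-ᶠ g)
    -ᶠ-cong {frac a d _} {frac b e _} (cross p) = cross (begin
      (- a) * e  ≈⟨ -‿distribˡ-* a e ⟨
      - (a * e)  ≈⟨ -‿cong p ⟩
      - (b * d)  ≈⟨ -‿distribˡ-* b d ⟩
      (- b) * d  ∎)

    *ᶠ-assoc : ∀ f g h → (f *ᶠ g) *ᶠ h ≈ᶠ f *ᶠ (g *ᶠ h)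
    *ᶠ-assoc (frac a d _) (frac a′ d′ _) (frac a″ d″ _) =
      cross (*-cong (*-assoc _ _ _) (sym (*-assoc _ _ _)))

    *ᶠ-comm : ∀ f g → f *ᶠ g ≈ᶠ g *ᶠ f
    *ᶠ-comm (frac a d _) (frac a′ d′ _) =
      cross (*-cong (*-comm _ _) (*-comm _ _))

    *ᶠ-identityˡ : ∀ f → embed 1# *ᶠ f ≈ᶠ f
    *ᶠ-identityˡ (frac a d _) =
      cross (trans (*-congʳ (*-identityˡ a)) (*-congˡ (sym (*-identityˡ d))))

    *ᶠ-distribˡ : ∀ f g h → f *ᶠ (g +ᶠ h) ≈ᶠ f *ᶠ g +ᶠ f *ᶠ h
    *ᶠ-distribˡ (frac a d _) (frac a′ d′ _) (frac a″ d″ _) = cross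
      (solve 6 (λ a d a′ d′ a″ d″ →
        (a :* (a′ :* d″ :+ a″ :* d′)) :* ((d :* d′) :* (d :* d″)) :=
        ((a :* a′) :* (d :* d″) :+ (a :* a″) :* (d :* d′)) :* (d :* (d′ :* d″)))
        refl a d a′ d′ a″ d″)

  isFractionRing : IsCommutativeRing _≈ᶠ_ _+ᶠ_ _*ᶠ_ -ᶠ_ (embed 0#) (embed 1#)
  isFractionRing = record
    { isRing = record
      { +-isAbelianGroup = record
        { isGroup = record
          { isMonoid = record
            { isSemigroup = record
              { isMagma = record
                { isEquivalence = record { refl = reflᶠ ; sym = symᶠ ; trans = transᶠ }
                ; ∙-cong = +ᶠ-cong
                }
              ; assoc = +ᶠ-assoc
              }
            ; identity = +ᶠ-identityˡ
                       , λ f → transᶠ (+ᶠ-comm f (embed 0#)) (+ᶠ-identityˡ f)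
            }
          ; inverse = -ᶠ-inverseˡ
                    , λ f → transᶠ (+ᶠ-comm f (-ᶠ f)) (-ᶠ-inverseˡ f)
          ; ⁻¹-cong = -ᶠ-cong
          }
        ; comm = +ᶠ-comm
        }
      ; *-cong = *ᶠ-cong
      ; *-assoc = *ᶠ-assoc
      ; *-identity = *ᶠ-identityˡ
                   , λ f → transᶠ (*ᶠ-comm f (embed 1#)) (*ᶠ-identityˡ f)
      ; distrib = *ᶠ-distribˡ , λ f g h →
          transᶠ (*ᶠ-comm (g +ᶠ h) f)
            (transᶠ (*ᶠ-distribˡ f g h) (+ᶠ-cong (*ᶠ-comm f g) (*ᶠ-comm f h)))
      }
    ; *-comm = *ᶠ-comm
    }

  fractionRing : CommutativeRing (c ⊔ ℓ) ℓ
  fractionRing = record { isCommutativeRing = isFractionRing }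

-- The field ℂ(x), as fractions of complex polynomials.
module ℂ    = Complexification Reals.realRing
module ℂ[x] = Polynomials ℂ.complexRing
module ℂ⟨x⟩ = Fractions ℂ[x].polynomialRing

ℂ⟨x⟩-ring : CommutativeRing 0ℓ 0ℓ
ℂ⟨x⟩-ring = ℂ⟨x⟩.fractionRing

rational : ℚ → CommutativeRing.Carrier ℂ⟨x⟩-ring
rational q = ℂ⟨x⟩.embed (ℂ[x].constant (Reals.fromℚ q ℂ.+i Reals.fromℚ 0ℚ))

indeterminate : CommutativeRing.Carrier ℂ⟨x⟩-ring
indeterminate = ℂ⟨x⟩.embed ℂ[x].X

-- A multiset over m disjoint alphabets of k letters each: entry j of row i is
-- the multiplicity of the j-th letter of the i-th alphabet.
Multiset : ℕ → ℕ → Set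
Multiset m k = Vec (Vec ℕ k) m

module _ {m k : ℕ} where

  infix 4 _≟ᴹ_
  _≟ᴹ_ : DecidableEquality (Multiset m k)
  _≟ᴹ_ = Vecₚ.≡-dec (Vecₚ.≡-dec ℕ._≟_)

  ∅ : Multiset m k
  ∅ = Vec.replicate m (Vec.replicate k 0)

  NonEmpty : Multiset m k → Set
  NonEmpty T = T ≢ ∅

  nonEmpty? : Decidable NonEmpty
  nonEmpty? T = ¬? (T ≟ᴹ ∅)

  -- The number of elements that the blocks of π have in the i-th alphabet.
  elements : Fin m → List (Multiset m k) → ℕ
  elements i π = sum (map (λ T → Vec.sum (Vec.lookup T i)) π)

  multiplicity : Multiset m k → List (Multiset m k) → ℕ
  multiplicity T π = length (filter (T ≟ᴹ_) π)

  -- m(π)!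
  multiplicities! : List (Multiset m k) → ℕ
  multiplicities! π = product (map (λ T → multiplicity T π !) (deduplicate _≟ᴹ_ π))

-- A multiset of blocks is a list of blocks up to permutation.
record MultisetPartition (m r k : ℕ) : Set where
  constructor multisetPartition
  field
    blocks   : List (Multiset m k)
    nonEmpty : All NonEmpty blocks
    balanced : ∀ i → elements i blocks ≡ r
open MultisetPartition public

Π Γ : ℕ → ℕ → Set
Π = MultisetPartition 2
Γ = MultisetPartition 3

infix 4 _≋_
_≋_ : ∀ {m r k} → MultisetPartition m r k → MultisetPartition m r k → Set
π ≋ γ = blocks π ↭ blocks γ

module _ {A : Set} (_≟ᴬ_ : DecidableEquality A) where
  open DecMembership _≟ᴬ_ using (_∈?_)

  permutation? : (xs ys : List A) → Dec (xs ↭ ys)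
  permutation? []       []       = yes ↭-refl
  permutation? []       (y ∷ ys) = no λ p → ℕ.0≢1+n (↭-length p)
  permutation? (x ∷ xs) ys with x ∈? ys
  ... | no x∉ys = no λ p → x∉ys (∈-resp-↭ p (here ≡.refl))
  ... | yes x∈ys with us , vs , ≡.refl ← ∈-∃++ x∈ys =
    map′ (λ p → ↭-trans (prep x p) (↭-sym (shift x us vs)))
         (λ p → drop-∷ (↭-trans p (shift x us vs)))
         (permutation? xs (us ++ vs))

infix 4 _≋?_
_≋?_ : ∀ {m r k} (π γ : MultisetPartition m r k) → Dec (π ≋ γ)
π ≋? γ = permutation? _≟ᴹ_ (blocks π) (blocks γ)

-- The restriction of a multiset to the alphabets listed in σ, which become the
-- alphabets 0, 1, … of the result; bars are thereby added or removed as needed.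
select : ∀ {m n k} → Vec (Fin m) n → Multiset m k → Multiset n k
select σ T = Vec.map (Vec.lookup T) σ

restrict : ∀ {m n k} → Vec (Fin m) n → List (Multiset m k) → List (Multiset n k)
restrict σ ν = filter nonEmpty? (map (select σ) ν)

private
  sum-replicate-0 : ∀ k → Vec.sum (Vec.replicate k 0) ≡ 0
  sum-replicate-0 zero    = ≡.refl
  sum-replicate-0 (suc k) = sum-replicate-0 k

  sum-∅ : ∀ {n k} (i : Fin n) → Vec.sum (Vec.lookup (∅ {n} {k}) i) ≡ 0
  sum-∅ {n} {k} i =
    ≡.trans (≡.cong Vec.sum (Vecₚ.lookup-replicate i (Vec.replicate k 0))) (sum-replicate-0 k)

  elements-restrict : ∀ {m n k} (σ : Vec (Fin m) n) i (ν : List (Multiset m k)) →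
    elements i (restrict σ ν) ≡ elements (Vec.lookup σ i) ν
  elements-restrict σ i [] = ≡.refl
  elements-restrict σ i (T ∷ ν) with select σ T ≟ᴹ ∅ | Vecₚ.lookup-map i (Vec.lookup T) σ
  ... | yes eq | row = ≡.cong₂ ℕ._+_
    (≡.trans (≡.sym (≡.trans (≡.cong (λ U → Vec.sum (Vec.lookup U i)) eq) (sum-∅ i)))
             (≡.cong Vec.sum row))
    (elements-restrict σ i ν)
  ... | no  _  | row = ≡.cong₂ ℕ._+_ (≡.cong Vec.sum row) (elements-restrict σ i ν)

infixl 10 _↾_
_↾_ : ∀ {m n r k} → MultisetPartition m r k → Vec (Fin m) n → MultisetPartition n r k
blocks   (ν ↾ σ) = restrict σ (blocks ν)
nonEmpty (ν ↾ σ) = Allₚ.all-filter nonEmpty? (map (select σ) (blocks ν))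
balanced (ν ↾ σ) i = ≡.trans (elements-restrict σ i (blocks ν)) (balanced ν (Vec.lookup σ i))

-- The alphabets 0, 1, 2 of Γ are [k], [k̄] and the doubly barred [k].
σ₁₂ σ₂₃ σ₁₃ : Vec (Fin 3) 2
σ₁₂ = 0F ∷ 1F ∷ []
σ₂₃ = 1F ∷ 2F ∷ []
σ₁₃ = 0F ∷ 2F ∷ []

-- Exhaustive, repetition-free lists of all multiset partitions.

tuples : {A : Set} → List A → (n : ℕ) → List (Vec A n)
tuples xs zero    = [ [] ]
tuples xs (suc n) = cartesianProductWith _∷_ xs (tuples xs n)

-- Each multiset of n elements of xs, listed in the order of xs.
multichoose : {A : Set} → ℕ → List A → List (List A)
multichoose zero    xs       = [ [] ]
multichoose (suc n) []       = []
multichoose (suc n) (x ∷ xs) =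
  map (x ∷_) (multichoose n (x ∷ xs)) ++ multichoose (suc n) xs

module _ (m r k : ℕ) where

  -- A letter of an element of MultisetPartition m r k occurs at most r times in
  -- any block, and there are at most m * r blocks.
  boundedBlocks : List (Multiset m k)
  boundedBlocks = filter nonEmpty? (tuples (tuples (upTo (suc r)) k) m)

  candidates : List (List (Multiset m k))
  candidates = concatMap (λ n → multichoose n boundedBlocks) (upTo (suc (m ℕ.* r)))

  partitionsAmong : List (List (Multiset m k)) → List (MultisetPartition m r k)
  partitionsAmong []       = []
  partitionsAmong (π ∷ πs)
    with All.all? nonEmpty? π | Finₚ.all? (λ i → elements i π ℕ.≟ r)
  ... | yes p | yes q = multisetPartition π p q ∷ partitionsAmong πs
  ... | _     | _     = partitionsAmong πs

  allPartitions : List (MultisetPartition m r k)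
  allPartitions = partitionsAmong candidates

  partitionSetoid : Setoid 0ℓ 0ℓ
  partitionSetoid = record
    { Carrier = MultisetPartition m r k
    ; _≈_ = _≋_
    ; isEquivalence = record { refl = ↭-refl ; sym = ↭-sym ; trans = ↭-trans }
    }

private
  _≁_ : {A : Set} → List A → List A → Set
  xs ≁ ys = ¬ (xs ↭ ys)

  tuples-complete : ∀ {A : Set} {xs : List A} {n} (v : Vec A n) →
    (∀ i → Vec.lookup v i ∈ xs) → v ∈ tuples xs n
  tuples-complete []      h = here ≡.refl
  tuples-complete (x ∷ v) h =
    ∈-cartesianProductWith⁺ _∷_ (h zero) (tuples-complete v (h ∘ suc))

  tuples-unique : ∀ {A : Set} {xs : List A} n → Unique xs → Unique (tuples xs n)
  tuples-unique zero    u = [] ∷ []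
  tuples-unique (suc n) u =
    Uniqueₚ.cartesianProductWith⁺ _∷_ Vecₚ.∷-injective u (tuples-unique n u)

  multichoose-length : ∀ {A : Set} n (xs : List A) {c} → c ∈ multichoose n xs → length c ≡ n
  multichoose-length zero    xs       (here ≡.refl) = ≡.refl
  multichoose-length (suc n) (x ∷ xs) c∈ with ∈-++⁻ (map (x ∷_) (multichoose n (x ∷ xs))) c∈
  ... | inj₂ c∈ʳ = multichoose-length (suc n) xs c∈ʳ
  ... | inj₁ c∈ˡ with d , d∈ , ≡.refl ← ∈-map⁻ (x ∷_) c∈ˡ =
    ≡.cong suc (multichoose-length n (x ∷ xs) d∈)

  multichoose-elements : ∀ {A : Set} n (xs : List A) {c} → c ∈ multichoose n xs → All (_∈ xs) c
  multichoose-elements zero    xs       (here ≡.refl) = []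
  multichoose-elements (suc n) (x ∷ xs) c∈ with ∈-++⁻ (map (x ∷_) (multichoose n (x ∷ xs))) c∈
  ... | inj₂ c∈ʳ = All.map there (multichoose-elements (suc n) xs c∈ʳ)
  ... | inj₁ c∈ˡ with d , d∈ , ≡.refl ← ∈-map⁻ (x ∷_) c∈ˡ =
    here ≡.refl ∷ multichoose-elements n (x ∷ xs) d∈

  multichoose-unique : ∀ {A : Set} n {xs : List A} → Unique xs → AllPairs _≁_ (multichoose n xs)
  multichoose-unique zero    u = [] ∷ []
  multichoose-unique (suc n) [] = []
  multichoose-unique (suc n) {x ∷ xs} (x∉ ∷ u) = AllPairsₚ.++⁺
    (AllPairsₚ.map⁺ (AllPairs.map (λ c≁d p → c≁d (drop-∷ p)) (multichoose-unique n (x∉ ∷ u))))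
    (multichoose-unique (suc n) u)
    (Allₚ.map⁺ (All.universal (λ c → All.tabulate λ d∈ p →
      Allₚ.All¬⇒¬Any x∉ (All.lookup (multichoose-elements (suc n) xs d∈) (∈-resp-↭ p (here ≡.refl)))) _))

  module _ {A : Set} (_≟ᴬ_ : DecidableEquality A) where
    open DecMembership _≟ᴬ_ using (_∈?_)

    Completes : ℕ → List A → Set
    Completes n xs = ∀ π → length π ≡ n → All (_∈ xs) π →
      ∃ λ c → c ∈ multichoose n xs × c ↭ π

    complete-∷ : ∀ {n x xs} → Completes n (x ∷ xs) → Completes (suc n) xs →
      Completes (suc n) (x ∷ xs)
    complete-∷ {n} {x} {xs} take skip π eq h with x ∈? π
    ... | no x∉π =
      let c , c∈ , p = skip π eq (All.tabulate λ y∈ → strengthen y∈ (All.lookup h y∈))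
      in c , ∈-++⁺ʳ _ c∈ , p
      where
      strengthen : ∀ {y} → y ∈ π → y ∈ x ∷ xs → y ∈ xs
      strengthen y∈ (here ≡.refl) = ⊥-elim (x∉π y∈)
      strengthen y∈ (there y∈xs)  = y∈xs
    ... | yes x∈π with us , vs , ≡.refl ← ∈-∃++ x∈π =
      let q = shift x us vs
          c , c∈ , p = take (us ++ vs)
            (ℕ.suc-injective (≡.trans (≡.sym (↭-length q)) eq)) (All.tail (All-resp-↭ q h))
      in x ∷ c , ∈-++⁺ˡ (∈-map⁺ (x ∷_) c∈) , ↭-trans (prep x p) (↭-sym q)

    multichoose-complete : ∀ n xs → Completes n xs
    multichoose-complete zero    xs       []      eq h        = [] , here ≡.refl , ↭-refl
    multichoose-complete (suc n) []       (y ∷ π) eq (() ∷ _)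
    multichoose-complete (suc n) (x ∷ xs) =
      complete-∷ (multichoose-complete n (x ∷ xs)) (multichoose-complete (suc n) xs)

  +ℕ : CommutativeSemigroup 0ℓ 0ℓ
  +ℕ = CommutativeMonoid.commutativeSemigroup ℕ.+-0-commutativeMonoid

  total : ∀ {n} → (Fin n → ℕ) → ℕ
  total {zero}  f = 0
  total {suc n} f = f zero ℕ.+ total (f ∘ suc)

  total-+ : ∀ {n} (f g : Fin n → ℕ) → total (λ i → f i ℕ.+ g i) ≡ total f ℕ.+ total g
  total-+ {zero}  f g = ≡.refl
  total-+ {suc n} f g = ≡.trans (≡.cong (f zero ℕ.+ g zero ℕ.+_) (total-+ (f ∘ suc) (g ∘ suc)))
    (CSProps.interchange +ℕ (f zero) (g zero) (total (f ∘ suc)) (total (g ∘ suc)))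

  total-const : ∀ {n} {f : Fin n → ℕ} {r} → (∀ i → f i ≡ r) → total f ≡ n ℕ.* r
  total-const {zero}  h = ≡.refl
  total-const {suc n} h = ≡.cong₂ ℕ._+_ (h zero) (total-const (h ∘ suc))

  total≡0 : ∀ {n} (f : Fin n → ℕ) → total f ≡ 0 → ∀ i → f i ≡ 0
  total≡0 f eq zero    = ℕ.m+n≡0⇒m≡0 (f zero) eq
  total≡0 f eq (suc i) = total≡0 (f ∘ suc) (ℕ.m+n≡0⇒n≡0 (f zero) eq) i

  sum≡0 : ∀ {k} (v : Vec ℕ k) → Vec.sum v ≡ 0 → v ≡ Vec.replicate k 0
  sum≡0 []      eq = ≡.refl
  sum≡0 (x ∷ v) eq = ≡.cong₂ _∷_ (ℕ.m+n≡0⇒m≡0 x eq) (sum≡0 v (ℕ.m+n≡0⇒n≡0 x eq))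

  rows≡∅ : ∀ {m k} (T : Multiset m k) → (∀ i → Vec.sum (Vec.lookup T i) ≡ 0) → T ≡ ∅
  rows≡∅ []      h = ≡.refl
  rows≡∅ (v ∷ T) h = ≡.cong₂ _∷_ (sum≡0 v (h zero)) (rows≡∅ T (h ∘ suc))

  nonEmpty⇒positive : ∀ {m k} (T : Multiset m k) → NonEmpty T →
    1 ℕ.≤ total (λ i → Vec.sum (Vec.lookup T i))
  nonEmpty⇒positive T T≢∅ = ℕ.n≢0⇒n>0 λ eq → T≢∅ (rows≡∅ T (total≡0 _ eq))

  length≤total : ∀ {m k} {π : List (Multiset m k)} → All NonEmpty π →
    length π ℕ.≤ total (λ i → elements i π)
  length≤total []                  = z≤n
  length≤total {π = T ∷ π} (p ∷ ps) =
    ≡.subst (suc (length π) ℕ.≤_) (≡.sym (total-+ (λ i → Vec.sum (Vec.lookup T i)) (λ i → elements i π)))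
      (ℕ.+-mono-≤ (nonEmpty⇒positive T p) (length≤total ps))

  lookup≤sum : ∀ {k} (v : Vec ℕ k) j → Vec.lookup v j ℕ.≤ Vec.sum v
  lookup≤sum (x ∷ v) zero    = ℕ.m≤m+n x _
  lookup≤sum (x ∷ v) (suc j) = ℕ.≤-trans (lookup≤sum v j) (ℕ.m≤n+m _ x)

  row≤elements : ∀ {m k} {T : Multiset m k} {π} → T ∈ π → ∀ i →
    Vec.sum (Vec.lookup T i) ℕ.≤ elements i π
  row≤elements (here ≡.refl) i = ℕ.m≤m+n _ _
  row≤elements (there T∈)    i = ℕ.≤-trans (row≤elements T∈ i) (ℕ.m≤n+m _ _)

  elements-resp-↭ : ∀ {m k} {π γ : List (Multiset m k)} → π ↭ γ → ∀ i → elements i π ≡ elements i γ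
  elements-resp-↭ p i = ListActionₚ.sum-↭ (↭ₚ.map⁺ (λ T → Vec.sum (Vec.lookup T i)) p)

  module _ {m r k : ℕ} where

    inBoundedBlocks : (ν : MultisetPartition m r k) → All (_∈ boundedBlocks m r k) (blocks ν)
    inBoundedBlocks ν = All.tabulate λ {T} T∈ →
      ∈-filter⁺ nonEmpty? (tuples-complete T λ i → tuples-complete (Vec.lookup T i) λ j →
        ∈-upTo⁺ (s≤s (ℕ.≤-trans (lookup≤sum (Vec.lookup T i) j)
          (≡.subst (Vec.sum (Vec.lookup T i) ℕ.≤_) (balanced ν i) (row≤elements T∈ i)))))
        (All.lookup (nonEmpty ν) T∈)

    inCandidates : (ν : MultisetPartition m r k) → ∃ λ c → c ∈ candidates m r k × c ↭ blocks ν
    inCandidates ν =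
      let c , c∈ , p = multichoose-complete _≟ᴹ_ _ (boundedBlocks m r k) (blocks ν) ≡.refl (inBoundedBlocks ν)
          n≤ = ≡.subst (length (blocks ν) ℕ.≤_) (total-const (balanced ν)) (length≤total (nonEmpty ν))
      in c , ∈-concatMap⁺ (λ n → multichoose n (boundedBlocks m r k))
               (lose (∈-upTo⁺ (s≤s n≤)) c∈) , p

    inPartitionsAmong : ∀ {c} πs → c ∈ πs → (ν : MultisetPartition m r k) → c ↭ blocks ν →
      Any (ν ≋_) (partitionsAmong m r k πs)
    inPartitionsAmong (π ∷ πs) c∈ ν p
      with All.all? nonEmpty? π | Finₚ.all? (λ i → elements i π ℕ.≟ r) | c∈
    ... | yes _ | yes _ | here ≡.refl = here (↭-sym p)
    ... | yes _ | yes _ | there c∈πs  = there (inPartitionsAmong πs c∈πs ν p)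
    ... | yes _ | no _  | there c∈πs  = inPartitionsAmong πs c∈πs ν p
    ... | no _  | _     | there c∈πs  = inPartitionsAmong πs c∈πs ν p
    ... | no ¬p | _     | here ≡.refl = ⊥-elim (¬p (All-resp-↭ (↭-sym p) (nonEmpty ν)))
    ... | yes _ | no ¬q | here ≡.refl =
      ⊥-elim (¬q λ i → ≡.trans (elements-resp-↭ p i) (balanced ν i))

    candidates-unique : AllPairs _≁_ (candidates m r k)
    candidates-unique = AllPairsₚ.concat⁺
      (Allₚ.map⁺ (All.universal (λ n → multichoose-unique n unique) sizes))
      (AllPairsₚ.map⁺ {xs = sizes} (AllPairs.map different (Uniqueₚ.upTo⁺ (suc (m ℕ.* r)))))
      where
      sizes = upTo (suc (m ℕ.* r))
      different : ∀ {n n′} → n ≢ n′ → All (λ c → All (c ≁_) (multichoose n′ (boundedBlocks m r k)))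
                                          (multichoose n (boundedBlocks m r k))
      different {n} {n′} n≢n′ = All.tabulate λ c∈ → All.tabulate λ d∈ p → n≢n′
        (≡.trans (≡.sym (multichoose-length n (boundedBlocks m r k) c∈))
          (≡.trans (↭-length p) (multichoose-length n′ (boundedBlocks m r k) d∈)))
      unique : Unique (boundedBlocks m r k)
      unique = Uniqueₚ.filter⁺ nonEmpty? (tuples-unique m (tuples-unique k (Uniqueₚ.upTo⁺ (suc r))))

    partitionsAmong-all : ∀ {P : List (Multiset m k) → Set} πs → All P πs →
      All (P ∘ blocks) (partitionsAmong m r k πs)
    partitionsAmong-all []       []       = []
    partitionsAmong-all (π ∷ πs) (h ∷ hs)
      with All.all? nonEmpty? π | Finₚ.all? (λ i → elements i π ℕ.≟ r)
    ... | yes _ | yes _ = h ∷ partitionsAmong-all πs hs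
    ... | yes _ | no _  = partitionsAmong-all πs hs
    ... | no _  | _     = partitionsAmong-all πs hs

    partitionsAmong-unique : ∀ πs → AllPairs _≁_ πs →
      AllPairs (λ π γ → ¬ (π ≋ γ)) (partitionsAmong m r k πs)
    partitionsAmong-unique []       []       = []
    partitionsAmong-unique (π ∷ πs) (h ∷ hs)
      with All.all? nonEmpty? π | Finₚ.all? (λ i → elements i π ℕ.≟ r)
    ... | yes _ | yes _ = partitionsAmong-all πs h ∷ partitionsAmong-unique πs hs
    ... | yes _ | no _  = partitionsAmong-unique πs hs
    ... | no _  | _     = partitionsAmong-unique πs hs

module _ (m r k : ℕ) where
  open SetoidEnumerates (partitionSetoid m r k) using (IsEnumeration)
  open SetoidUnique (partitionSetoid m r k) renaming (Unique to Unique≋) using ()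

  allPartitions-complete : IsEnumeration (allPartitions m r k)
  allPartitions-complete ν =
    let c , c∈ , p = inCandidates ν in inPartitionsAmong (candidates m r k) c∈ ν p

  allPartitions-unique : Unique≋ (allPartitions m r k)
  allPartitions-unique = partitionsAmong-unique (candidates m r k) candidates-unique

multiplicities!≢0 : ∀ {m k} (π : List (Multiset m k)) → ℕ.NonZero (multiplicities! π)
multiplicities!≢0 π = ListActionₚ.product≢0
  (Allₚ.map⁺ (All.universal (λ T → multiplicity T π ℕ.!≢0) (deduplicate _≟ᴹ_ π)))

infixl 7 _/m!_
_/m!_ : ∀ {m k} → ℕ → List (Multiset m k) → ℚ
n /m! π = ((+ n) ℚ./ multiplicities! π) {{multiplicities!≢0 π}}

module _ {r k : ℕ} (ν : Γ r k) where

  fibre : Multiset 2 k → List (Multiset 3 k)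
  fibre S = filter (λ T → select σ₁₃ T ≟ᴹ S) (blocks ν)

  -- The blocks with no element outside the middle alphabet.
  β : List (Multiset 3 k)
  β = fibre ∅

  a : ℚ
  a = foldr ℚ._*_ 1ℚ
    (map (λ S → length (fibre S) ! /m! fibre S)
         (deduplicate _≟ᴹ_ (blocks (ν ↾ σ₁₃))))

-- Used with K = ℂ(x), ι the inclusion of ℚ and x the indeterminate.
module MultisetPartitionAlgebra {c ℓ} (K : CommutativeRing c ℓ)
    (ι : ℚ → CommutativeRing.Carrier K) (x : CommutativeRing.Carrier K) (r k : ℕ) where
  open CommutativeRing K hiding (zero)

  -- The falling factorial (t)ₛ = t (t - 1) ⋯ (t - s + 1).
  falling : Carrier → ℕ → Carrier
  falling t zero    = 1#
  falling t (suc s) = t * falling (t - 1#) s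

  b : Γ r k → Carrier
  b ν = falling (x - ι (+ length (blocks (ν ↾ σ₁₃)) ℚ./ 1)) (length (β ν))
      * ι (1 /m! β ν)

  -- Formal linear combinations of the X π, equal when their coefficients are.
  MP : Set c
  MP = List (Carrier × Π r k)

  X : Π r k → MP
  X π = [ 1# , π ]

  coefficient : MP → Π r k → Carrier
  coefficient []            ρ = 0#
  coefficient ((c , π) ∷ u) ρ with does (π ≋? ρ)
  ... | true  = c + coefficient u ρ
  ... | false = coefficient u ρ

  infix 4 _≈ᴹ_
  _≈ᴹ_ : MP → MP → Set ℓ
  u ≈ᴹ v = ∀ ρ → coefficient u ρ ≈ coefficient v ρ

  infixr 7 _•_
  _•_ : Carrier → MP → MP
  c • u = map (map₁ (c *_)) u

  -- The product X π · X γ.  The restriction of ν to the last two alphabets has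
  -- already lost a bar, so it is compared with γ itself.
  basisProduct : Π r k → Π r k → MP
  basisProduct π γ = concatMap (λ ν → (ι (a ν) * b ν) • X (ν ↾ σ₁₃))
    (filter (λ ν → (ν ↾ σ₁₂ ≋? π) ×-dec (ν ↾ σ₂₃ ≋? γ)) (allPartitions 3 r k))

  -- The bilinear extension of basisProduct.
  infixl 7 _·_
  _·_ : MP → MP → MP
  u · v = concatMap (λ (c , π) → concatMap (λ (d , γ) → (c * d) • basisProduct π γ) v) u

  -- The product is well defined on MP modulo ≈ᴹ (·-cong).
  open SetoidReasoning setoid
  open CSProps +-commutativeSemigroup using (interchange)

  evaluate : (Π r k → Carrier) → MP → Carrier
  evaluate F []            = 0#
  evaluate F ((c , π) ∷ u) = c * F π + evaluate F u

  evaluate-++ : ∀ F u v → evaluate F (u ++ v) ≈ evaluate F u + evaluate F v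
  evaluate-++ F []            v = sym (+-identityˡ _)
  evaluate-++ F ((c , π) ∷ u) v = trans (+-congˡ (evaluate-++ F u v)) (sym (+-assoc _ _ _))

  evaluate-• : ∀ F c u → evaluate F (c • u) ≈ c * evaluate F u
  evaluate-• F c []            = sym (zeroʳ c)
  evaluate-• F c ((d , π) ∷ u) =
    trans (+-cong (*-assoc c d (F π)) (evaluate-• F c u)) (sym (distribˡ c _ _))

  evaluate-congˡ : ∀ {F G} → (∀ π → F π ≈ G π) → ∀ u → evaluate F u ≈ evaluate G u
  evaluate-congˡ h []            = refl
  evaluate-congˡ h ((c , π) ∷ u) = +-cong (*-congˡ (h π)) (evaluate-congˡ h u)

  δ : Π r k → Π r k → Carrier
  δ ρ π with does (π ≋? ρ)
  ... | true  = 1#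
  ... | false = 0#

  coefficient≈evaluate : ∀ u ρ → coefficient u ρ ≈ evaluate (δ ρ) u
  coefficient≈evaluate []            ρ = refl
  coefficient≈evaluate ((c , π) ∷ u) ρ with does (π ≋? ρ)
  ... | true  = +-cong (sym (*-identityʳ c)) (coefficient≈evaluate u ρ)
  ... | false = trans (coefficient≈evaluate u ρ)
    (trans (sym (+-identityˡ _)) (+-congʳ (sym (zeroʳ c))))

  sumOver : List (Π r k) → (Π r k → Carrier) → Carrier
  sumOver []       g = 0#
  sumOver (ρ ∷ ρs) g = g ρ + sumOver ρs g

  sumOver-cong : ∀ ρs {g h} → (∀ ρ → g ρ ≈ h ρ) → sumOver ρs g ≈ sumOver ρs h
  sumOver-cong []       e = refl
  sumOver-cong (ρ ∷ ρs) e = +-cong (e ρ) (sumOver-cong ρs e)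

  sumOver-+ : ∀ ρs g h → sumOver ρs (λ ρ → g ρ + h ρ) ≈ sumOver ρs g + sumOver ρs h
  sumOver-+ []       g h = sym (+-identityˡ _)
  sumOver-+ (ρ ∷ ρs) g h = trans (+-congˡ (sumOver-+ ρs g h)) (interchange _ _ _ _)

  sumOver-0 : ∀ ρs g → All (λ ρ → g ρ ≈ 0#) ρs → sumOver ρs g ≈ 0#
  sumOver-0 []       g []       = refl
  sumOver-0 (ρ ∷ ρs) g (e ∷ es) = trans (+-cong e (sumOver-0 ρs g es)) (+-identityˡ _)

  δ≈1 : ∀ ρ π → π ≋ ρ → δ ρ π ≈ 1#
  δ≈1 ρ π p with π ≋? ρ
  ... | yes _ = refl
  ... | no ¬p = ⊥-elim (¬p p)

  δ≈0 : ∀ ρ π → ¬ (π ≋ ρ) → δ ρ π ≈ 0#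
  δ≈0 ρ π ¬p with π ≋? ρ
  ... | yes p = ⊥-elim (¬p p)
  ... | no _  = refl

  Invariant : (Π r k → Carrier) → Set _
  Invariant F = ∀ {π γ} → π ≋ γ → F π ≈ F γ

  sumOver-δ : ∀ {F} → Invariant F → ∀ π ρs → Any (π ≋_) ρs → AllPairs (λ ρ τ → ¬ (ρ ≋ τ)) ρs →
    sumOver ρs (λ ρ → δ ρ π * F ρ) ≈ F π
  sumOver-δ {F} inv π (ρ ∷ ρs) (here p) (ρ∉ ∷ u) = begin
    δ ρ π * F ρ + sumOver ρs _
      ≈⟨ +-cong (*-cong (δ≈1 ρ π p) (inv (↭-sym p)))
           (sumOver-0 ρs _ (All.map (λ {τ} ρ≉τ →
             trans (*-congʳ (δ≈0 τ π λ q → ρ≉τ (↭-trans (↭-sym p) q))) (zeroˡ _)) ρ∉)) ⟩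
    1# * F π + 0# ≈⟨ +-identityʳ _ ⟩
    1# * F π      ≈⟨ *-identityˡ _ ⟩
    F π           ∎
  sumOver-δ {F} inv π (ρ ∷ ρs) (there π∈) (ρ∉ ∷ u) = begin
    δ ρ π * F ρ + sumOver ρs _
      ≈⟨ +-cong (trans (*-congʳ (δ≈0 ρ π (ρ≉π ρ∉ π∈))) (zeroˡ _)) (sumOver-δ inv π ρs π∈ u) ⟩
    0# + F π ≈⟨ +-identityˡ _ ⟩
    F π      ∎
    where
    ρ≉π : ∀ {τs} → All (λ τ → ¬ (ρ ≋ τ)) τs → Any (π ≋_) τs → ¬ (π ≋ ρ)
    ρ≉π (¬p ∷ _)  (here q)   p = ¬p (↭-trans (↭-sym p) q)
    ρ≉π (_ ∷ ¬ps) (there qs) p = ρ≉π ¬ps qs p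

  evaluate≈sumOver : ∀ {F} → Invariant F → ∀ u →
    evaluate F u ≈ sumOver (allPartitions 2 r k) (λ ρ → evaluate (δ ρ) u * F ρ)
  evaluate≈sumOver {F} inv [] =
    sym (sumOver-0 ρs (λ ρ → 0# * F ρ) (All.universal (λ ρ → zeroˡ (F ρ)) ρs))
    where ρs = allPartitions 2 r k
  evaluate≈sumOver {F} inv ((c , π) ∷ u) = begin
    c * F π + evaluate F u
      ≈⟨ +-cong (sumOver-δ {λ ρ → c * F ρ} (λ p → *-congˡ (inv p)) π ρs
                   (allPartitions-complete 2 r k π) (allPartitions-unique 2 r k))
                refl ⟨
    sumOver ρs (λ ρ → δ ρ π * (c * F ρ)) + evaluate F u
      ≈⟨ +-congˡ (evaluate≈sumOver inv u) ⟩
    sumOver ρs (λ ρ → δ ρ π * (c * F ρ)) + sumOver ρs (λ ρ → evaluate (δ ρ) u * F ρ)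
      ≈⟨ sumOver-+ ρs _ _ ⟨
    sumOver ρs (λ ρ → δ ρ π * (c * F ρ) + evaluate (δ ρ) u * F ρ)
      ≈⟨ sumOver-cong ρs (λ ρ → trans (+-congʳ (trans (sym (*-assoc _ _ _))
           (*-congʳ (*-comm _ _)))) (sym (distribʳ _ _ _))) ⟩
    sumOver ρs (λ ρ → (c * δ ρ π + evaluate (δ ρ) u) * F ρ) ∎
    where ρs = allPartitions 2 r k

  evaluate-congʳ : ∀ {F} → Invariant F → ∀ {u v} → u ≈ᴹ v → evaluate F u ≈ evaluate F v
  evaluate-congʳ {F} inv {u} {v} e = begin
    evaluate F u ≈⟨ evaluate≈sumOver inv u ⟩
    sumOver ρs (λ ρ → evaluate (δ ρ) u * F ρ)
      ≈⟨ sumOver-cong ρs (λ ρ → *-congʳ (trans (sym (coefficient≈evaluate u ρ))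
           (trans (e ρ) (coefficient≈evaluate v ρ)))) ⟩
    sumOver ρs (λ ρ → evaluate (δ ρ) v * F ρ) ≈⟨ evaluate≈sumOver inv v ⟨
    evaluate F v ∎
    where ρs = allPartitions 2 r k

  evaluate-· : ∀ F u v → evaluate F (u · v) ≈
    evaluate (λ π → evaluate (λ γ → evaluate F (basisProduct π γ)) v) u
  evaluate-· F []            v = refl
  evaluate-· F ((c , π) ∷ u) v =
    trans (evaluate-++ F (concatMap _ v) (u · v)) (+-cong (go v) (evaluate-· F u v))
    where
    go : ∀ v → evaluate F (concatMap (λ (d , γ) → (c * d) • basisProduct π γ) v) ≈
      c * evaluate (λ γ → evaluate F (basisProduct π γ)) v
    go []            = sym (zeroʳ c)
    go ((d , γ) ∷ v) = begin
      evaluate F ((c * d) • basisProduct π γ ++ concatMap _ v)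
        ≈⟨ evaluate-++ F ((c * d) • basisProduct π γ) (concatMap _ v) ⟩
      evaluate F ((c * d) • basisProduct π γ) + evaluate F (concatMap _ v)
        ≈⟨ +-cong (trans (evaluate-• F (c * d) (basisProduct π γ)) (*-assoc c d _)) (go v) ⟩
      c * (d * evaluate F (basisProduct π γ)) + c * evaluate _ v
        ≈⟨ distribˡ c _ _ ⟨
      c * (d * evaluate F (basisProduct π γ) + evaluate _ v) ∎

  basisProduct-cong : ∀ {π π′ γ γ′} → π ≋ π′ → γ ≋ γ′ → basisProduct π γ ≡ basisProduct π′ γ′
  basisProduct-cong p q = ≡.cong (concatMap _) (Listₚ.filter-≐ _ _
    ( (λ (s , t) → ↭-trans s p , ↭-trans t q)
    , (λ (s , t) → ↭-trans s (↭-sym p) , ↭-trans t (↭-sym q)) )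
    (allPartitions 3 r k))

  ·-cong : ∀ {u u′ v v′} → u ≈ᴹ u′ → v ≈ᴹ v′ → u · v ≈ᴹ u′ · v′
  ·-cong {u} {u′} {v} {v′} e f ρ = begin
    coefficient (u · v) ρ            ≈⟨ coefficient≈evaluate (u · v) ρ ⟩
    evaluate (δ ρ) (u · v)           ≈⟨ evaluate-· (δ ρ) u v ⟩
    evaluate (λ π → evaluate (s π) v) u
      ≈⟨ evaluate-congʳ (λ {π} {π′} p → evaluate-congˡ (λ γ → s-cong {π} {π′} {γ} {γ} p ↭-refl) v)
           {u} {u′} e ⟩
    evaluate (λ π → evaluate (s π) v) u′
      ≈⟨ evaluate-congˡ (λ π → evaluate-congʳ
           (λ {γ} {γ′} q → s-cong {π} {π} {γ} {γ′} ↭-refl q) {v} {v′} f) u′ ⟩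
    evaluate (λ π → evaluate (s π) v′) u′ ≈⟨ evaluate-· (δ ρ) u′ v′ ⟨
    evaluate (δ ρ) (u′ · v′)         ≈⟨ coefficient≈evaluate (u′ · v′) ρ ⟨
    coefficient (u′ · v′) ρ          ∎
    where
    s : Π r k → Π r k → Carrier
    s π γ = evaluate (δ ρ) (basisProduct π γ)
    s-cong : ∀ {π π′ γ γ′} → π ≋ π′ → γ ≋ γ′ → s π γ ≈ s π′ γ′
    s-cong {π} {π′} {γ} {γ′} p q =
      reflexive (≡.cong (evaluate (δ ρ)) (basisProduct-cong {π} {π′} {γ} {γ′} p q))

{-# OPTIONS --safe #-}

-- Fix rows M, P ∈ (ℕᵏ)ⁿ such that the nonzero columns of the 2 × n array (M, P) form
-- ν|₁₃.  Then a_ν b_ν(n) is the number of rows N for which the nonzero columns of the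
-- array (M, N, P) form ν.  Hence at x = n the structure constant of π, γ, ρ counts the
-- rows N with (M, N) of type π and (N, P) of type γ, where (M, P) has type ρ, and the
-- coefficients of X_ρ in (X_π X_γ) X_τ and in X_π (X_γ X_τ) both count the pairs (N, Q)
-- with (M, N), (N, Q), (Q, P) of types π, γ, τ.  Such M and P exist as soon as n ≥ ℓ(ρ),
-- and the two coefficients are polynomials in x over ℚ, so they are equal.
module Submission where

open import Defs
open import Algebra.Bundles using (CommutativeMonoid; CommutativeRing; CommutativeSemiring)
open import Algebra.Definitions using (Associative)
import Algebra.Morphism.Construct.Composition as Composition
import Algebra.Morphism.Construct.Identity as Identity
open import Algebra.Morphism.Structures using (module RingMorphisms)
import Algebra.Properties.CommutativeSemigroup as CommutativeSemigroupProperties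
import Algebra.Properties.Ring as RingProperties
import Algebra.Solver.Ring.NaturalCoefficients.Default as SemiringSolver
open import Data.Bool.Base using (if_then_else_)
open import Data.Empty using (⊥-elim)
open import Data.Fin.Base using (Fin)
open import Data.Fin.Patterns using (0F; 1F; 2F)
open import Data.Integer.Base as ℤ using (+_)
import Data.Integer.Properties as ℤ
open import Data.List.Base as List
  using (List; []; _∷_; _++_; map; filter; length; concatMap; cartesianProductWith;
         deduplicate; replicate; foldr)
import Data.List.Membership.DecPropositional as DecMembership
open import Data.List.Membership.Propositional using (_∈_)
open import Data.List.Membership.Propositional.Properties
  using (∈-∃++; ∈-deduplicate⁺; ∈-deduplicate⁻; ∈-filter⁺; ∈-map⁺; ∈-concatMap⁺)
import Data.List.Properties as List
open import Data.List.Relation.Binary.Permutation.Propositional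
  using (_↭_; ↭-refl; ↭-sym; ↭-trans; ↭-reflexive; prep)
open import Data.List.Relation.Binary.Permutation.Propositional.Properties as ↭
  using (shift; drop-∷; ↭-length; All-resp-↭; filter-↭; ∈-resp-↭)
open import Data.List.Relation.Unary.All as All using (All; []; _∷_)
import Data.List.Relation.Unary.All.Properties as All
open import Data.List.Relation.Unary.AllPairs as AllPairs using (AllPairs; []; _∷_)
open import Data.List.Relation.Unary.Any as Any using (Any; here; there)
open import Data.List.Relation.Unary.Unique.Propositional using (Unique)
import Data.List.Relation.Unary.Unique.DecPropositional.Properties as DecUnique
open import Data.Nat.Base as ℕ using (ℕ; zero; suc; _!; _∸_)
open import Data.Nat.ListAction using (product)
open import Data.Nat.ListAction.Properties using (sum-↭)
import Data.Nat.Properties as ℕ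
open import Data.Product using (_,_; ∃₂; _×_)
open import Data.Rational.Base as ℚ using (ℚ; 0ℚ; 1ℚ)
import Data.Rational.Properties as ℚ
open import Data.Rational.Unnormalised.Base as ℚᵘ using (mkℚᵘ; *≡*)
import Data.Rational.Unnormalised.Properties as ℚᵘ
open import Data.Sum.Base using ([_,_]′)
open import Data.Vec.Base as Vec using (Vec; []; _∷_)
import Data.Vec.Properties as Vec
open import Function.Base using (_∘_; id)
open import Level using (Level)
open import Relation.Binary.Definitions using (DecidableEquality)
open import Relation.Binary.PropositionalEquality as ≡ using (_≡_; _≢_)
import Relation.Binary.Reasoning.Setoid as SetoidReasoning
open import Relation.Nullary using (¬_; Dec; yes; no; does)
open import Relation.Nullary.Decidable using (_×-dec_)
open import Relation.Unary using (Decidable)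
open Polynomials ℚ.+-*-commutativeRing using (_+ᵖ_) renaming (_·_ to _·ᵖ_)

-- Fractions of polynomials are not evaluated at `n`. The passage from `x = n` to the indeterminate
-- is made by `Interpolates`: one list of rational coefficients yields the value over ℚ at every `n`
-- and the element at `x` in any ring `K` with a ring map from ℚ. Both sides of associativity are
-- built by sums, scalars and factors `x - q`, so closure under these is enough. The coefficients
-- refer to Newton's basis starting at `N = ℓ(ρ)`, because equality is known exactly from there on:
-- vanishing at N, N + 1, ... kills such coefficients one after another. The count behind a_ν b_ν(n)
-- is a quotient of two stabiliser orders. Padding ν and ν|₁₃ with zero columns to length n makes
-- both orders products of factorials; their quotient is the product of multinomials, the falling
-- factorial and 1/m(β)!. The count is stated as a product, so that it remains in ℕ. If n < ℓ(ν) no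
-- row exists, and b_ν(n) vanishes because the array (M, P) forces ℓ(ν|₁₃) ≤ n. There are infinitely
-- many rows; the sums run over those with entries from a finite list containing every middle part
-- of an element of Γ.

module _ {c ℓ : Level} (R : CommutativeSemiring c ℓ) where
  open CommutativeSemiring R
  open SemiringSolver R

  weight-interchange : ∀ a F B S A Q → a * (F * B) * (S * A * Q) ≈ a * A * (F * Q) * (B * S)
  weight-interchange = solve 6 (λ a F B S A Q →
    a :* (F :* B) :* (S :* A :* Q) := a :* A :* (F :* Q) :* (B :* S)) refl

  weight-assoc : ∀ a F B y → a * (F * (B * y)) ≈ a * (F * B) * y
  weight-assoc = solve 4 (λ a F B y → a :* (F :* (B :* y)) := a :* (F :* B) :* y) refl

-- Finite sums and indicator functions

module Summation {c ℓ : Level} (R : CommutativeSemiring c ℓ) where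
  open CommutativeSemiring R
  open CommutativeSemigroupProperties +-commutativeSemigroup using (interchange)

  ∑ : {A : Set} → List A → (A → Carrier) → Carrier
  ∑ []       f = 0#
  ∑ (x ∷ xs) f = f x + ∑ xs f

  -- Iverson brackets.
  ⟦_⟧ : {P : Set} → Dec P → Carrier
  ⟦ d ⟧ = if does d then 1# else 0#

  ⟦⟧-yes : {P : Set} (d : Dec P) → P → ⟦ d ⟧ ≈ 1#
  ⟦⟧-yes (yes _) p = refl
  ⟦⟧-yes (no ¬p) p = ⊥-elim (¬p p)

  ⟦⟧-no : {P : Set} (d : Dec P) → ¬ P → ⟦ d ⟧ ≈ 0#
  ⟦⟧-no (yes p) ¬p = ⊥-elim (¬p p)
  ⟦⟧-no (no _)  ¬p = refl

  ⟦⟧-⇔ : {P Q : Set} (d : Dec P) (e : Dec Q) → (P → Q) → (Q → P) → ⟦ d ⟧ ≈ ⟦ e ⟧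
  ⟦⟧-⇔ (yes p) e f g = sym (⟦⟧-yes e (f p))
  ⟦⟧-⇔ (no ¬p) e f g = sym (⟦⟧-no e (¬p ∘ g))

  ⟦⟧-× : {P Q : Set} (d : Dec P) (e : Dec Q) → ⟦ d ×-dec e ⟧ ≈ ⟦ d ⟧ * ⟦ e ⟧
  ⟦⟧-× (yes _) (yes _) = sym (*-identityʳ 1#)
  ⟦⟧-× (yes _) (no _)  = sym (*-identityˡ 0#)
  ⟦⟧-× (no _)  e       = sym (zeroˡ ⟦ e ⟧)

  ∑-cong : ∀ {A : Set} (xs : List A) {f g} → (∀ x → f x ≈ g x) → ∑ xs f ≈ ∑ xs g
  ∑-cong []       e = refl
  ∑-cong (x ∷ xs) e = +-cong (e x) (∑-cong xs e)

  ∑-zero : ∀ {A : Set} (xs : List A) {f} → All (λ x → f x ≈ 0#) xs → ∑ xs f ≈ 0#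
  ∑-zero []       []       = refl
  ∑-zero (x ∷ xs) (e ∷ es) = trans (+-cong e (∑-zero xs es)) (+-identityˡ 0#)

  ∑-+ : ∀ {A : Set} (xs : List A) f g → ∑ xs (λ x → f x + g x) ≈ ∑ xs f + ∑ xs g
  ∑-+ []       f g = sym (+-identityˡ 0#)
  ∑-+ (x ∷ xs) f g = trans (+-congˡ (∑-+ xs f g)) (interchange _ _ _ _)

  ∑-*ˡ : ∀ {A : Set} (xs : List A) z f → ∑ xs (λ x → z * f x) ≈ z * ∑ xs f
  ∑-*ˡ []       z f = sym (zeroʳ z)
  ∑-*ˡ (x ∷ xs) z f = trans (+-congˡ (∑-*ˡ xs z f)) (sym (distribˡ z _ _))

  ∑-*ʳ : ∀ {A : Set} (xs : List A) f z → ∑ xs (λ x → f x * z) ≈ ∑ xs f * z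
  ∑-*ʳ xs f z =
    trans (∑-cong xs λ _ → *-comm _ z) (trans (∑-*ˡ xs z f) (*-comm z _))

  ∑-++ : ∀ {A : Set} (xs ys : List A) f → ∑ (xs ++ ys) f ≈ ∑ xs f + ∑ ys f
  ∑-++ []       ys f = sym (+-identityˡ _)
  ∑-++ (x ∷ xs) ys f = trans (+-congˡ (∑-++ xs ys f)) (sym (+-assoc _ _ _))

  ∑-swap : ∀ {A B : Set} (xs : List A) (ys : List B) (f : A → B → Carrier) →
    ∑ xs (λ x → ∑ ys (f x)) ≈ ∑ ys (λ y → ∑ xs (λ x → f x y))
  ∑-swap []       ys f = sym (∑-zero ys {λ _ → 0#} (All.universal (λ _ → refl) ys))
  ∑-swap (x ∷ xs) ys f =
    trans (+-congˡ (∑-swap xs ys f)) (sym (∑-+ ys (f x) _))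

  ∑-map : ∀ {A B : Set} (h : B → A) (ys : List B) f → ∑ (map h ys) f ≈ ∑ ys (f ∘ h)
  ∑-map h []       f = refl
  ∑-map h (y ∷ ys) f = +-congˡ (∑-map h ys f)

  -- Uniqueness is expressed through `P` instead of inequality of entries, because `Γs` is free of
  -- repetitions only up to permutation of blocks.
  ∑-single : ∀ {A : Set} (xs : List A) {P : A → Set} {f z} → Any P xs →
    AllPairs (λ x y → P x → ¬ P y) xs → Decidable P →
    (∀ x → P x → f x ≈ z) → (∀ x → ¬ P x → f x ≈ 0#) → ∑ xs f ≈ z
  ∑-single (x ∷ xs) (here p) (x∉ ∷ _) P? e₁ e₀ =
    trans (+-cong (e₁ x p) (∑-zero xs (All.map (λ {y} h → e₀ y (h p)) x∉))) (+-identityʳ _)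
  ∑-single (x ∷ xs) (there p∈) (x∉ ∷ u) P? e₁ e₀ =
    trans (+-cong (e₀ x (λ p → absurd p x∉ p∈)) (∑-single xs p∈ u P? e₁ e₀)) (+-identityˡ _)
    where
    absurd : ∀ {A : Set} {P : A → Set} {x xs} → P x → All (λ y → P x → ¬ P y) xs → ¬ Any P xs
    absurd p (h ∷ _)  (here q)   = h p q
    absurd p (_ ∷ hs) (there qs) = absurd p hs qs

  ∑-cartesianProductWith : ∀ {A B C : Set} (h : A → B → C) (xs : List A) (ys : List B) f →
    ∑ (cartesianProductWith h xs ys) f ≈ ∑ xs (λ x → ∑ ys (λ y → f (h x y)))
  ∑-cartesianProductWith h []       ys f = refl
  ∑-cartesianProductWith h (x ∷ xs) ys f = trans (∑-++ (map (h x) ys) _ f)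
    (+-cong (∑-map (h x) ys f) (∑-cartesianProductWith h xs ys f))

  ∑-pullˡ : ∀ {A : Set} (xs : List A) x w (u v : A → Carrier) →
    x * (w * ∑ xs (λ y → u y * v y)) ≈ ∑ xs (λ y → x * (w * u y) * v y)
  ∑-pullˡ xs x w u v = begin
    x * (w * ∑ xs (λ y → u y * v y)) ≈⟨ *-assoc x w _ ⟨
    x * w * ∑ xs (λ y → u y * v y)   ≈⟨ ∑-*ˡ xs (x * w) _ ⟨
    ∑ xs (λ y → x * w * (u y * v y)) ≈⟨ ∑-cong xs (λ y → trans (sym (*-assoc (x * w) (u y) (v y)))
                                          (*-congʳ (*-assoc x w (u y)))) ⟩
    ∑ xs (λ y → x * (w * u y) * v y) ∎
    where open SetoidReasoning setoid

  ∑-pullʳ : ∀ {A : Set} (xs : List A) x w (u v : A → Carrier) →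
    x * (w * ∑ xs (λ y → u y * v y)) ≈ ∑ xs (λ y → u y * (x * (w * v y)))
  ∑-pullʳ xs x w u v = trans (*-congˡ (*-congˡ (∑-cong xs λ y → *-comm (u y) (v y))))
    (trans (∑-pullˡ xs x w v u) (∑-cong xs λ y → *-comm _ (u y)))

-- Structure constants as sums over Γ, both for ℚ with `x = n` and for `K`

module StructureSums {c ℓ : Level} (K : CommutativeRing c ℓ)
    (ι : ℚ → CommutativeRing.Carrier K) (x : CommutativeRing.Carrier K) (r k : ℕ) where
  open CommutativeRing K using (Carrier; _*_; commutativeSemiring)
  open Summation commutativeSemiring
  open MultisetPartitionAlgebra K ι x r k using (b)

  weight : Γ r k → Carrier
  weight ν = ι (a ν) * b ν

  Γs : List (Γ r k)
  Γs = allPartitions 3 r k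

  lies-over : Π r k → Π r k → Γ r k → Carrier
  lies-over π γ ν = ⟦ ν ↾ σ₁₂ ≋? π ⟧ * ⟦ ν ↾ σ₂₃ ≋? γ ⟧

  -- The coefficient of X_ρ in X_π X_γ. The filter in `basisProduct` has become a factor, so that
  -- the order of summation can be exchanged.
  structureConstant : Π r k → Π r k → Π r k → Carrier
  structureConstant π γ ρ = ∑ Γs λ ν → lies-over π γ ν * (weight ν * ⟦ ν ↾ σ₁₃ ≋? ρ ⟧)

  -- The coefficients of X ρ in (X π · X γ) · X τ and X π · (X γ · X τ).
  leftSum rightSum : Π r k → Π r k → Π r k → Π r k → Carrier
  leftSum  π γ τ ρ = ∑ Γs λ ν → lies-over π γ ν * (weight ν * structureConstant (ν ↾ σ₁₃) τ ρ)
  rightSum π γ τ ρ = ∑ Γs λ ν → lies-over γ τ ν * (weight ν * structureConstant π (ν ↾ σ₁₃) ρ)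

-- Counting the middle rows of an array

module _ where
  open import Data.Nat.Base using (_+_; _*_)
  open ≡ using (refl; sym; trans; cong; cong₂; subst)
  open ≡.≡-Reasoning
  open CommutativeSemigroupProperties ℕ.*-commutativeSemigroup using (x∙yz≈y∙xz)

  -- Serves `symmetries-fibres`, where adding one block alters the factor of a single fibre.
  product-scale : ∀ {A : Set} {L : List A} {z} {g h : A → ℕ} c → Unique L → z ∈ L →
    g z ≡ c * h z → (∀ x → x ≢ z → g x ≡ h x) → product (map g L) ≡ c * product (map h L)
  product-scale {L = x ∷ L} {h = h} c (x∉ ∷ _) (here refl) e₁ e₂ = begin
    _ ≡⟨ cong₂ _*_ e₁ (cong product (List.map-cong-local (All.map (λ x≢ → e₂ _ (x≢ ∘ sym)) x∉))) ⟩
    c * h x * product (map h L) ≡⟨ ℕ.*-assoc c (h x) _ ⟩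
    c * (h x * product (map h L)) ∎
  product-scale {L = x ∷ L} {h = h} c (x∉ ∷ u) (there z∈) e₁ e₂ = begin
    _ ≡⟨ cong₂ _*_ (e₂ x (All.lookup x∉ z∈)) (product-scale {h = h} c u z∈ e₁ e₂) ⟩
    h x * (c * product (map h L)) ≡⟨ x∙yz≈y∙xz (h x) c _ ⟩
    c * (h x * product (map h L)) ∎

  product-ones : ∀ {A : Set} (L : List A) → product (map (λ _ → 1) L) ≡ 1
  product-ones []      = refl
  product-ones (x ∷ L) = trans (ℕ.*-identityˡ _) (product-ones L)

  module _ {m k : ℕ} where

    -- The order of the stabiliser of a list under permutation of its entries, that is m(π)!.
    symmetries : List (Multiset m k) → ℕ
    symmetries []      = 1
    symmetries (T ∷ π) = suc (multiplicity T π) * symmetries π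

    multiplicity-here : ∀ (T : Multiset m k) π → multiplicity T (T ∷ π) ≡ suc (multiplicity T π)
    multiplicity-here T π = cong length (List.filter-accept (T ≟ᴹ_) refl)

    multiplicity-there : ∀ {S T : Multiset m k} π → S ≢ T → multiplicity S (T ∷ π) ≡ multiplicity S π
    multiplicity-there {S} π S≢T = cong length (List.filter-reject (S ≟ᴹ_) S≢T)

    multiplicity-↭ : ∀ (T : Multiset m k) {π γ} → π ↭ γ → multiplicity T π ≡ multiplicity T γ
    multiplicity-↭ T p = ↭-length (filter-↭ (T ≟ᴹ_) p)

    multiplicity-∉ : ∀ {T : Multiset m k} {π} → ¬ T ∈ π → multiplicity T π ≡ 0
    multiplicity-∉ {T} {π} T∉ =
      cong length (List.filter-none (T ≟ᴹ_) {π} (All.tabulate λ S∈ → λ { refl → T∉ S∈ }))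

    multiplicity-filter : ∀ {P : Multiset m k → Set} (P? : Decidable P) {T} π → P T →
      multiplicity T (filter P? π) ≡ multiplicity T π
    multiplicity-filter P? []      p = refl
    multiplicity-filter P? {T} (S ∷ π) p with P? S | T ≟ᴹ S
    ... | yes _ | yes refl = trans (multiplicity-here T _) (cong suc (multiplicity-filter P? π p))
    ... | yes _ | no T≢S   = trans (multiplicity-there _ T≢S) (multiplicity-filter P? π p)
    ... | no ¬q | yes refl = ⊥-elim (¬q p)
    ... | no _  | no _     = multiplicity-filter P? π p

    -- A permutation of positions that fixes the list preserves the values of `f`, so the stabiliser
    -- is the product of the stabilisers of the fibres. In the induction a new entry `T` changes
    -- only the factor at `f T`, and its multiplicity in that fibre is its multiplicity in `π`.
    symmetries-fibres : ∀ {B : Set} (_≟_ : DecidableEquality B) (f : Multiset m k → B) {L} →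
      Unique L → ∀ π → All (λ T → f T ∈ L) π →
      product (map (λ S → symmetries (filter (λ T → f T ≟ S) π)) L) ≡ symmetries π
    symmetries-fibres _≟_ f {L} u []      []        = product-ones L
    symmetries-fibres _≟_ f {L} u (T ∷ π) (T∈ ∷ h) = trans
      (product-scale {h = λ S → symmetries (filter (λ T → f T ≟ S) π)}
        (suc (multiplicity T π)) u T∈
        (trans (cong symmetries (List.filter-accept (λ U → f U ≟ f T) refl))
          (cong (λ n → suc n * symmetries (filter (λ U → f U ≟ f T) π))
            (multiplicity-filter (λ U → f U ≟ f T) π refl)))
        (λ S S≢ → cong symmetries (List.filter-reject (λ U → f U ≟ S) (S≢ ∘ sym))))
      (cong (suc (multiplicity T π) *_) (symmetries-fibres _≟_ f u π h))

    symmetries-constant : ∀ (S : Multiset m k) π →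
      symmetries (filter (λ T → T ≟ᴹ S) π) ≡ multiplicity S π !
    symmetries-constant S [] = refl
    symmetries-constant S (T ∷ π) with T ≟ᴹ S
    ... | yes refl rewrite multiplicity-here T π = cong₂ _*_
      (cong suc (multiplicity-filter (λ T → T ≟ᴹ S) π refl)) (symmetries-constant S π)
    ... | no T≢S rewrite multiplicity-there π (T≢S ∘ sym) = symmetries-constant S π

    -- The fibres of the identity are constant lists, whose stabilisers are full symmetric groups.
    product-multiplicities! : ∀ {L : List (Multiset m k)} → Unique L → ∀ π → All (_∈ L) π →
      product (map (λ T → multiplicity T π !) L) ≡ symmetries π
    product-multiplicities! {L} u π h = trans
      (cong product (List.map-cong (λ S → sym (symmetries-constant S π)) L))
      (symmetries-fibres _≟ᴹ_ (λ T → T) u π h)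

    deduplicate-covers : ∀ (π : List (Multiset m k)) → All (_∈ deduplicate _≟ᴹ_ π) π
    deduplicate-covers π = All.tabulate (∈-deduplicate⁺ _≟ᴹ_)

    multiplicities!≡symmetries : ∀ (π : List (Multiset m k)) → multiplicities! π ≡ symmetries π
    multiplicities!≡symmetries π =
      product-multiplicities! (DecUnique.deduplicate-! _≟ᴹ_ π) π (deduplicate-covers π)

    -- The recursion reads the list in order; the product of factorials does not. Both lists are
    -- compared over the same index list `deduplicate _≟ᴹ_ π`.
    symmetries-↭ : ∀ {π γ : List (Multiset m k)} → π ↭ γ → symmetries π ≡ symmetries γ
    symmetries-↭ {π} {γ} p = begin
      symmetries π     ≡⟨ multiplicities!≡symmetries π ⟨
      multiplicities! π
        ≡⟨ cong product (List.map-cong (λ T → cong _! (multiplicity-↭ T p)) (deduplicate _≟ᴹ_ π)) ⟩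
      product (map (λ T → multiplicity T γ !) (deduplicate _≟ᴹ_ π))
        ≡⟨ product-multiplicities! (DecUnique.deduplicate-! _≟ᴹ_ π) γ
             (All-resp-↭ p (deduplicate-covers π)) ⟩
      symmetries γ ∎

  module _ {k : ℕ} where

    -- The columns of the array with rows `M` and `P`; zero columns are kept as `∅`, so the length
    -- is always `n`.
    join : ∀ {n} → Vec (Vec ℕ k) n → Vec (Vec ℕ k) n → List (Multiset 2 k)
    join []      []      = []
    join (u ∷ M) (v ∷ P) = (u ∷ v ∷ []) ∷ join M P

    join₃ : ∀ {n} → Vec (Vec ℕ k) n → Vec (Vec ℕ k) n → Vec (Vec ℕ k) n → List (Multiset 3 k)
    join₃ []      []      []      = []
    join₃ (u ∷ M) (c ∷ N) (v ∷ P) = (u ∷ c ∷ v ∷ []) ∷ join₃ M N P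

    infix 4 _↭?_
    _↭?_ : ∀ {m} (π γ : List (Multiset m k)) → Dec (π ↭ γ)
    _↭?_ = permutation? _≟ᴹ_

    open Summation ℕ.+-*-commutativeSemiring

    multiplicity-∷ : ∀ {m} (S T : Multiset m k) π →
      multiplicity S (T ∷ π) ≡ ⟦ S ≟ᴹ T ⟧ + multiplicity S π
    multiplicity-∷ S T π with S ≟ᴹ T
    ... | yes _ = refl
    ... | no _  = refl

    module _ {columns : List (Vec ℕ k)} (unique : Unique columns) where

      -- The blocks over `(u, v)` are sorted by their middle entry, which occurs exactly once in
      -- `columns`.
      ∑-multiplicity : ∀ u v π → All (λ T → Vec.lookup T 1F ∈ columns) π →
        ∑ columns (λ c → multiplicity (u ∷ c ∷ v ∷ []) π)
          ≡ multiplicity (u ∷ v ∷ []) (map (select σ₁₃) π)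
      ∑-multiplicity u v [] [] = ∑-zero columns (All.universal (λ _ → refl) columns)
      ∑-multiplicity u v ((p ∷ c₀ ∷ q ∷ []) ∷ π) (c₀∈ ∷ h) = begin
        ∑ columns (λ c → multiplicity (ucv c) (T ∷ π))
          ≡⟨ ∑-cong columns (λ c → multiplicity-∷ (ucv c) T π) ⟩
        ∑ columns (λ c → ⟦ ucv c ≟ᴹ T ⟧ + multiplicity (ucv c) π)
          ≡⟨ ∑-+ columns _ _ ⟩
        ∑ columns (λ c → ⟦ ucv c ≟ᴹ T ⟧) + ∑ columns (λ c → multiplicity (ucv c) π)
          ≡⟨ cong₂ _+_ new (∑-multiplicity u v π h) ⟩
        ⟦ uv ≟ᴹ pq ⟧ + multiplicity uv (map (select σ₁₃) π)
          ≡⟨ multiplicity-∷ uv pq _ ⟨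
        multiplicity uv (pq ∷ map (select σ₁₃) π) ∎
        where
        T = p ∷ c₀ ∷ q ∷ []
        uv = u ∷ v ∷ []
        pq = p ∷ q ∷ []
        ucv : Vec ℕ k → Multiset 3 k
        ucv c = u ∷ c ∷ v ∷ []
        new : ∑ columns (λ c → ⟦ ucv c ≟ᴹ T ⟧) ≡ ⟦ uv ≟ᴹ pq ⟧
        new = ∑-single columns {λ c → c ≡ c₀} (Any.map sym c₀∈)
          (AllPairs.map (λ x≢y x≡ y≡ → x≢y (trans x≡ (sym y≡))) unique)
          (λ c → Vec.≡-dec ℕ._≟_ c c₀)
          (λ { c refl → ⟦⟧-⇔ (ucv c ≟ᴹ T) (uv ≟ᴹ pq) (λ { refl → refl }) (λ { refl → refl }) })
          (λ c c≢c₀ → ⟦⟧-no (ucv c ≟ᴹ T) (λ { refl → c≢c₀ refl }))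

      -- Orbit–stabiliser: the arrays counted form a single orbit of the stabiliser of join M P,
      -- and each of them has a stabiliser of order symmetries π.
      count-rows : ∀ {n} (M P : Vec (Vec ℕ k) n) π →
        map (select σ₁₃) π ↭ join M P → All (λ T → Vec.lookup T 1F ∈ columns) π →
        ∑ (tuples columns n) (λ N → ⟦ join₃ M N P ↭? π ⟧) * symmetries π ≡ symmetries (join M P)
      count-rows [] [] []      p h = refl
      count-rows [] [] (T ∷ π) p h = ⊥-elim (↭.¬x∷xs↭[] p)
      count-rows {suc n} (u ∷ M) (v ∷ P) π p h = begin
        ∑ (tuples columns (suc n)) (λ N → ⟦ join₃ (u ∷ M) N (v ∷ P) ↭? π ⟧) * symmetries π
          ≡⟨ cong (_* symmetries π) (∑-cartesianProductWith _∷_ columns (tuples columns n) _) ⟩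
        ∑ columns count * symmetries π
          ≡⟨ ∑-*ʳ columns count (symmetries π) ⟨
        ∑ columns (λ c → count c * symmetries π)
          ≡⟨ ∑-cong columns (λ c → step c (ucv c ∈? π)) ⟩
        ∑ columns (λ c → multiplicity (ucv c) π * symmetries (join M P))
          ≡⟨ ∑-*ʳ columns (λ c → multiplicity (ucv c) π) _ ⟩
        ∑ columns (λ c → multiplicity (ucv c) π) * symmetries (join M P)
          ≡⟨ cong (_* symmetries (join M P)) (∑-multiplicity u v π h) ⟩
        multiplicity uv (map (select σ₁₃) π) * symmetries (join M P)
          -- By `p` the multiplicity of `uv` is taken in the whole array, which has one copy more
          -- than `join M P`; this is the factor in the recursion of `symmetries`.
          ≡⟨ cong (_* symmetries (join M P))
               (trans (multiplicity-↭ uv p) (multiplicity-here uv (join M P))) ⟩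
        suc (multiplicity uv (join M P)) * symmetries (join M P) ∎
        where
        open DecMembership (_≟ᴹ_ {3} {k}) using (_∈?_)
        uv = u ∷ v ∷ []
        ucv : Vec ℕ k → Multiset 3 k
        ucv c = u ∷ c ∷ v ∷ []
        count : Vec ℕ k → ℕ
        count c = ∑ (tuples columns n) (λ N → ⟦ ucv c ∷ join₃ M N P ↭? π ⟧)
        Step : Vec ℕ k → Set
        Step c = count c * symmetries π ≡ multiplicity (ucv c) π * symmetries (join M P)
        absent : ∀ c → ¬ ucv c ∈ π → Step c
        absent c ∉π = trans
          (cong (_* symmetries π) (∑-zero (tuples columns n) (All.universal
            (λ N → ⟦⟧-no (_ ↭? π) (λ q → ∉π (∈-resp-↭ q (here refl)))) _)))
          (cong (_* symmetries (join M P)) (sym (multiplicity-∉ ∉π)))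
        -- If the first entry of the row is `c`, the first column uses up one copy of `ucv c`.
        -- Removing that copy from `π` gives `π′`, to which the induction applies, and
        -- `symmetries π` is `symmetries π′` times the multiplicity of `ucv c` in `π`.
        present : ∀ c → ucv c ∈ π → Step c
        present c ∈π with xs , ys , eq ← ∈-∃++ ∈π = begin
          count c * symmetries π
            ≡⟨ cong₂ _*_
                 (∑-cong (tuples columns n) λ N →
                   ⟦⟧-⇔ (_ ↭? π) (_ ↭? π′)
                     (λ q → drop-∷ (↭-trans q s)) (λ q → ↭-trans (prep _ q) (↭-sym s)))
                 (symmetries-↭ s) ⟩
          count′ * (suc (multiplicity (ucv c) π′) * symmetries π′)
            ≡⟨ x∙yz≈y∙xz count′ (suc (multiplicity (ucv c) π′)) (symmetries π′) ⟩
          suc (multiplicity (ucv c) π′) * (count′ * symmetries π′)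
            ≡⟨ cong₂ _*_
                 (sym (trans (multiplicity-↭ (ucv c) s) (multiplicity-here (ucv c) π′)))
                 (count-rows M P π′ (drop-∷ (↭-trans (↭-sym (↭.map⁺ (select σ₁₃) s)) p))
                   (All.tail (All-resp-↭ s h))) ⟩
          multiplicity (ucv c) π * symmetries (join M P) ∎
          where
          π′ = xs ++ ys
          s : π ↭ ucv c ∷ π′
          s = subst (_↭ ucv c ∷ π′) (sym eq) (shift (ucv c) xs ys)
          count′ : ℕ
          count′ = ∑ (tuples columns n) (λ N → ⟦ join₃ M N P ↭? π′ ⟧)
        step : ∀ c → Dec (ucv c ∈ π) → Step c
        step c (yes ∈π) = present c ∈π
        step c (no ∉π)  = absent c ∉π

-- Natural numbers and quotients in ℚ

module _ where
  open import Data.Rational.Base using (_+_; _*_; _-_; -_; _/_)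
  open ≡ using (refl; sym; trans; cong; cong₂; subst; subst₂)
  open ≡.≡-Reasoning

  fromℕ : ℕ → ℚ
  fromℕ n = + n / 1

  -- A quotient `n / d` is by computation the image of an unnormalised fraction, so identities
  -- between quotients reduce to cross-multiplied identities in ℤ.
  fromℚᵘ-homo-* : ∀ p q → ℚ.fromℚᵘ (p ℚᵘ.* q) ≡ ℚ.fromℚᵘ p * ℚ.fromℚᵘ q
  fromℚᵘ-homo-* p q = ℚ.toℚᵘ-injective (ℚᵘ.≃-trans (ℚ.toℚᵘ-fromℚᵘ (p ℚᵘ.* q)) (ℚᵘ.≃-sym
    (ℚᵘ.≃-trans (ℚ.toℚᵘ-homo-* (ℚ.fromℚᵘ p) (ℚ.fromℚᵘ q))
      (ℚᵘ.*-cong (ℚ.toℚᵘ-fromℚᵘ p) (ℚ.toℚᵘ-fromℚᵘ q)))))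

  fromℚᵘ-homo-+ : ∀ p q → ℚ.fromℚᵘ (p ℚᵘ.+ q) ≡ ℚ.fromℚᵘ p + ℚ.fromℚᵘ q
  fromℚᵘ-homo-+ p q = ℚ.toℚᵘ-injective (ℚᵘ.≃-trans (ℚ.toℚᵘ-fromℚᵘ (p ℚᵘ.+ q)) (ℚᵘ.≃-sym
    (ℚᵘ.≃-trans (ℚ.toℚᵘ-homo-+ (ℚ.fromℚᵘ p) (ℚ.fromℚᵘ q))
      (ℚᵘ.+-cong (ℚ.toℚᵘ-fromℚᵘ p) (ℚ.toℚᵘ-fromℚᵘ q)))))

  fromℕ-* : ∀ m n → fromℕ (m ℕ.* n) ≡ fromℕ m * fromℕ n
  fromℕ-* m n = trans
    (ℚ.fromℚᵘ-cong {mkℚᵘ (+ (m ℕ.* n)) 0} {mkℚᵘ (+ m) 0 ℚᵘ.* mkℚᵘ (+ n) 0}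
      (*≡* (cong (ℤ._* (+ 1)) (ℤ.pos-* m n))))
    (fromℚᵘ-homo-* (mkℚᵘ (+ m) 0) (mkℚᵘ (+ n) 0))

  fromℕ-+ : ∀ m n → fromℕ (m ℕ.+ n) ≡ fromℕ m + fromℕ n
  fromℕ-+ m n = trans
    (ℚ.fromℚᵘ-cong {mkℚᵘ (+ (m ℕ.+ n)) 0} {mkℚᵘ (+ m) 0 ℚᵘ.+ mkℚᵘ (+ n) 0} (*≡* (cong (ℤ._* (+ 1))
      (trans (ℤ.pos-+ m n) (sym (cong₂ ℤ._+_ (ℤ.*-identityʳ (+ m)) (ℤ.*-identityʳ (+ n))))))))
    (fromℚᵘ-homo-+ (mkℚᵘ (+ m) 0) (mkℚᵘ (+ n) 0))

  m+n-m≡n : ∀ m n → fromℕ (m ℕ.+ n) - fromℕ m ≡ fromℕ n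
  m+n-m≡n m n = begin
    fromℕ (m ℕ.+ n) - fromℕ m
      ≡⟨ cong (_- fromℕ m) (trans (fromℕ-+ m n) (ℚ.+-comm (fromℕ m) (fromℕ n))) ⟩
    fromℕ n + fromℕ m - fromℕ m     ≡⟨ ℚ.+-assoc (fromℕ n) (fromℕ m) (- fromℕ m) ⟩
    fromℕ n + (fromℕ m - fromℕ m)   ≡⟨ cong (λ q → fromℕ n + q) (ℚ.+-inverseʳ (fromℕ m)) ⟩
    fromℕ n + 0ℚ                    ≡⟨ ℚ.+-identityʳ (fromℕ n) ⟩
    fromℕ n ∎

  /-*-cancel : ∀ n d .{{_ : ℕ.NonZero d}} → (+ n / d) * fromℕ d ≡ fromℕ n
  /-*-cancel n d@(suc d-1) = trans
    (sym (fromℚᵘ-homo-* (mkℚᵘ (+ n) d-1) (mkℚᵘ (+ d) 0)))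
    (ℚ.fromℚᵘ-cong {mkℚᵘ (+ n) d-1 ℚᵘ.* mkℚᵘ (+ d) 0} {mkℚᵘ (+ n) 0} (*≡* (begin
      + n ℤ.* + d ℤ.* + 1       ≡⟨ ℤ.*-identityʳ (+ n ℤ.* + d) ⟩
      + n ℤ.* + d               ≡⟨ cong (λ e → + n ℤ.* + e) (ℕ.*-identityʳ d) ⟨
      + n ℤ.* + (d ℕ.* 1)       ∎)))

  *-fromℕ-cancelʳ : ∀ {p q} d .{{_ : ℕ.NonZero d}} → p * fromℕ d ≡ q * fromℕ d → p ≡ q
  *-fromℕ-cancelʳ {p} {q} d e = trans (sym (undo p)) (trans (cong (_* (+ 1 / d)) e) (undo q))
    where
    undo : ∀ p → p * fromℕ d * (+ 1 / d) ≡ p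
    undo p = begin
      p * fromℕ d * (+ 1 / d)   ≡⟨ ℚ.*-assoc p (fromℕ d) (+ 1 / d) ⟩
      p * (fromℕ d * (+ 1 / d))
        ≡⟨ cong (λ u → p * u) (trans (ℚ.*-comm (fromℕ d) (+ 1 / d)) (/-*-cancel 1 d)) ⟩
      p * 1ℚ                    ≡⟨ ℚ.*-identityʳ p ⟩
      p ∎

  -- Padding with empty blocks and removing them

  module _ {m k : ℕ} where

    pad : List (Multiset m k) → ℕ → List (Multiset m k)
    pad π j = π ++ replicate j ∅

    -- Empty blocks are interchanged only among themselves, which contributes the factor `j !`.
    symmetries-pad : ∀ {π : List (Multiset m k)} → All NonEmpty π → ∀ j →
      symmetries (pad π j) ≡ symmetries π ℕ.* j !
    symmetries-pad [] j = trans (∅s j) (sym (ℕ.*-identityˡ (j !)))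
      where
      ∅s : ∀ j → symmetries (replicate j (∅ {m} {k})) ≡ j !
      ∅s zero    = refl
      ∅s (suc j) = cong₂ ℕ._*_
        (cong suc (trans (cong length (List.filter-all (∅ ≟ᴹ_) (All.replicate⁺ j refl)))
                         (List.length-replicate j)))
        (∅s j)
    symmetries-pad {T ∷ π} (T≢∅ ∷ h) j = trans
      (cong₂ ℕ._*_ (cong suc multiplicity-pad) (symmetries-pad h j))
      (sym (ℕ.*-assoc (suc (multiplicity T π)) (symmetries π) (j !)))
      where
      multiplicity-pad : multiplicity T (pad π j) ≡ multiplicity T π
      multiplicity-pad = cong length (begin
        filter (T ≟ᴹ_) (pad π j) ≡⟨ List.filter-++ (T ≟ᴹ_) π (replicate j ∅) ⟩
        filter (T ≟ᴹ_) π ++ filter (T ≟ᴹ_) (replicate j ∅)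
          ≡⟨ cong (filter (T ≟ᴹ_) π ++_) (List.filter-none (T ≟ᴹ_) (All.replicate⁺ j T≢∅)) ⟩
        filter (T ≟ᴹ_) π ++ []   ≡⟨ List.++-identityʳ _ ⟩
        filter (T ≟ᴹ_) π         ∎)

    strip : List (Multiset m k) → List (Multiset m k)
    strip = filter nonEmpty?

    strip-pad : ∀ {π : List (Multiset m k)} → All NonEmpty π → ∀ j → strip (pad π j) ≡ π
    strip-pad {π} h j = begin
      strip (pad π j)                ≡⟨ List.filter-++ nonEmpty? π (replicate j ∅) ⟩
      strip π ++ strip (replicate j ∅)
        ≡⟨ cong₂ _++_ (List.filter-all nonEmpty? h)
             (List.filter-none nonEmpty? (All.replicate⁺ j λ ¬e → ¬e refl)) ⟩
      π ++ []                        ≡⟨ List.++-identityʳ π ⟩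
      π                              ∎

    ↭-pad-strip : ∀ (π : List (Multiset m k)) → π ↭ pad (strip π) (length π ∸ length (strip π))
    ↭-pad-strip [] = ↭-refl
    ↭-pad-strip (T ∷ π) with T ≟ᴹ ∅
    ... | no _     = prep T (↭-pad-strip π)
    ... | yes refl
      rewrite ℕ.+-∸-assoc 1 (List.length-filter nonEmpty? π) =
      ↭-trans (prep ∅ (↭-pad-strip π)) (↭-sym (shift ∅ (strip π) _))

    -- What `strip` removes are copies of `∅`, and the lengths determine how many.
    strip-injective : ∀ (π γ : List (Multiset m k)) → length π ≡ length γ → strip π ↭ strip γ → π ↭ γ
    strip-injective π γ e p = ↭-trans (↭-pad-strip π) (↭-trans
      (↭.++⁺ p (↭-reflexive (cong (λ j → replicate j ∅) (cong₂ _∸_ e (↭-length p)))))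
      (↭-sym (↭-pad-strip γ)))

    length-preimage : ∀ {A : Set} (f : A → Multiset m k) S xs →
      length (filter (λ x → f x ≟ᴹ S) xs) ≡ multiplicity S (map f xs)
    length-preimage f S []       = refl
    length-preimage f S (x ∷ xs) with f x ≟ᴹ S
    ... | yes refl = trans (cong suc (length-preimage f S xs)) (sym (multiplicity-here S (map f xs)))
    ... | no fx≢S  = trans (length-preimage f S xs) (sym (multiplicity-there (map f xs) (fx≢S ∘ sym)))

    length-strip-map : ∀ {A : Set} (f : A → Multiset m k) xs →
      length xs ≡ length (strip (map f xs)) ℕ.+ length (filter (λ x → f x ≟ᴹ ∅) xs)
    length-strip-map f [] = refl
    length-strip-map f (x ∷ xs) with f x ≟ᴹ ∅
    ... | yes _ = trans (cong suc (length-strip-map f xs)) (sym (ℕ.+-suc _ _))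
    ... | no _  = cong suc (length-strip-map f xs)

  -- Clearing the denominators of a_ν and b_ν

  module _ {r k : ℕ} (ν : Γ r k) where

    outer : List (Multiset 2 k)
    outer = restrict σ₁₃ (blocks ν)

    length-fibre : ∀ {S} → S ≢ ∅ → length (fibre ν S) ≡ multiplicity S outer
    length-fibre {S} S≢∅ = trans (length-preimage (select σ₁₃) S (blocks ν))
      (sym (multiplicity-filter nonEmpty? (map (select σ₁₃) (blocks ν)) S≢∅))

    length-split : length (blocks ν) ≡ length outer ℕ.+ length (β ν)
    length-split = length-strip-map (select σ₁₃) (blocks ν)

    outerBlocks : List (Multiset 2 k)
    outerBlocks = deduplicate _≟ᴹ_ outer

    outerBlocks-nonEmpty : All NonEmpty outerBlocks
    outerBlocks-nonEmpty = All.tabulate λ S∈ →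
      All.lookup (nonEmpty (ν ↾ σ₁₃)) (∈-deduplicate⁻ _≟ᴹ_ outer S∈)

    -- `symmetries-fibres` for the restriction `select σ₁₃`: the fibre over `∅` is `β`, the others
    -- are the ν_S.
    symmetries-split : symmetries (β ν) ℕ.* product (map (symmetries ∘ fibre ν) outerBlocks)
      ≡ symmetries (blocks ν)
    symmetries-split = symmetries-fibres _≟ᴹ_ (select σ₁₃)
      (All.map (λ S≢∅ e → S≢∅ (sym e)) outerBlocks-nonEmpty ∷ DecUnique.deduplicate-! _≟ᴹ_ outer)
      (blocks ν) (All.tabulate covered)
      where
      covered : ∀ {T} → T ∈ blocks ν → select σ₁₃ T ∈ ∅ ∷ outerBlocks
      covered {T} T∈ with select σ₁₃ T ≟ᴹ ∅
      ... | yes e = here e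
      ... | no ne = there (∈-deduplicate⁺ _≟ᴹ_ (∈-filter⁺ nonEmpty? (∈-map⁺ (select σ₁₃) T∈) ne))

    /m!-cancel : ∀ {m} n (π : List (Multiset m k)) → (n /m! π) * fromℕ (symmetries π) ≡ fromℕ n
    /m!-cancel n π = trans (cong (λ d → (n /m! π) * fromℕ d) (sym (multiplicities!≡symmetries π)))
      (/-*-cancel n (multiplicities! π) {{multiplicities!≢0 π}})

    -- The length of ν_S is the multiplicity of S in `outer`, so the numerators of a_ν multiply to
    -- m(ν|₁₃)!, while the second factor on the left clears the denominators.
    a-cancel : a ν * fromℕ (product (map (symmetries ∘ fibre ν) outerBlocks)) ≡ fromℕ (symmetries outer)
    a-cancel = trans (go outerBlocks) (cong fromℕ (begin
      product (map (λ S → length (fibre ν S) !) outerBlocks)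
        ≡⟨ cong product (List.map-cong-local
             (All.map (λ S≢∅ → cong _! (length-fibre S≢∅)) outerBlocks-nonEmpty)) ⟩
      multiplicities! outer ≡⟨ multiplicities!≡symmetries outer ⟩
      symmetries outer      ∎))
      where
      open CommutativeSemigroupProperties
        (CommutativeMonoid.commutativeSemigroup ℚ.*-1-commutativeMonoid) using (interchange)
      go : ∀ L → foldr _*_ 1ℚ (map (λ S → length (fibre ν S) ! /m! fibre ν S) L)
        * fromℕ (product (map (symmetries ∘ fibre ν) L))
        ≡ fromℕ (product (map (λ S → length (fibre ν S) !) L))
      go []      = refl
      go (S ∷ L) = begin
        (q * u) * fromℕ (n ℕ.* v)       ≡⟨ cong (λ e → (q * u) * e) (fromℕ-* n v) ⟩
        (q * u) * (fromℕ n * fromℕ v)   ≡⟨ interchange q u (fromℕ n) (fromℕ v) ⟩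
        (q * fromℕ n) * (u * fromℕ v)   ≡⟨ cong₂ _*_ (/m!-cancel (l !) (fibre ν S)) (go L) ⟩
        fromℕ (l !) * fromℕ w           ≡⟨ fromℕ-* (l !) w ⟨
        fromℕ (l ! ℕ.* w)               ∎
        where
        l = length (fibre ν S)
        q = l ! /m! fibre ν S
        n = symmetries (fibre ν S)
        u = foldr _*_ 1ℚ (map (λ S → length (fibre ν S) ! /m! fibre ν S) L)
        v = product (map (symmetries ∘ fibre ν) L)
        w = product (map (λ S → length (fibre ν S) !) L)

  module _ {k : ℕ} where

    length-join : ∀ {n} (M P : Vec (Vec ℕ k) n) → length (join M P) ≡ n
    length-join []      []      = refl
    length-join (u ∷ M) (v ∷ P) = cong suc (length-join M P)

    length-join₃ : ∀ {n} (M N P : Vec (Vec ℕ k) n) → length (join₃ M N P) ≡ n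
    length-join₃ []      []      []      = refl
    length-join₃ (u ∷ M) (c ∷ N) (v ∷ P) = cong suc (length-join₃ M N P)

  ℚ-semiring : CommutativeSemiring _ _
  ℚ-semiring = CommutativeRing.commutativeSemiring ℚ.+-*-commutativeRing

  -- The value a_ν b_ν(n) as a number of rows

  module Natural (n r k : ℕ) where
    open MultisetPartitionAlgebra ℚ.+-*-commutativeRing id (fromℕ n) r k using (falling)
    open StructureSums ℚ.+-*-commutativeRing id (fromℕ n) r k using (weight)

    falling-! : ∀ s j → falling (fromℕ (s ℕ.+ j)) s * fromℕ (j !) ≡ fromℕ ((s ℕ.+ j) !)
    falling-! zero    j = ℚ.*-identityˡ (fromℕ (j !))
    falling-! (suc s) j = begin
      fromℕ u * falling (fromℕ u - 1ℚ) s * fromℕ (j !)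
        ≡⟨ cong (λ t → fromℕ u * falling t s * fromℕ (j !)) (m+n-m≡n 1 (s ℕ.+ j)) ⟩
      fromℕ u * falling (fromℕ (s ℕ.+ j)) s * fromℕ (j !)
        ≡⟨ ℚ.*-assoc (fromℕ u) (falling (fromℕ (s ℕ.+ j)) s) (fromℕ (j !)) ⟩
      fromℕ u * (falling (fromℕ (s ℕ.+ j)) s * fromℕ (j !))
        ≡⟨ cong (λ t → fromℕ u * t) (falling-! s j) ⟩
      fromℕ u * fromℕ ((s ℕ.+ j) !) ≡⟨ fromℕ-* u ((s ℕ.+ j) !) ⟨
      fromℕ (u !) ∎
      where u = suc s ℕ.+ j

    -- More than `j` factors descending from `j` pass through 0.
    falling-vanishes : ∀ j i → falling (fromℕ j) (suc (j ℕ.+ i)) ≡ 0ℚ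
    falling-vanishes zero    i = ℚ.*-zeroˡ (falling (0ℚ - 1ℚ) i)
    falling-vanishes (suc j) i = begin
      fromℕ (suc j) * falling (fromℕ (suc j) - 1ℚ) (suc (j ℕ.+ i))
        ≡⟨ cong (λ t → fromℕ (suc j) * falling t (suc (j ℕ.+ i))) (m+n-m≡n 1 j) ⟩
      fromℕ (suc j) * falling (fromℕ j) (suc (j ℕ.+ i))
        ≡⟨ cong (λ t → fromℕ (suc j) * t) (falling-vanishes j i) ⟩
      fromℕ (suc j) * 0ℚ ≡⟨ ℚ.*-zeroʳ (fromℕ (suc j)) ⟩
      0ℚ ∎

    module _ (ν : Γ r k) where
      private
        s = length (β ν)
        β! = 1 /m! β ν

      weight-vanishes : ∀ j i → n ≡ length (outer ν) ℕ.+ j → s ≡ suc (j ℕ.+ i) → weight ν ≡ 0ℚ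
      weight-vanishes j i e f = begin
        a ν * (falling (fromℕ n - fromℕ (length (outer ν))) s * β!)
          ≡⟨ cong₂ (λ t s → a ν * (falling t s * β!))
               (trans (cong (λ n → fromℕ n - fromℕ (length (outer ν))) e)
                      (m+n-m≡n (length (outer ν)) j)) f ⟩
        a ν * (falling (fromℕ j) (suc (j ℕ.+ i)) * β!)
          ≡⟨ cong (λ t → a ν * (t * β!)) (falling-vanishes j i) ⟩
        a ν * (0ℚ * β!) ≡⟨ cong (λ t → a ν * t) (ℚ.*-zeroˡ β!) ⟩
        a ν * 0ℚ        ≡⟨ ℚ.*-zeroʳ (a ν) ⟩
        0ℚ              ∎

      -- The quotient of stabiliser orders. Over the `s + j` zero columns of the padded `outer` lie
      -- the `s` blocks of `β` and `j` zero columns; the falling factorial turns `j !` into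
      -- `(s + j) !`, while `a ν` and `β!` clear the orders belonging to the ν_S and to `β`.
      weight-pad : ∀ j → n ≡ length (outer ν) ℕ.+ (s ℕ.+ j) →
        weight ν * fromℕ (symmetries (pad (blocks ν) j)) ≡ fromℕ (symmetries (pad (outer ν) (s ℕ.+ j)))
      weight-pad j e = begin
        a ν * (F * β!) * fromℕ (symmetries (pad (blocks ν) j))
          ≡⟨ cong (λ t → a ν * (F * β!) * t) (trans
               (cong fromℕ (trans (symmetries-pad (nonEmpty ν) j)
                                  (cong (ℕ._* j !) (sym (symmetries-split ν)))))
               (trans (fromℕ-* (sβ ℕ.* A) (j !)) (cong (_* Q) (fromℕ-* sβ A)))) ⟩
        a ν * (F * β!) * (fromℕ sβ * fromℕ A * Q)
          ≡⟨ weight-interchange ℚ-semiring (a ν) F β! (fromℕ sβ) (fromℕ A) Q ⟩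
        a ν * fromℕ A * (F * Q) * (β! * fromℕ sβ)
          ≡⟨ cong₂ _*_ (cong₂ _*_ (a-cancel ν) F-cancel) (/m!-cancel ν 1 (β ν)) ⟩
        fromℕ (symmetries (outer ν)) * fromℕ ((s ℕ.+ j) !) * 1ℚ
          ≡⟨ ℚ.*-identityʳ _ ⟩
        fromℕ (symmetries (outer ν)) * fromℕ ((s ℕ.+ j) !)
          ≡⟨ fromℕ-* (symmetries (outer ν)) ((s ℕ.+ j) !) ⟨
        fromℕ (symmetries (outer ν) ℕ.* (s ℕ.+ j) !)
          ≡⟨ cong fromℕ (symmetries-pad (nonEmpty (ν ↾ σ₁₃)) (s ℕ.+ j)) ⟨
        fromℕ (symmetries (pad (outer ν) (s ℕ.+ j))) ∎
        where
        F = falling (fromℕ n - fromℕ (length (outer ν))) s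
        Q = fromℕ (j !)
        sβ = symmetries (β ν)
        A = product (map (symmetries ∘ fibre ν) (outerBlocks ν))
        F-cancel : F * Q ≡ fromℕ ((s ℕ.+ j) !)
        F-cancel = trans
          (cong (λ t → falling t s * Q)
            (trans (cong (λ n → fromℕ n - fromℕ (length (outer ν))) e)
                   (m+n-m≡n (length (outer ν)) (s ℕ.+ j))))
          (falling-! s j)

      module _ {columns : List (Vec ℕ k)} (unique : Unique columns)
          (empty∈ : Vec.replicate k 0 ∈ columns)
          (middle∈ : All (λ T → Vec.lookup T 1F ∈ columns) (blocks ν)) where
        open Summation ℕ.+-*-commutativeSemiring

        Counts : (M P : Vec (Vec ℕ k) n) → Set
        Counts M P =
          weight ν ≡ fromℕ (∑ (tuples columns n) λ N → ⟦ strip (join₃ M N P) ↭? blocks ν ⟧)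

        -- With `ν` padded to `n` columns, `weight-pad` and `count-rows` describe the same quotient;
        -- the nonzero order `symmetries V` is cancelled.
        weight≡count-≤ : ∀ M P → strip (join M P) ↭ outer ν → length (blocks ν) ℕ.≤ n → Counts M P
        weight≡count-≤ M P p ℓν≤n = *-fromℕ-cancelʳ {weight ν}
          {fromℕ (∑ (tuples columns n) λ N → ⟦ strip (join₃ M N P) ↭? blocks ν ⟧)}
          (symmetries V) {{V≢0}} (begin
          weight ν * fromℕ (symmetries V)
            ≡⟨ weight-pad j n≡ ⟩
          fromℕ (symmetries (pad (outer ν) (s ℕ.+ j)))
            ≡⟨ cong fromℕ (symmetries-↭ (strip-injective (pad (outer ν) (s ℕ.+ j)) (join M P)
                 (trans |outer|≡n (sym (length-join M P)))
                 (↭-trans (↭-reflexive (strip-pad (nonEmpty (ν ↾ σ₁₃)) (s ℕ.+ j))) (↭-sym p)))) ⟩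
          fromℕ (symmetries (join M P))
            ≡⟨ cong fromℕ (count-rows unique M P V shape columns∈) ⟨
          fromℕ (∑ (tuples columns n) (λ N → ⟦ join₃ M N P ↭? V ⟧) ℕ.* symmetries V)
            ≡⟨ fromℕ-* (∑ (tuples columns n) (λ N → ⟦ join₃ M N P ↭? V ⟧)) (symmetries V) ⟩
          fromℕ (∑ (tuples columns n) (λ N → ⟦ join₃ M N P ↭? V ⟧)) * fromℕ (symmetries V)
            -- Both lists have `n` entries, so comparing them is the same as comparing their
            -- nonempty blocks.
            ≡⟨ cong (λ t → fromℕ t * fromℕ (symmetries V)) (∑-cong (tuples columns n) λ N →
                 ⟦⟧-⇔ (_ ↭? V) (_ ↭? blocks ν)
                   (λ q → ↭-trans (filter-↭ nonEmpty? q) (↭-reflexive stripV))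
                   (λ q → strip-injective (join₃ M N P) V (trans (length-join₃ M N P) (sym |V|≡n))
                     (↭-trans q (↭-reflexive (sym stripV))))) ⟩
          fromℕ (∑ (tuples columns n) (λ N → ⟦ strip (join₃ M N P) ↭? blocks ν ⟧))
            * fromℕ (symmetries V) ∎)
          where
          j = n ∸ length (blocks ν)
          V = pad (blocks ν) j
          V≢0 : ℕ.NonZero (symmetries V)
          V≢0 = subst ℕ.NonZero (multiplicities!≡symmetries V) (multiplicities!≢0 V)
          stripV : strip V ≡ blocks ν
          stripV = strip-pad (nonEmpty ν) j
          n≡ : n ≡ length (outer ν) ℕ.+ (s ℕ.+ j)
          n≡ = begin
            n                               ≡⟨ ℕ.m+[n∸m]≡n ℓν≤n ⟨
            length (blocks ν) ℕ.+ j         ≡⟨ cong (ℕ._+ j) (length-split ν) ⟩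
            length (outer ν) ℕ.+ s ℕ.+ j    ≡⟨ ℕ.+-assoc (length (outer ν)) s j ⟩
            length (outer ν) ℕ.+ (s ℕ.+ j)      ∎
          length-pad : ∀ {m} (π : List (Multiset m k)) i → length (pad π i) ≡ length π ℕ.+ i
          length-pad π i = trans (List.length-++ π) (cong (length π ℕ.+_) (List.length-replicate i))
          |outer|≡n : length (pad (outer ν) (s ℕ.+ j)) ≡ n
          |outer|≡n = trans (length-pad (outer ν) (s ℕ.+ j)) (sym n≡)
          |V|≡n : length V ≡ n
          |V|≡n = trans (length-pad (blocks ν) j) (ℕ.m+[n∸m]≡n ℓν≤n)
          columns∈ : All (λ T → Vec.lookup T 1F ∈ columns) V
          columns∈ = All.++⁺ middle∈ (All.replicate⁺ j empty∈)
          shape : map (select σ₁₃) V ↭ join M P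
          shape = strip-injective (map (select σ₁₃) V) (join M P)
            (trans (List.length-map (select σ₁₃) V) (trans |V|≡n (sym (length-join M P))))
            (↭-trans (↭-reflexive (begin
              strip (map (select σ₁₃) V)
                ≡⟨ cong strip (List.map-++ (select σ₁₃) (blocks ν) (replicate j ∅)) ⟩
              strip (map (select σ₁₃) (blocks ν) ++ map (select σ₁₃) (replicate j ∅))
                ≡⟨ cong (λ u → strip (map (select σ₁₃) (blocks ν) ++ u))
                     (List.map-replicate (select σ₁₃) j ∅) ⟩
              strip (pad (map (select σ₁₃) (blocks ν)) j)
                ≡⟨ List.filter-++ nonEmpty? (map (select σ₁₃) (blocks ν)) (replicate j ∅) ⟩
              outer ν ++ strip (replicate j ∅)
                ≡⟨ cong (outer ν ++_) (List.filter-none nonEmpty? (All.replicate⁺ j λ ¬e → ¬e refl)) ⟩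
              outer ν ++ []  ≡⟨ List.++-identityʳ (outer ν) ⟩
              outer ν        ∎)) (↭-sym p))

        -- An array with `n` columns is too short to form `ν`, so the count is 0. The array `(M, P)`
        -- gives ℓ(`outer ν`) ≤ n, hence n - ℓ(`outer ν`) is a natural number below `s` and the
        -- falling factorial is 0; from a negative start it would not vanish.
        weight≡count-> : ∀ M P → strip (join M P) ↭ outer ν → n ℕ.< length (blocks ν) → Counts M P
        weight≡count-> M P p n<ℓν = trans
          (weight-vanishes (n ∸ length (outer ν)) (s ∸ suc (n ∸ length (outer ν)))
            (sym (ℕ.m+[n∸m]≡n outer≤n)) (sym (ℕ.m+[n∸m]≡n short)))
          (cong fromℕ (sym (∑-zero (tuples columns n) (All.universal
            (λ N → ⟦⟧-no (_ ↭? blocks ν) λ q → ℕ.<⇒≱ n<ℓν (too-long N q)) _))))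
          where
          too-long : ∀ N → strip (join₃ M N P) ↭ blocks ν → length (blocks ν) ℕ.≤ n
          too-long N q = subst₂ ℕ._≤_ (↭-length q) (length-join₃ M N P)
            (List.length-filter nonEmpty? (join₃ M N P))
          outer≤n : length (outer ν) ℕ.≤ n
          outer≤n = subst₂ ℕ._≤_ (↭-length p) (length-join M P) (List.length-filter nonEmpty? (join M P))
          short : n ∸ length (outer ν) ℕ.< s
          short = ℕ.+-cancelˡ-< (length (outer ν)) _ _
            (subst₂ ℕ._<_ (sym (ℕ.m+[n∸m]≡n outer≤n)) (length-split ν) n<ℓν)

        weight≡count : ∀ M P → strip (join M P) ↭ outer ν → Counts M P
        weight≡count M P p =
          [ weight≡count-≤ M P p , weight≡count-> M P p ]′ (ℕ.≤-<-connex (length (blocks ν)) n)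

  -- Restrictions and row totals of arrays

  module _ {k : ℕ} where

    select-∅ : ∀ {m n} (σ : Vec (Fin m) n) → select σ (∅ {m} {k}) ≡ ∅
    select-∅ []      = refl
    select-∅ (i ∷ σ) = cong₂ _∷_ (Vec.lookup-replicate i _) (select-∅ σ)

    restrict-strip : ∀ {m n} (σ : Vec (Fin m) n) (π : List (Multiset m k)) →
      restrict σ (strip π) ≡ restrict σ π
    restrict-strip σ []      = refl
    restrict-strip σ (T ∷ π) with T ≟ᴹ ∅
    ... | yes refl = trans (restrict-strip σ π)
      (sym (List.filter-reject nonEmpty? (λ ne → ne (select-∅ σ))))
    ... | no _ = begin
      strip (map (select σ) (T ∷ strip π))     ≡⟨ List.filter-++ nonEmpty? (select σ T ∷ []) _ ⟩
      strip (select σ T ∷ []) ++ restrict σ (strip π)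
        ≡⟨ cong (strip (select σ T ∷ []) ++_) (restrict-strip σ π) ⟩
      strip (select σ T ∷ []) ++ restrict σ π
        ≡⟨ List.filter-++ nonEmpty? (select σ T ∷ []) (map (select σ) π) ⟨
      strip (map (select σ) (T ∷ π))           ∎

    sum-replicate-0 : ∀ k → Vec.sum (Vec.replicate k 0) ≡ 0
    sum-replicate-0 zero    = refl
    sum-replicate-0 (suc k) = sum-replicate-0 k

    elements-strip : ∀ {m} i (π : List (Multiset m k)) → elements i (strip π) ≡ elements i π
    elements-strip i []      = refl
    elements-strip i (T ∷ π) with T ≟ᴹ ∅
    ... | yes refl = cong₂ ℕ._+_
      (sym (trans (cong Vec.sum (Vec.lookup-replicate i _)) (sum-replicate-0 k)))
      (elements-strip i π)
    ... | no _     = cong (_ ℕ.+_) (elements-strip i π)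

    elements-↭ : ∀ {m} i {π γ : List (Multiset m k)} → π ↭ γ → elements i π ≡ elements i γ
    elements-↭ i p = sum-↭ (↭.map⁺ _ p)

    map-σ₁₂ : ∀ {n} (M N P : Vec (Vec ℕ k) n) → map (select σ₁₂) (join₃ M N P) ≡ join M N
    map-σ₁₂ []      []      []      = refl
    map-σ₁₂ (u ∷ M) (c ∷ N) (v ∷ P) = cong (_ ∷_) (map-σ₁₂ M N P)

    map-σ₂₃ : ∀ {n} (M N P : Vec (Vec ℕ k) n) → map (select σ₂₃) (join₃ M N P) ≡ join N P
    map-σ₂₃ []      []      []      = refl
    map-σ₂₃ (u ∷ M) (c ∷ N) (v ∷ P) = cong (_ ∷_) (map-σ₂₃ M N P)

    map-σ₁₃ : ∀ {n} (M N P : Vec (Vec ℕ k) n) → map (select σ₁₃) (join₃ M N P) ≡ join M P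
    map-σ₁₃ []      []      []      = refl
    map-σ₁₃ (u ∷ M) (c ∷ N) (v ∷ P) = cong (_ ∷_) (map-σ₁₃ M N P)

    unjoin : ∀ n (π : List (Multiset 2 k)) → length π ≡ n →
      ∃₂ λ (M P : Vec (Vec ℕ k) n) → join M P ≡ π
    unjoin zero    []                    refl = [] , [] , refl
    unjoin (suc n) ((u ∷ v ∷ []) ∷ π) e =
      let M , P , f = unjoin n π (ℕ.suc-injective e) in u ∷ M , v ∷ P , cong (_ ∷_) f

    elements-join₁ : ∀ {n} (M N P : Vec (Vec ℕ k) n) →
      elements 0F (join₃ M N P) ≡ elements 0F (join M N)
    elements-join₁ []      []      []      = refl
    elements-join₁ (u ∷ M) (c ∷ N) (v ∷ P) = cong (_ ℕ.+_) (elements-join₁ M N P)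

    elements-join₂ : ∀ {n} (M N P : Vec (Vec ℕ k) n) →
      elements 1F (join₃ M N P) ≡ elements 1F (join M N)
    elements-join₂ []      []      []      = refl
    elements-join₂ (u ∷ M) (c ∷ N) (v ∷ P) = cong (_ ℕ.+_) (elements-join₂ M N P)

    elements-join₃ : ∀ {n} (M N P : Vec (Vec ℕ k) n) →
      elements 2F (join₃ M N P) ≡ elements 1F (join N P)
    elements-join₃ []      []      []      = refl
    elements-join₃ (u ∷ M) (c ∷ N) (v ∷ P) = cong (_ ℕ.+_) (elements-join₃ M N P)

  module Columns (r k : ℕ) where

    _≟ᶜ_ : DecidableEquality (Vec ℕ k)
    _≟ᶜ_ = Vec.≡-dec ℕ._≟_

    middles : Γ r k → List (Vec ℕ k)
    middles ν = map (λ T → Vec.lookup T 1F) (blocks ν)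

    -- All entries that a middle row can have in an element of Γ; the zero column is used
    -- where the array has more columns than there are blocks.
    columns : List (Vec ℕ k)
    columns = deduplicate _≟ᶜ_ (Vec.replicate k 0 ∷ concatMap middles (allPartitions 3 r k))

    columns-unique : Unique columns
    columns-unique = DecUnique.deduplicate-! _≟ᶜ_
      (Vec.replicate k 0 ∷ concatMap middles (allPartitions 3 r k))

    empty∈columns : Vec.replicate k 0 ∈ columns
    empty∈columns = here refl

    -- The list `allPartitions` contains `ν` only up to permutation, which preserves membership of
    -- blocks.
    middle∈columns : ∀ (ν : Γ r k) → All (λ T → Vec.lookup T 1F ∈ columns) (blocks ν)
    middle∈columns ν = All.tabulate λ T∈ → ∈-deduplicate⁺ _≟ᶜ_ (there
      (∈-concatMap⁺ middles
        (Any.map (λ p → ∈-map⁺ _ (∈-resp-↭ p T∈)) (allPartitions-complete 3 r k ν))))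

  -- Associativity at x = n

  module AtNatural (n r k : ℕ) where
    open Columns r k
    open StructureSums ℚ.+-*-commutativeRing id (fromℕ n) r k
    open Summation ℚ-semiring
    open Natural n r k
    private module ∑ℕ = Summation ℕ.+-*-commutativeSemiring

    rows : List (Vec (Vec ℕ k) n)
    rows = tuples columns n

    fromℕ-∑ : ∀ {A : Set} (xs : List A) (f : A → ℕ) → fromℕ (∑ℕ.∑ xs f) ≡ ∑ xs (fromℕ ∘ f)
    fromℕ-∑ []       f = refl
    fromℕ-∑ (x ∷ xs) f =
      trans (fromℕ-+ (f x) (∑ℕ.∑ xs f)) (cong (λ q → fromℕ (f x) + q) (fromℕ-∑ xs f))

    fromℕ-⟦⟧ : ∀ {P : Set} (d : Dec P) → fromℕ ∑ℕ.⟦ d ⟧ ≡ ⟦ d ⟧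
    fromℕ-⟦⟧ (yes _) = refl
    fromℕ-⟦⟧ (no _)  = refl

    restrict-shape : ∀ {σ : Vec (Fin 3) 2} {Z : List (Multiset 3 k)} {W} {ν : Γ r k} →
      map (select σ) Z ≡ W → strip Z ↭ blocks ν → strip W ↭ blocks (ν ↾ σ)
    restrict-shape {σ} {Z} refl p = ↭-trans (↭-reflexive (sym (restrict-strip σ Z)))
      (filter-↭ nonEmpty? (↭.map⁺ (select σ) p))

    -- The bracket extends `weight≡count` to all `M` and `P`: a row completing `(M, P)` to `ν`
    -- forces the type of `(M, P)` to be `outer ν`, so otherwise both sides are 0.
    weight-counts : ∀ (ν : Γ r k) M P → Dec (strip (join M P) ↭ outer ν) →
      weight ν * ⟦ strip (join M P) ↭? outer ν ⟧ ≡ ∑ rows λ N → ⟦ strip (join₃ M N P) ↭? blocks ν ⟧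
    weight-counts ν M P (yes p) = begin
      weight ν * ⟦ strip (join M P) ↭? outer ν ⟧
        ≡⟨ cong (λ q → weight ν * q) (⟦⟧-yes (strip (join M P) ↭? outer ν) p) ⟩
      weight ν * 1ℚ ≡⟨ ℚ.*-identityʳ (weight ν) ⟩
      weight ν      ≡⟨ weight≡count ν columns-unique empty∈columns (middle∈columns ν) M P p ⟩
      fromℕ (∑ℕ.∑ rows λ N → ∑ℕ.⟦ strip (join₃ M N P) ↭? blocks ν ⟧)
        ≡⟨ fromℕ-∑ rows _ ⟩
      ∑ rows (λ N → fromℕ ∑ℕ.⟦ strip (join₃ M N P) ↭? blocks ν ⟧)
        ≡⟨ ∑-cong rows (λ N → fromℕ-⟦⟧ (strip (join₃ M N P) ↭? blocks ν)) ⟩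
      ∑ rows (λ N → ⟦ strip (join₃ M N P) ↭? blocks ν ⟧) ∎
    weight-counts ν M P (no ¬p) = begin
      weight ν * ⟦ strip (join M P) ↭? outer ν ⟧
        ≡⟨ cong (λ q → weight ν * q) (⟦⟧-no (strip (join M P) ↭? outer ν) ¬p) ⟩
      weight ν * 0ℚ ≡⟨ ℚ.*-zeroʳ (weight ν) ⟩
      0ℚ
        ≡⟨ ∑-zero rows (All.universal (λ N → ⟦⟧-no (strip (join₃ M N P) ↭? blocks ν)
             (λ q → ¬p (restrict-shape {σ₁₃} {ν = ν} (map-σ₁₃ M N P) q))) rows) ⟨
      ∑ rows (λ N → ⟦ strip (join₃ M N P) ↭? blocks ν ⟧) ∎

    Path : Vec (Vec ℕ k) n → Vec (Vec ℕ k) n → Vec (Vec ℕ k) n → Π r k → Π r k → Set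
    Path M N P π γ = strip (join M N) ↭ blocks π × strip (join N P) ↭ blocks γ

    path? : ∀ M N P π γ → Dec (Path M N P π γ)
    path? M N P π γ = (strip (join M N) ↭? blocks π) ×-dec (strip (join N P) ↭? blocks γ)

    -- The total of each row is `r` because it can be read off from `(M, N)` or `(N, P)`, whose
    -- types are balanced.
    triple : ∀ M N P {π γ} → Path M N P π γ → Γ r k
    triple M N P {π} {γ} (p , q) =
      multisetPartition (strip (join₃ M N P)) (All.all-filter nonEmpty? (join₃ M N P)) balance
      where
      via : ∀ i j (W : List (Multiset 2 k)) (π : Π r k) →
        elements i (join₃ M N P) ≡ elements j W → strip W ↭ blocks π →
        elements i (strip (join₃ M N P)) ≡ r
      via i j W π e p = begin
        elements i (strip (join₃ M N P)) ≡⟨ elements-strip i (join₃ M N P) ⟩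
        elements i (join₃ M N P)         ≡⟨ e ⟩
        elements j W                     ≡⟨ elements-strip j W ⟨
        elements j (strip W)             ≡⟨ elements-↭ j p ⟩
        elements j (blocks π)            ≡⟨ balanced π j ⟩
        r                                ∎
      balance : ∀ i → elements i (strip (join₃ M N P)) ≡ r
      balance 0F = via 0F 0F (join M N) π (elements-join₁ M N P) p
      balance 1F = via 1F 1F (join M N) π (elements-join₂ M N P) p
      balance 2F = via 2F 1F (join N P) γ (elements-join₃ M N P) q

    -- An array has only one type, and the restrictions of that type are the types of `(M, N)` and
    -- `(N, P)`. For a path the type lies in Γ by `triple`, so exactly one listed `ν` contributes.
    Γs-partition : ∀ M N P π γ → Dec (Path M N P π γ) →
      ∑ Γs (λ ν → lies-over π γ ν * ⟦ strip (join₃ M N P) ↭? blocks ν ⟧) ≡ ⟦ path? M N P π γ ⟧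
    Γs-partition M N P π γ (yes pq@(p , q)) = trans
      (∑-single Γs {λ ν → strip (join₃ M N P) ↭ blocks ν}
        (allPartitions-complete 3 r k (triple M N P {π} {γ} pq))
        (AllPairs.map (λ ¬p p q → ¬p (↭-trans (↭-sym p) q)) (allPartitions-unique 3 r k))
        (λ ν → strip (join₃ M N P) ↭? blocks ν)
        (λ ν s → cong₂ _*_
          (cong₂ _*_
            (⟦⟧-yes (ν ↾ σ₁₂ ≋? π) (↭-trans (↭-sym (restrict-shape {σ₁₂} {ν = ν} (map-σ₁₂ M N P) s)) p))
            (⟦⟧-yes (ν ↾ σ₂₃ ≋? γ) (↭-trans (↭-sym (restrict-shape {σ₂₃} {ν = ν} (map-σ₂₃ M N P) s)) q)))
          (⟦⟧-yes (strip (join₃ M N P) ↭? blocks ν) s))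
        (λ ν ¬s → trans (cong (λ q → lies-over π γ ν * q) (⟦⟧-no (strip (join₃ M N P) ↭? blocks ν) ¬s))
                        (ℚ.*-zeroʳ (lies-over π γ ν))))
      (sym (⟦⟧-yes (path? M N P π γ) pq))
    Γs-partition M N P π γ (no ¬pq) = trans
      (∑-zero Γs (All.universal (λ ν → trans
        (cong (λ q → q * ⟦ strip (join₃ M N P) ↭? blocks ν ⟧)
          (sym (⟦⟧-× (ν ↾ σ₁₂ ≋? π) (ν ↾ σ₂₃ ≋? γ))))
        (trans (sym (⟦⟧-× (over? ν) (strip (join₃ M N P) ↭? blocks ν)))
          (⟦⟧-no (over? ν ×-dec (strip (join₃ M N P) ↭? blocks ν)) λ ((p , q) , s) →
            ¬pq ( ↭-trans (restrict-shape {σ₁₂} {ν = ν} (map-σ₁₂ M N P) s) p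
                , ↭-trans (restrict-shape {σ₂₃} {ν = ν} (map-σ₂₃ M N P) s) q )))) Γs))
      (sym (⟦⟧-no (path? M N P π γ) ¬pq))
      where
      over? : ∀ ν → Dec (ν ↾ σ₁₂ ≋ π × ν ↾ σ₂₃ ≋ γ)
      over? ν = (ν ↾ σ₁₂ ≋? π) ×-dec (ν ↾ σ₂₃ ≋? γ)

    -- Stated for arbitrary outer rows, without fixing the type of `(M, P)`: `sums-agree` applies it
    -- to `(M, Q)` and `(N, P)` with `Q` and `N` running over all rows.
    paths : ∀ M P π γ →
      ∑ Γs (λ ν → lies-over π γ ν * (weight ν * ⟦ strip (join M P) ↭? outer ν ⟧))
        ≡ ∑ rows λ N → ⟦ strip (join M N) ↭? blocks π ⟧ * ⟦ strip (join N P) ↭? blocks γ ⟧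
    paths M P π γ = begin
      ∑ Γs (λ ν → lies-over π γ ν * (weight ν * ⟦ strip (join M P) ↭? outer ν ⟧))
        ≡⟨ ∑-cong Γs (λ ν → trans
             (cong (λ q → lies-over π γ ν * q) (weight-counts ν M P (strip (join M P) ↭? outer ν)))
             (sym (∑-*ˡ rows (lies-over π γ ν) _))) ⟩
      ∑ Γs (λ ν → ∑ rows λ N → lies-over π γ ν * ⟦ strip (join₃ M N P) ↭? blocks ν ⟧)
        ≡⟨ ∑-swap Γs rows _ ⟩
      ∑ rows (λ N → ∑ Γs λ ν → lies-over π γ ν * ⟦ strip (join₃ M N P) ↭? blocks ν ⟧)
        ≡⟨ ∑-cong rows (λ N → trans (Γs-partition M N P π γ (path? M N P π γ))
             (⟦⟧-× (strip (join M N) ↭? blocks π) (strip (join N P) ↭? blocks γ))) ⟩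
      ∑ rows (λ N → ⟦ strip (join M N) ↭? blocks π ⟧ * ⟦ strip (join N P) ↭? blocks γ ⟧) ∎

    module _ (π γ τ ρ : Π r k) (M P : Vec (Vec ℕ k) n) (type : strip (join M P) ↭ blocks ρ) where

      structureConstant-paths : ∀ π γ → structureConstant π γ ρ
        ≡ ∑ rows λ N → ⟦ strip (join M N) ↭? blocks π ⟧ * ⟦ strip (join N P) ↭? blocks γ ⟧
      structureConstant-paths π γ = trans
        (∑-cong Γs λ ν → cong (λ q → lies-over π γ ν * (weight ν * q))
          (⟦⟧-⇔ (ν ↾ σ₁₃ ≋? ρ) (strip (join M P) ↭? outer ν)
            (λ p → ↭-trans type (↭-sym p)) (λ p → ↭-trans (↭-sym p) type)))
        (paths M P π γ)

      sums-agree : leftSum π γ τ ρ ≡ rightSum π γ τ ρ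
      sums-agree = begin
        ∑ Γs (λ ν → lies-over π γ ν * (weight ν * structureConstant (ν ↾ σ₁₃) τ ρ))
          ≡⟨ ∑-cong Γs (λ ν → trans
               (cong (λ q → lies-over π γ ν * (weight ν * q)) (structureConstant-paths (ν ↾ σ₁₃) τ))
               (∑-pullˡ rows (lies-over π γ ν) (weight ν)
                 (λ Q → ⟦ strip (join M Q) ↭? outer ν ⟧) last)) ⟩
        ∑ Γs (λ ν → ∑ rows λ Q →
          lies-over π γ ν * (weight ν * ⟦ strip (join M Q) ↭? outer ν ⟧) * last Q)
          ≡⟨ ∑-swap Γs rows _ ⟩
        ∑ rows (λ Q → ∑ Γs λ ν →
          lies-over π γ ν * (weight ν * ⟦ strip (join M Q) ↭? outer ν ⟧) * last Q)
          -- For fixed `Q` the sum over `ν` counts the rows `N` between `M` and `Q`.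
          ≡⟨ ∑-cong rows (λ Q → trans (∑-*ʳ Γs _ (last Q))
               (trans (cong (λ q → q * last Q) (paths M Q π γ)) (sym (∑-*ʳ rows _ (last Q))))) ⟩
        ∑ rows (λ Q → ∑ rows λ N → first N * middle N Q * last Q)
          ≡⟨ ∑-swap rows rows _ ⟩
        ∑ rows (λ N → ∑ rows λ Q → first N * middle N Q * last Q)
          -- The pairs are now grouped by `N`, and `paths N P γ τ` is read backwards to recover a
          -- sum over Γ.
          ≡⟨ ∑-cong rows (λ N → trans
               (∑-cong rows λ Q → ℚ.*-assoc (first N) (middle N Q) (last Q))
               (trans (∑-*ˡ rows (first N) _) (cong (λ q → first N * q) (sym (paths N P γ τ))))) ⟩
        ∑ rows (λ N → first N *
          ∑ Γs λ ν → lies-over γ τ ν * (weight ν * ⟦ strip (join N P) ↭? outer ν ⟧))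
          ≡⟨ ∑-cong rows (λ N → sym (∑-*ˡ Γs (first N) _)) ⟩
        ∑ rows (λ N → ∑ Γs λ ν →
          first N * (lies-over γ τ ν * (weight ν * ⟦ strip (join N P) ↭? outer ν ⟧)))
          ≡⟨ ∑-swap rows Γs _ ⟩
        ∑ Γs (λ ν → ∑ rows λ N →
          first N * (lies-over γ τ ν * (weight ν * ⟦ strip (join N P) ↭? outer ν ⟧)))
          ≡⟨ ∑-cong Γs (λ ν → trans
               (cong (λ q → lies-over γ τ ν * (weight ν * q)) (structureConstant-paths π (ν ↾ σ₁₃)))
               (∑-pullʳ rows (lies-over γ τ ν) (weight ν) first
                 (λ N → ⟦ strip (join N P) ↭? outer ν ⟧))) ⟨
        ∑ Γs (λ ν → lies-over γ τ ν * (weight ν * structureConstant π (ν ↾ σ₁₃) ρ)) ∎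
        where
        first last : Vec (Vec ℕ k) n → ℚ
        first N = ⟦ strip (join M N) ↭? blocks π ⟧
        last Q  = ⟦ strip (join Q P) ↭? blocks τ ⟧
        middle : Vec (Vec ℕ k) n → Vec (Vec ℕ k) n → ℚ
        middle N Q = ⟦ strip (join N Q) ↭? blocks γ ⟧

    leftSum≡rightSum : ∀ π γ τ ρ → length (blocks ρ) ℕ.≤ n → leftSum π γ τ ρ ≡ rightSum π γ τ ρ
    leftSum≡rightSum π γ τ ρ ℓ≤n =
      -- Zero columns fill `ρ` up to `n` columns; the two rows of the result are `M` and `P`.
      let j = n ∸ length (blocks ρ)
          e = trans (List.length-++ (blocks ρ))
                (trans (cong (length (blocks ρ) ℕ.+_) (List.length-replicate j)) (ℕ.m+[n∸m]≡n ℓ≤n))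
          M , P , f = unjoin n (pad (blocks ρ) j) e
      in sums-agree π γ τ ρ M P
           (↭-reflexive (trans (cong strip f) (strip-pad (nonEmpty ρ) j)))

-- Polynomial identities in x

IsRingMap : ∀ {c ℓ : Level} (K : CommutativeRing c ℓ) → (ℚ → CommutativeRing.Carrier K) → Set ℓ
IsRingMap K = RingMorphisms.IsRingHomomorphism ℚ.+-*-rawRing (CommutativeRing.rawRing K)

-- Multiplication by x - q = (N - q) + (x - N) in Newton's form.
linear : ℕ → ℚ → List ℚ → List ℚ
linear N q []       = []
linear N q (c ∷ cs) = c ℚ.* (fromℕ N ℚ.- q) ∷ ((c ∷ []) +ᵖ linear (suc N) q cs)

module Newton {c ℓ : Level} (K : CommutativeRing c ℓ) (ι : ℚ → CommutativeRing.Carrier K)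
    (hom : IsRingMap K ι) (x : CommutativeRing.Carrier K) where
  open CommutativeRing K hiding (zero)
  open RingProperties ring
  open SetoidReasoning setoid
  open CommutativeSemigroupProperties +-commutativeSemigroup using (interchange)
  open CommutativeSemigroupProperties (CommutativeMonoid.commutativeSemigroup *-commutativeMonoid)
    using (x∙yz≈y∙xz)
  module ι = RingMorphisms.IsRingHomomorphism hom

  x-_ : ℚ → Carrier
  x- q = x - ι q

  -- Newton's form: the coefficients are those of 1, x - N, (x - N)(x - (N + 1)), …
  newton : ℕ → List ℚ → Carrier
  newton N []       = 0#
  newton N (c ∷ cs) = ι c + (x- fromℕ N) * newton (suc N) cs

  newton-+ : ∀ N cs ds → newton N (cs +ᵖ ds) ≈ newton N cs + newton N ds
  newton-+ N []       ds       = sym (+-identityˡ _)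
  newton-+ N (c ∷ cs) []       = sym (+-identityʳ _)
  newton-+ N (c ∷ cs) (d ∷ ds) = begin
    ι (c ℚ.+ d) + (x- fromℕ N) * newton (suc N) (cs +ᵖ ds)
      ≈⟨ +-cong (ι.+-homo c d) (trans (*-congˡ (newton-+ (suc N) cs ds)) (distribˡ _ _ _)) ⟩
    ι c + ι d + ((x- fromℕ N) * newton (suc N) cs + (x- fromℕ N) * newton (suc N) ds)
      ≈⟨ interchange _ _ _ _ ⟩
    newton N (c ∷ cs) + newton N (d ∷ ds) ∎

  newton-· : ∀ N q cs → newton N (q ·ᵖ cs) ≈ ι q * newton N cs
  newton-· N q []       = sym (zeroʳ (ι q))
  newton-· N q (c ∷ cs) = begin
    ι (q ℚ.* c) + (x- fromℕ N) * newton (suc N) (q ·ᵖ cs)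
      ≈⟨ +-cong (ι.*-homo q c) (trans (*-congˡ (newton-· (suc N) q cs)) (x∙yz≈y∙xz _ _ _)) ⟩
    ι q * ι c + ι q * ((x- fromℕ N) * newton (suc N) cs)
      ≈⟨ distribˡ _ _ _ ⟨
    ι q * newton N (c ∷ cs) ∎

  ι-difference : ∀ p q → ι (p ℚ.- q) ≈ ι p - ι q
  ι-difference p q = trans (ι.+-homo p (ℚ.- q)) (+-congˡ (ι.-‿homo q))

  newton-linear : ∀ N q cs → newton N (linear N q cs) ≈ (x- q) * newton N cs
  newton-linear N q []       = sym (zeroʳ _)
  newton-linear N q (c ∷ cs) = begin
    ι (c ℚ.* (fromℕ N ℚ.- q)) + (x- fromℕ N) * newton (suc N) ((c ∷ []) +ᵖ linear (suc N) q cs)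
      ≈⟨ +-cong (trans (ι.*-homo c _) (*-congˡ (ι-difference (fromℕ N) q)))
           (*-congˡ (trans (newton-+ (suc N) (c ∷ []) (linear (suc N) q cs))
             (+-cong (trans (+-congˡ (zeroʳ _)) (+-identityʳ (ι c))) (newton-linear (suc N) q cs)))) ⟩
    ι c * (ι (fromℕ N) - ι q) + (x- fromℕ N) * (ι c + (x- q) * R)
      ≈⟨ solve 5 (λ c d e f R → c :* d :+ e :* (c :+ f :* R) := (d :+ e) :* c :+ f :* (e :* R))
           refl (ι c) (ι (fromℕ N) - ι q) (x- fromℕ N) (x- q) R ⟩
    (ι (fromℕ N) - ι q + (x- fromℕ N)) * ι c + (x- q) * ((x- fromℕ N) * R)
      ≈⟨ +-congʳ (*-congʳ telescope) ⟩
    (x- q) * ι c + (x- q) * ((x- fromℕ N) * R)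
      ≈⟨ distribˡ _ _ _ ⟨
    (x- q) * newton N (c ∷ cs) ∎
    where
    open SemiringSolver commutativeSemiring using (solve; _:=_; _:+_; _:*_)
    R = newton (suc N) cs
    telescope : ι (fromℕ N) - ι q + (x- fromℕ N) ≈ x- q
    telescope = begin
      ι (fromℕ N) - ι q + (x - ι (fromℕ N))
        ≈⟨ solve 4 (λ n m x y → n :+ m :+ (x :+ y) := x :+ m :+ (n :+ y)) refl _ _ _ _ ⟩
      x - ι q + (ι (fromℕ N) - ι (fromℕ N)) ≈⟨ +-congˡ (-‿inverseʳ _) ⟩
      x - ι q + 0#                          ≈⟨ +-identityʳ _ ⟩
      x - ι q                               ∎

ℚ-id : IsRingMap ℚ.+-*-commutativeRing (λ q → q)
ℚ-id = Identity.isRingHomomorphism ℚ.+-*-rawRing ≡.refl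

module Newtonℚ (n : ℕ) = Newton ℚ.+-*-commutativeRing (λ q → q) ℚ-id (fromℕ n)

module Transfer {c ℓ : Level} (K : CommutativeRing c ℓ) (ι : ℚ → CommutativeRing.Carrier K)
    (hom : IsRingMap K ι) (x : CommutativeRing.Carrier K) (N : ℕ) where
  open CommutativeRing K hiding (zero)
  open RingProperties ring
  open SetoidReasoning setoid
  open Newton K ι hom x

  -- At `n = N` only the constant coefficient survives, so it is 0. For larger `n` the factor
  -- `n - N` is a nonzero rational and cancels, which leaves the same hypothesis for the tail with
  -- base `suc N`.
  newton-vanishes : ∀ N cs → (∀ n → N ℕ.≤ n → Newtonℚ.newton n N cs ≡ 0ℚ) → newton N cs ≈ 0#
  newton-vanishes N []       h = refl
  newton-vanishes N (c ∷ cs) h = begin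
    ι c + (x- fromℕ N) * newton (suc N) cs
      ≈⟨ +-cong (trans (reflexive (≡.cong ι c≡0)) ι.0#-homo)
           (*-congˡ (newton-vanishes (suc N) cs tail)) ⟩
    0# + (x- fromℕ N) * 0# ≈⟨ trans (+-identityˡ _) (zeroʳ _) ⟩
    0#                     ∎
    where
    c≡0 : c ≡ 0ℚ
    c≡0 = ≡.trans (≡.sym (≡.trans
      (≡.cong (λ t → c ℚ.+ t ℚ.* Newtonℚ.newton N (suc N) cs) (ℚ.+-inverseʳ (fromℕ N)))
      (≡.trans (≡.cong (λ t → c ℚ.+ t) (ℚ.*-zeroˡ (Newtonℚ.newton N (suc N) cs)))
        (ℚ.+-identityʳ c))))
      (h N ℕ.≤-refl)
    at : ∀ j → Newtonℚ.newton (N ℕ.+ suc j) (suc N) cs ≡ 0ℚ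
    at j = *-fromℕ-cancelʳ {e} {0ℚ} (suc j) (≡.trans (ℚ.*-comm e (fromℕ (suc j)))
      (≡.trans (≡.sym (≡.trans
        (≡.cong₂ (λ c t → c ℚ.+ t ℚ.* e) c≡0 (m+n-m≡n N (suc j)))
        (ℚ.+-identityˡ (fromℕ (suc j) ℚ.* e))))
        (≡.trans (h (N ℕ.+ suc j) (ℕ.m≤m+n N (suc j))) (≡.sym (ℚ.*-zeroˡ (fromℕ (suc j)))))))
      where
      e = Newtonℚ.newton (N ℕ.+ suc j) (suc N) cs
    tail : ∀ n → suc N ℕ.≤ n → Newtonℚ.newton n (suc N) cs ≡ 0ℚ
    tail n N<n = ≡.subst (λ n → Newtonℚ.newton n (suc N) cs ≡ 0ℚ)
      (≡.trans (ℕ.+-suc N (n ℕ.∸ suc N)) (ℕ.m+[n∸m]≡n N<n)) (at (n ℕ.∸ suc N))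

  -- Some polynomial over ℚ takes the value f n at each n and the value y at x.
  record Interpolates (f : ℕ → ℚ) (y : Carrier) : Set ℓ where
    constructor interpolation
    field
      coefficients : List ℚ
      at-ℕ : ∀ n → f n ≡ Newtonℚ.newton n N coefficients
      at-x : y ≈ newton N coefficients

  interpolates-resp : ∀ {f g y z} → (∀ n → f n ≡ g n) → y ≈ z → Interpolates f y → Interpolates g z
  interpolates-resp e e′ (interpolation cs h h′) =
    interpolation cs (λ n → ≡.trans (≡.sym (e n)) (h n)) (trans (sym e′) h′)

  interpolates-0 : Interpolates (λ _ → 0ℚ) 0#
  interpolates-0 = interpolation [] (λ _ → ≡.refl) refl

  interpolates-1 : Interpolates (λ _ → 1ℚ) 1#
  interpolates-1 = interpolation (1ℚ ∷ [])
    (λ n → ≡.sym (≡.trans (≡.cong (1ℚ ℚ.+_) (ℚ.*-zeroʳ (fromℕ n ℚ.- fromℕ N))) (ℚ.+-identityʳ 1ℚ)))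
    (sym (trans (+-cong ι.1#-homo (zeroʳ _)) (+-identityʳ 1#)))

  interpolates-+ : ∀ {f g y z} → Interpolates f y → Interpolates g z →
    Interpolates (λ n → f n ℚ.+ g n) (y + z)
  interpolates-+ (interpolation cs h h′) (interpolation ds i i′) = interpolation (cs +ᵖ ds)
    (λ n → ≡.trans (≡.cong₂ ℚ._+_ (h n) (i n)) (≡.sym (Newtonℚ.newton-+ n N cs ds)))
    (trans (+-cong h′ i′) (sym (newton-+ N cs ds)))

  interpolates-scale : ∀ q {f y} → Interpolates f y → Interpolates (λ n → q ℚ.* f n) (ι q * y)
  interpolates-scale q (interpolation cs h h′) = interpolation (q ·ᵖ cs)
    (λ n → ≡.trans (≡.cong (λ t → q ℚ.* t) (h n)) (≡.sym (Newtonℚ.newton-· n N q cs)))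
    (trans (*-congˡ h′) (sym (newton-· N q cs)))

  interpolates-linear : ∀ q {f y} → Interpolates f y →
    Interpolates (λ n → (fromℕ n ℚ.- q) ℚ.* f n) ((x - ι q) * y)
  interpolates-linear q (interpolation cs h h′) = interpolation (linear N q cs)
    (λ n → ≡.trans (≡.cong (λ t → (fromℕ n ℚ.- q) ℚ.* t) (h n))
                   (≡.sym (Newtonℚ.newton-linear n N q cs)))
    (trans (*-congˡ h′) (sym (newton-linear N q cs)))

  -- The two coefficient lists may differ in form; `newton-vanishes` is applied to the list of their
  -- difference.
  interpolates-unique : ∀ {f g y z} → Interpolates f y → Interpolates g z →
    (∀ n → N ℕ.≤ n → f n ≡ g n) → y ≈ z
  interpolates-unique {f} {g} {y} {z} p q e = difference
    (interpolates-+ p (interpolates-scale (ℚ.- 1ℚ) q))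
    where
    difference : Interpolates (λ n → f n ℚ.+ (ℚ.- 1ℚ) ℚ.* g n) (y + ι (ℚ.- 1ℚ) * z) → y ≈ z
    difference (interpolation cs h h′) = x∙y⁻¹≈ε⇒x≈y y z (begin
      y - z                 ≈⟨ +-congˡ (trans (sym (-1*x≈-x z))
                                 (*-congʳ (sym (trans (ι.-‿homo 1ℚ) (-‿cong ι.1#-homo))))) ⟩
      y + ι (ℚ.- 1ℚ) * z    ≈⟨ h′ ⟩
      newton N cs           ≈⟨ newton-vanishes N cs (λ n l → ≡.trans (≡.sym (h n)) (cancel n l)) ⟩
      0#                    ∎)
      where
      cancel : ∀ n → N ℕ.≤ n → f n ℚ.+ (ℚ.- 1ℚ) ℚ.* g n ≡ 0ℚ
      cancel n l = ≡.trans
        (≡.cong₂ ℚ._+_ (e n l) (RingProperties.-1*x≈-x (CommutativeRing.ring ℚ.+-*-commutativeRing) (g n)))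
        (ℚ.+-inverseʳ (g n))

-- Polynomial dependence of the structure sums on x

module StructureTransfer {c ℓ : Level} (K : CommutativeRing c ℓ) (ι : ℚ → CommutativeRing.Carrier K)
    (hom : IsRingMap K ι) (x : CommutativeRing.Carrier K) (N r k : ℕ) where
  open CommutativeRing K hiding (zero)
  open Newton K ι hom x using (module ι)
  open Transfer K ι hom x N
  open MultisetPartitionAlgebra K ι x r k using (falling)
  open StructureSums K ι x r k
  open Summation commutativeSemiring
  private
    module Algebraℚ n = MultisetPartitionAlgebra ℚ.+-*-commutativeRing (λ q → q) (fromℕ n) r k
    module Sumsℚ n = StructureSums ℚ.+-*-commutativeRing (λ q → q) (fromℕ n) r k
    module ∑ℚ = Summation ℚ-semiring

  falling-cong : ∀ {t t′} s → t ≈ t′ → falling t s ≈ falling t′ s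
  falling-cong zero    e = refl
  falling-cong (suc s) e = *-cong e (falling-cong s (+-congʳ e))

  -- The falling factorial acts as a multiplier on a given polynomial, so it is applied one linear
  -- factor at a time; lowering the argument `x - q` by 1 means raising `q` by 1. The lemmas on
  -- brackets, weights and `lies-over` have the same form and therefore compose into products.
  interpolates-falling : ∀ q s {f y} → Interpolates f y →
    Interpolates (λ n → Algebraℚ.falling n (fromℕ n ℚ.- q) s ℚ.* f n) (falling (x - ι q) s * y)
  interpolates-falling q zero    {f} {y} p =
    interpolates-resp (λ n → ≡.sym (ℚ.*-identityˡ (f n))) (sym (*-identityˡ y)) p
  interpolates-falling q (suc s) {f} {y} p = interpolates-resp
    (λ n → ≡.trans
      (≡.cong (λ t → (fromℕ n ℚ.- q) ℚ.* (Algebraℚ.falling n t s ℚ.* f n)) (next n))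
      (≡.sym (ℚ.*-assoc (fromℕ n ℚ.- q) (Algebraℚ.falling n (fromℕ n ℚ.- q ℚ.- 1ℚ) s) (f n))))
    (trans (*-congˡ (*-congʳ (falling-cong s next-x))) (sym (*-assoc _ _ y)))
    (interpolates-linear q (interpolates-falling (q ℚ.+ 1ℚ) s p))
    where
    next : ∀ n → fromℕ n ℚ.- (q ℚ.+ 1ℚ) ≡ fromℕ n ℚ.- q ℚ.- 1ℚ
    next n = ≡.trans (≡.cong (λ t → fromℕ n ℚ.+ t) (ℚ.neg-distrib-+ q 1ℚ))
      (≡.sym (ℚ.+-assoc (fromℕ n) (ℚ.- q) (ℚ.- 1ℚ)))
    next-x : x - ι (q ℚ.+ 1ℚ) ≈ x - ι q - 1#
    next-x = trans (+-congˡ (trans (-‿cong (trans (ι.+-homo q 1ℚ) (+-congˡ ι.1#-homo)))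
      (sym (-‿+-comm (ι q) 1#)))) (sym (+-assoc x _ _))
      where open RingProperties ring

  interpolates-⟦⟧ : ∀ {P : Set} (d : Dec P) {f y} → Interpolates f y →
    Interpolates (λ n → ∑ℚ.⟦ d ⟧ ℚ.* f n) (⟦ d ⟧ * y)
  interpolates-⟦⟧ (yes _) {f} {y} p =
    interpolates-resp (λ n → ≡.sym (ℚ.*-identityˡ (f n))) (sym (*-identityˡ y)) p
  interpolates-⟦⟧ (no _) {f} {y} p =
    interpolates-resp (λ n → ≡.sym (ℚ.*-zeroˡ (f n))) (sym (zeroˡ y)) interpolates-0

  interpolates-∑ : ∀ {A : Set} (xs : List A) {f : ℕ → A → ℚ} {y} →
    (∀ u → Interpolates (λ n → f n u) (y u)) → Interpolates (λ n → ∑ℚ.∑ xs (f n)) (∑ xs y)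
  interpolates-∑ []       h = interpolates-0
  interpolates-∑ (u ∷ us) h = interpolates-+ (h u) (interpolates-∑ us h)

  interpolates-weight : ∀ ν {f y} → Interpolates f y →
    Interpolates (λ n → Sumsℚ.weight n ν ℚ.* f n) (weight ν * y)
  interpolates-weight ν {f} {y} p = interpolates-resp
    (λ n → weight-assoc ℚ-semiring (a ν) (Algebraℚ.falling n (fromℕ n ℚ.- q) s) (1 /m! β ν) (f n))
    (weight-assoc commutativeSemiring (ι (a ν)) (falling (x - ι q) s) (ι (1 /m! β ν)) y)
    (interpolates-scale (a ν) (interpolates-falling q s (interpolates-scale (1 /m! β ν) p)))
    where
    q = + length (blocks (ν ↾ σ₁₃)) ℚ./ 1
    s = length (β ν)

  interpolates-lies-over : ∀ π γ ν {f y} → Interpolates f y →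
    Interpolates (λ n → Sumsℚ.lies-over n π γ ν ℚ.* f n) (lies-over π γ ν * y)
  interpolates-lies-over π γ ν {f} {y} p = interpolates-resp
    (λ n → ≡.sym (ℚ.*-assoc ∑ℚ.⟦ ν ↾ σ₁₂ ≋? π ⟧ ∑ℚ.⟦ ν ↾ σ₂₃ ≋? γ ⟧ (f n)))
    (sym (*-assoc _ _ y))
    (interpolates-⟦⟧ (ν ↾ σ₁₂ ≋? π) (interpolates-⟦⟧ (ν ↾ σ₂₃ ≋? γ) p))

  interpolates-structureConstant : ∀ π γ ρ →
    Interpolates (λ n → Sumsℚ.structureConstant n π γ ρ) (structureConstant π γ ρ)
  interpolates-structureConstant π γ ρ = interpolates-∑ Γs λ ν →
    interpolates-lies-over π γ ν (interpolates-weight ν (interpolates-resp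
      (λ n → ℚ.*-identityʳ ∑ℚ.⟦ ν ↾ σ₁₃ ≋? ρ ⟧) (*-identityʳ ⟦ ν ↾ σ₁₃ ≋? ρ ⟧)
      (interpolates-⟦⟧ (ν ↾ σ₁₃ ≋? ρ) interpolates-1)))

  interpolates-leftSum : ∀ π γ τ ρ →
    Interpolates (λ n → Sumsℚ.leftSum n π γ τ ρ) (leftSum π γ τ ρ)
  interpolates-leftSum π γ τ ρ = interpolates-∑ Γs λ ν →
    interpolates-lies-over π γ ν (interpolates-weight ν
      (interpolates-structureConstant (ν ↾ σ₁₃) τ ρ))

  interpolates-rightSum : ∀ π γ τ ρ →
    Interpolates (λ n → Sumsℚ.rightSum n π γ τ ρ) (rightSum π γ τ ρ)
  interpolates-rightSum π γ τ ρ = interpolates-∑ Γs λ ν →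
    interpolates-lies-over γ τ ν (interpolates-weight ν
      (interpolates-structureConstant π (ν ↾ σ₁₃) ρ))

-- From structure constants to the bilinear product

module Associativity {c ℓ : Level} (K : CommutativeRing c ℓ) (ι : ℚ → CommutativeRing.Carrier K)
    (hom : IsRingMap K ι) (x : CommutativeRing.Carrier K) (r k : ℕ) where
  open CommutativeRing K hiding (zero)
  open SetoidReasoning setoid
  open MultisetPartitionAlgebra K ι x r k hiding (_·_)
  open MultisetPartitionAlgebra K ι x r k using () renaming (_·_ to _∙_)
  open StructureSums K ι x r k
  open Summation commutativeSemiring
  open CommutativeSemigroupProperties +-commutativeSemigroup using (interchange)
  open CommutativeSemigroupProperties (CommutativeMonoid.commutativeSemigroup *-commutativeMonoid)
    using (x∙yz≈y∙xz)

  leftSum≈rightSum : ∀ π γ τ ρ → leftSum π γ τ ρ ≈ rightSum π γ τ ρ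
  leftSum≈rightSum π γ τ ρ = interpolates-unique
    (interpolates-leftSum π γ τ ρ) (interpolates-rightSum π γ τ ρ)
    (λ n → AtNatural.leftSum≡rightSum n r k π γ τ ρ)
    where
    -- The least `n` for which an array of type `ρ` exists, taken as the base of Newton's form.
    N = length (blocks ρ)
    open Transfer K ι hom x N
    open StructureTransfer K ι hom x N r k

  evaluate-filter : ∀ F {A : Set} {P : A → Set} (P? : Decidable P) (h : A → MP) xs →
    evaluate F (concatMap h (filter P? xs)) ≈ ∑ xs (λ y → ⟦ P? y ⟧ * evaluate F (h y))
  evaluate-filter F P? h []       = refl
  evaluate-filter F P? h (y ∷ xs) with P? y
  ... | yes _ = trans (evaluate-++ F (h y) _)
    (+-cong (sym (*-identityˡ _)) (evaluate-filter F P? h xs))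
  ... | no _  = trans (evaluate-filter F P? h xs)
    (trans (sym (+-identityˡ _)) (+-congʳ (sym (zeroˡ _))))

  evaluate-basisProduct : ∀ F π γ → evaluate F (basisProduct π γ) ≈
    ∑ Γs (λ ν → lies-over π γ ν * (weight ν * F (ν ↾ σ₁₃)))
  evaluate-basisProduct F π γ = trans (evaluate-filter F _ _ Γs) (∑-cong Γs λ ν →
    *-cong (⟦⟧-× (ν ↾ σ₁₂ ≋? π) (ν ↾ σ₂₃ ≋? γ))
           (trans (+-identityʳ _) (*-congʳ (*-identityʳ _))))

  δ≈⟦⟧ : ∀ ρ π → Dec (π ≋ ρ) → δ ρ π ≈ ⟦ π ≋? ρ ⟧
  δ≈⟦⟧ ρ π (yes p) = trans (δ≈1 ρ π p) (sym (⟦⟧-yes (π ≋? ρ) p))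
  δ≈⟦⟧ ρ π (no ¬p) = trans (δ≈0 ρ π ¬p) (sym (⟦⟧-no (π ≋? ρ) ¬p))

  product-coefficient : ∀ ρ π γ → evaluate (δ ρ) (basisProduct π γ) ≈ structureConstant π γ ρ
  product-coefficient ρ π γ = trans (evaluate-basisProduct (δ ρ) π γ) (∑-cong Γs λ ν →
    *-congˡ (*-congˡ (δ≈⟦⟧ ρ (ν ↾ σ₁₃) (ν ↾ σ₁₃ ≋? ρ))))

  basis-associative : ∀ ρ π γ τ →
    evaluate (λ μ → evaluate (δ ρ) (basisProduct μ τ)) (basisProduct π γ) ≈
    evaluate (λ μ → evaluate (δ ρ) (basisProduct π μ)) (basisProduct γ τ)
  basis-associative ρ π γ τ = begin
    evaluate (λ μ → evaluate (δ ρ) (basisProduct μ τ)) (basisProduct π γ)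
      ≈⟨ trans (evaluate-basisProduct _ π γ) (∑-cong Γs λ ν →
           *-congˡ (*-congˡ (product-coefficient ρ (ν ↾ σ₁₃) τ))) ⟩
    leftSum π γ τ ρ  ≈⟨ leftSum≈rightSum π γ τ ρ ⟩
    rightSum π γ τ ρ
      ≈⟨ trans (evaluate-basisProduct _ γ τ) (∑-cong Γs λ ν →
           *-congˡ (*-congˡ (product-coefficient ρ π (ν ↾ σ₁₃)))) ⟨
    evaluate (λ μ → evaluate (δ ρ) (basisProduct π μ)) (basisProduct γ τ) ∎

  evaluate-linear : ∀ c F G u →
    evaluate (λ π → c * F π + G π) u ≈ c * evaluate F u + evaluate G u
  evaluate-linear c F G []            = sym (trans (+-identityʳ _) (zeroʳ c))
  evaluate-linear c F G ((d , π) ∷ u) = begin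
    d * (c * F π + G π) + evaluate (λ π → c * F π + G π) u
      ≈⟨ +-cong (trans (distribˡ d _ _) (+-congʳ (x∙yz≈y∙xz d c (F π)))) (evaluate-linear c F G u) ⟩
    c * (d * F π) + d * G π + (c * evaluate F u + evaluate G u) ≈⟨ interchange _ _ _ _ ⟩
    c * (d * F π) + c * evaluate F u + (d * G π + evaluate G u) ≈⟨ +-congʳ (distribˡ c _ _) ⟨
    c * (d * F π + evaluate F u) + (d * G π + evaluate G u) ∎

  evaluate-0 : ∀ u → evaluate (λ _ → 0#) u ≈ 0#
  evaluate-0 []            = refl
  evaluate-0 ((c , π) ∷ u) = trans (+-cong (zeroʳ c) (evaluate-0 u)) (+-identityˡ 0#)

  -- In (uv)w the sum over w lies inside the sum over the product of two basis elements; exchanging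
  -- them isolates a triple of basis elements.
  evaluate-swap : ∀ (s : Π r k → Π r k → Carrier) u v →
    evaluate (λ π → evaluate (s π) v) u ≈ evaluate (λ τ → evaluate (λ π → s π τ) u) v
  evaluate-swap s []            v = sym (evaluate-0 v)
  evaluate-swap s ((c , π) ∷ u) v =
    trans (+-congˡ (evaluate-swap s u v)) (sym (evaluate-linear c (s π) _ v))

  associative : Associative _≈ᴹ_ _∙_
  associative u v w ρ = begin
    coefficient ((u ∙ v) ∙ w) ρ
      ≈⟨ trans (coefficient≈evaluate ((u ∙ v) ∙ w) ρ) (evaluate-· (δ ρ) (u ∙ v) w) ⟩
    evaluate (λ μ → evaluate (s μ) w) (u ∙ v)
      ≈⟨ evaluate-· (λ μ → evaluate (s μ) w) u v ⟩
    evaluate (λ π → evaluate (λ γ → evaluate (λ μ → evaluate (s μ) w) (basisProduct π γ)) v) u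
      ≈⟨ evaluate-congˡ (λ π → evaluate-congˡ (λ γ →
           trans (evaluate-swap s (basisProduct π γ) w)
             (evaluate-congˡ (λ τ → basis-associative ρ π γ τ) w)) v) u ⟩
    evaluate (λ π → evaluate (λ γ → evaluate (λ τ → evaluate (s π) (basisProduct γ τ)) w) v) u
      ≈⟨ evaluate-congˡ (λ π → evaluate-· (s π) v w) u ⟨
    evaluate (λ π → evaluate (s π) (v ∙ w)) u
      ≈⟨ trans (coefficient≈evaluate (u ∙ (v ∙ w)) ρ) (evaluate-· (δ ρ) u (v ∙ w)) ⟨
    coefficient (u ∙ (v ∙ w)) ρ ∎
    where
    s : Π r k → Π r k → Carrier
    s π γ = evaluate (δ ρ) (basisProduct π γ)

module _ {c₁ ℓ₁ c₂ ℓ₂ : Level} (R : CommutativeRing c₁ ℓ₁) (S : CommutativeRing c₂ ℓ₂) where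
  private
    module R = CommutativeRing R
    module S = CommutativeRing S
  open RingMorphisms R.rawRing S.rawRing

  ringHomomorphism : (f : R.Carrier → S.Carrier) → (∀ {a b} → a R.≈ b → f a S.≈ f b) →
    (∀ a b → f (a R.+ b) S.≈ f a S.+ f b) → (∀ a b → f (a R.* b) S.≈ f a S.* f b) →
    f R.0# S.≈ S.0# → f R.1# S.≈ S.1# → (∀ a → f (R.- a) S.≈ S.- f a) → IsRingHomomorphism f
  ringHomomorphism f f-cong f-+ f-* f-0 f-1 f-neg = record
    { isSemiringHomomorphism = record
      { isNearSemiringHomomorphism = record
        { +-isMonoidHomomorphism = record
          { isMagmaHomomorphism = record { isRelHomomorphism = record { cong = f-cong } ; homo = f-+ }
          ; ε-homo = f-0
          }
        ; *-homo = f-*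
        }
      ; 1#-homo = f-1
      }
    ; -‿homo = f-neg
    }

-- The inclusion of ℚ in ℂ(x)

module _ where
  open Reals

  -- The operations on reals act termwise, so sums, products and negatives of constant sequences
  -- have the required terms by computation; only the Cauchy proofs differ.
  constant-sequence : ∀ y q → (∀ n → q ≡ seq y n) → fromℚ q ≈ʳ y
  constant-sequence y q e = null λ ε ε>0 → 0 , λ n _ → ≡.subst (λ t → ℚ.∣ t ∣ ℚ.< ε)
    (≡.sym (≡.trans (≡.cong (λ t → q ℚ.- t) (≡.sym (e n))) (ℚ.+-inverseʳ q))) ε>0

  fromℚ-isRingHomomorphism : IsRingMap realRing fromℚ
  fromℚ-isRingHomomorphism = ringHomomorphism ℚ.+-*-commutativeRing realRing fromℚ
    (λ { ≡.refl → refl })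
    (λ p q → constant-sequence (fromℚ p +ʳ fromℚ q) (p ℚ.+ q) λ _ → ≡.refl)
    (λ p q → constant-sequence (fromℚ p *ʳ fromℚ q) (p ℚ.* q) λ _ → ≡.refl)
    refl refl
    (λ p → constant-sequence (-ʳ fromℚ p) (ℚ.- p) λ _ → ≡.refl)
    where open CommutativeRing realRing using (refl)

module _ {c ℓ : Level} (R : CommutativeRing c ℓ) where
  open CommutativeRing R hiding (zero)
  open RingProperties ring using (-0#≈0#)
  open RingMorphisms using (IsRingHomomorphism)

  module _ where
    open Complexification R

    real-isRingHomomorphism : IsRingHomomorphism rawRing (CommutativeRing.rawRing complexRing) (_+i 0#)
    real-isRingHomomorphism = ringHomomorphism R complexRing (_+i 0#)
      (λ e → e , refl)
      (λ a b → refl , sym (+-identityˡ 0#))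
      (λ a b → sym (trans (+-congˡ (trans (-‿cong (zeroˡ 0#)) -0#≈0#)) (+-identityʳ _))
             , sym (trans (+-cong (zeroʳ a) (zeroˡ b)) (+-identityˡ 0#)))
      (refl , refl) (refl , refl)
      (λ a → refl , sym -0#≈0#)

  module _ where
    open Polynomials R

    constant-isRingHomomorphism :
      IsRingHomomorphism rawRing (CommutativeRing.rawRing polynomialRing) constant
    constant-isRingHomomorphism = ringHomomorphism R polynomialRing constant
      (λ e → coeffwise λ { zero → e ; (suc n) → refl })
      (λ a b → coeffwise λ n → refl)
      (λ a b → coeffwise λ { zero → sym (+-identityʳ (a * b)) ; (suc n) → refl })
      (coeffwise λ { zero → refl ; (suc n) → refl })
      (coeffwise λ n → refl)
      (λ a → coeffwise λ n → refl)

  module _ where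
    open Fractions R

    embed-isRingHomomorphism :
      IsRingHomomorphism rawRing (CommutativeRing.rawRing fractionRing) embed
    embed-isRingHomomorphism = ringHomomorphism R fractionRing embed
      (λ e → cross (*-congʳ e))
      (λ a b → cross (*-cong (sym (+-cong (*-identityʳ a) (*-identityʳ b))) (*-identityˡ 1#)))
      (λ a b → cross (*-congˡ (*-identityˡ 1#)))
      (cross refl) (cross refl)
      (λ a → cross refl)

complex-isRingMap : IsRingMap ℂ.complexRing λ q → Reals.fromℚ q ℂ.+i Reals.fromℚ 0ℚ
complex-isRingMap = Composition.isRingHomomorphism (CommutativeRing.trans ℂ.complexRing)
  fromℚ-isRingHomomorphism (real-isRingHomomorphism Reals.realRing)

polynomial-isRingMap : IsRingMap ℂ[x].polynomialRing
  λ q → ℂ[x].constant (Reals.fromℚ q ℂ.+i Reals.fromℚ 0ℚ)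
polynomial-isRingMap = Composition.isRingHomomorphism (CommutativeRing.trans ℂ[x].polynomialRing)
  complex-isRingMap (constant-isRingHomomorphism ℂ.complexRing)

rational-isRingMap : IsRingMap ℂ⟨x⟩-ring rational
rational-isRingMap = Composition.isRingHomomorphism (CommutativeRing.trans ℂ⟨x⟩-ring)
  polynomial-isRingMap (embed-isRingHomomorphism ℂ[x].polynomialRing)

proposition3p4 : (r k : ℕ) → let open MultisetPartitionAlgebra ℂ⟨x⟩-ring rational indeterminate r k in Associative _≈ᴹ_ _·_
proposition3p4 r k = Associativity.associative ℂ⟨x⟩-ring rational rational-isRingMap indeterminate r k
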